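{- Let $F$ be a fullerene admitting a nontrivial cyclic-$5$-edge cutset (so that $F$ contains two antipodal pentacaps, or is the dodecahedron, the union of two pentacaps). Then $F$ has a Hamilton cycle. Moreover: (i) if the number of hexagonal faces of $F$ is odd, then there exists a path of faces containing precisely two pentagons from each of the two pentacaps of $F$ whose boundary is a Hamilton cycle of $F$; and (ii) if the number of hexagonal faces of $F$ is even, then there exists a path of faces containing precisely six pentagons, two from one pentacap and four from the other, whose boundary is a Hamilton cycle of $F$.
   Context: A fullerene is a $3$-connected cubic planar graph all of whose faces are pentagons and hexagons. A cyclic-$5$-edge cutset is a set of $5$ edges whose removal disconnects the graph into two components each containing a cycle; it is trivial if one of the two components induces a single $5$-cycle, nontrivial otherwise. A pentacap is a pentagonal face together with its five neighbouring faces, all of which are pentagons (a planar graph on $15$ vertices with outer $10$-cycle). A path of faces is a sequence of distinct faces in which consecutive faces share an edge, whose union is a disc; its boundary is the boundary cycle of this disc. A Hamilton cycle is a cycle through all vertices. -}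

module Defs where

open import Data.Nat using (ℕ; zero; suc; _+_; _*_; _≤_)
open import Data.Fin using (Fin; zero; suc; toℕ; inject₁; fromℕ)
open import Data.Bool using (Bool)
open import Data.Product using (Σ; ∃; ∃-syntax; _×_; _,_; proj₁)
open import Data.Sum using (_⊎_)
open import Data.Empty using (⊥)
open import Relation.Nullary using (¬_)
open import Relation.Binary.PropositionalEquality using (_≡_; _≢_)
open import Relation.Binary.Construct.Closure.ReflexiveTransitive using (Star)

-- Cubic combinatorial maps (rotation systems).
-- Vertices are Fin V; the darts (half-edges) at vertex v are (v , i),
-- i : Fin 3 (so the graph is cubic), cyclically ordered by the rotation
-- σ (v , i) = (v , i+1 mod 3).  The involution α pairs the two darts of
-- an edge.  Faces are the orbits of φ = σ ∘ α.

Dart : ℕ → Set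
Dart V = Fin V × Fin 3

vert : ∀ {V} → Dart V → Fin V
vert = proj₁

next3 : Fin 3 → Fin 3
next3 zero = suc zero
next3 (suc zero) = suc (suc zero)
next3 (suc (suc zero)) = zero

σ : ∀ {V} → Dart V → Dart V
σ (v , i) = (v , next3 i)

iter : ∀ {A : Set} → ℕ → (A → A) → A → A
iter zero f x = x
iter (suc k) f x = f (iter k f x)

ExactlyN : ∀ {k} → ℕ → (Fin k → Set) → Set
ExactlyN {k} n P =
  Σ (Fin n → Fin k) λ g →
    (∀ a b → g a ≡ g b → a ≡ b) × (∀ a → P (g a)) × (∀ i → P i → ∃[ a ] g a ≡ i)

record Cycle {V : ℕ} (R : Fin V → Fin V → Set) : Set where
  field
    m     : ℕ
    vtx   : Fin (suc (suc (suc m))) → Fin V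
    inj   : ∀ i j → vtx i ≡ vtx j → i ≡ j
    step  : ∀ (i : Fin (suc (suc m))) → R (vtx (inject₁ i)) (vtx (suc i))
    close : R (vtx (fromℕ (suc (suc m)))) (vtx zero)

CycEdge : ∀ {V} {R : Fin V → Fin V → Set} → Cycle R → Fin V → Fin V → Set
CycEdge C u v =
  (∃[ i ] ((vtx (inject₁ i) ≡ u × vtx (suc i) ≡ v) ⊎ (vtx (inject₁ i) ≡ v × vtx (suc i) ≡ u)))
  ⊎ ((vtx (fromℕ (suc (suc m))) ≡ u × vtx zero ≡ v) ⊎ (vtx (fromℕ (suc (suc m))) ≡ v × vtx zero ≡ u))
  where open Cycle C

module _ {V : ℕ} (α : Dart V → Dart V) where

  φ : Dart V → Dart V
  φ d = σ (α d)

  Adj : Fin V → Fin V → Set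
  Adj u v = ∃[ i ] vert (α (u , i)) ≡ v

  SameFace : Dart V → Dart V → Set
  SameFace d e = ∃[ k ] iter k φ d ≡ e

  FaceLen : Dart V → ℕ → Set
  FaceLen d n = (1 ≤ n) × (iter n φ d ≡ d) × (∀ j → 1 ≤ j → suc j ≤ n → iter j φ d ≢ d)

  Pentagon : Dart V → Set
  Pentagon d = FaceLen d 5

  Hexagon : Dart V → Set
  Hexagon d = FaceLen d 6

  -- the map has exactly n faces whose darts satisfy P
  -- (P is meant to be constant on faces)
  NumFacesWith : (Dart V → Set) → ℕ → Set
  NumFacesWith P n =
    Σ (Fin n → Dart V) λ g →
      (∀ a b → SameFace (g a) (g b) → a ≡ b) × (∀ a → P (g a)) ×
      (∀ d → P d → ∃[ a ] SameFace (g a) d)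

  NumFaces : ℕ → Set
  NumFaces = NumFacesWith (λ _ → Data.Unit.⊤)
    where import Data.Unit

  NumHexFaces : ℕ → Set
  NumHexFaces = NumFacesWith Hexagon

  ConnectedWithout : Fin V → Fin V → Set
  ConnectedWithout x y =
    ∀ u v → u ≢ x → u ≢ y → v ≢ x → v ≢ y →
      Star (λ a b → Adj a b × a ≢ x × a ≢ y × b ≢ x × b ≢ y) u v

  ThreeConnected : Set
  ThreeConnected = (4 ≤ V) × (∀ x y → ConnectedWithout x y)

  -- planarity of the embedding: genus 0, i.e. Euler's formula
  -- V - E + F = 2 with E = 3V/2
  Planar : Set
  Planar = ∃[ f ] (NumFaces f × (2 * V + 2 * f ≡ 3 * V + 4))

  record IsFullerene : Set where
    field
      α-invol   : ∀ d → α (α d) ≡ d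
      loopless  : ∀ d → vert (α d) ≢ vert d
      nomulti   : ∀ v i j → vert (α (v , i)) ≡ vert (α (v , j)) → i ≡ j
      threeConn : ThreeConnected
      planar    : Planar
      faces     : ∀ d → Pentagon d ⊎ Hexagon d

  Removed : ∀ {k} → (Fin k → Dart V) → Dart V → Set
  Removed es d = ∃[ a ] (d ≡ es a ⊎ α d ≡ es a)

  AdjMinus : ∀ {k} → (Fin k → Dart V) → Fin V → Fin V → Set
  AdjMinus es u v = ∃[ i ] (vert (α (u , i)) ≡ v × ¬ Removed es (u , i))

  Induces5Cycle : (Fin V → Set) → Set
  Induces5Cycle X =
    Σ (Cycle Adj) λ C → (Cycle.m C ≡ 2) ×
      (∀ v → X v → ∃[ i ] Cycle.vtx C i ≡ v) × (∀ i → X (Cycle.vtx C i)) ×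
      (∀ u v → X u → X v → Adj u v → CycEdge C u v)

  Cyclic5Cut : (Fin 5 → Dart V) → (Fin V → Bool) → Set
  Cyclic5Cut es S =
    (∀ a b → es a ≡ es b ⊎ es a ≡ α (es b) → a ≡ b) ×
    (∀ u v → S u ≡ S v → Star (AdjMinus es) u v) ×
    (∀ u v → S u ≢ S v → ¬ Star (AdjMinus es) u v) ×
    (∀ b → ∃[ u ] S u ≡ b) ×
    (∀ b → Σ (Cycle (AdjMinus es)) λ C → ∀ i → S (Cycle.vtx C i) ≡ b)

  HasNontrivialCyclic5Cut : Set
  HasNontrivialCyclic5Cut =
    ∃[ es ] ∃[ S ] (Cyclic5Cut es S × (∀ b → ¬ Induces5Cycle (λ v → S v ≡ b)))

  IsHamiltonCycle : Cycle Adj → Set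
  IsHamiltonCycle C = ∀ v → ∃[ i ] Cycle.vtx C i ≡ v

  HasHamiltonCycle : Set
  HasHamiltonCycle = Σ (Cycle Adj) IsHamiltonCycle

  -- paths of faces; faces are given by representative darts fs i

  module _ {k : ℕ} (fs : Fin k → Dart V) where

    InFaces : Dart V → Set
    InFaces d = ∃[ i ] SameFace (fs i) d

    BoundaryDart : Dart V → Set
    BoundaryDart d = (InFaces d × ¬ InFaces (α d)) ⊎ (InFaces (α d) × ¬ InFaces d)

    BoundaryIs : Cycle Adj → Set
    BoundaryIs C = ∀ d → (BoundaryDart d → CycEdge C (vert d) (vert (α d)))
                       × (CycEdge C (vert d) (vert (α d)) → BoundaryDart d)

    UnionIsDisc : Set
    UnionIsDisc = Σ (Cycle Adj) BoundaryIs

  ShareEdge : Dart V → Dart V → Set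
  ShareEdge f g = ∃[ d ] (SameFace f d × SameFace g (α d))

  IsPathOfFaces : ∀ {k} → (Fin (suc k) → Dart V) → Set
  IsPathOfFaces {k} fs =
    (∀ i j → SameFace (fs i) (fs j) → i ≡ j) ×
    (∀ (i : Fin k) → ShareEdge (fs (inject₁ i)) (fs (suc i))) ×
    UnionIsDisc fs

  -- pentacaps: centre face (of dart c) a pentagon, its five neighbouring
  -- faces (across the edges of the centre) pentagons

  IsPentacap : Dart V → Set
  IsPentacap c = Pentagon c × (∀ (j : Fin 5) → Pentagon (α (iter (toℕ j) φ c)))

  InCap : Dart V → Dart V → Set
  InCap c f = SameFace c f ⊎ ∃[ j ] (SameFace (α (iter (toℕ {5} j) φ c)) f)

  DisjointCaps : Dart V → Dart V → Set
  DisjointCaps c₁ c₂ = ∀ f → InCap c₁ f → InCap c₂ f → ⊥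

  HamFacePath : Dart V → Dart V → ℕ → ℕ → Set
  HamFacePath c₁ c₂ n₁ n₂ =
    ∃[ k ] Σ (Fin (suc k) → Dart V) λ fs → Σ (Cycle Adj) λ H →
      IsPathOfFaces fs × IsHamiltonCycle H × BoundaryIs fs H ×
      ExactlyN n₁ (λ i → Pentagon (fs i) × InCap c₁ (fs i)) ×
      ExactlyN n₂ (λ i → Pentagon (fs i) × InCap c₂ (fs i)) ×
      ExactlyN (n₁ + n₂) (λ i → Pentagon (fs i))

{-# OPTIONS --safe #-}

-- Let S be one side of a cut with k ≤ 5 edges, both sides having at least k vertices. Deleting from the induced
-- graph one edge per inner face keeps it connected, which gives Euler's inequality for both sides; the two add up to
-- Euler's formula, so they are equalities and every face met by the cut is crossed exactly twice. Counting pentagons,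
-- the outer boundary walks of the two sides have total length at most 4k. Removing from S the vertices of its
-- boundary walk gives again a cut with at most k edges if that walk has length at most 2k; by descent there are no
-- such cuts with k ≤ 4, and for k = 5 either a side is a pentagon or both walks have length 10 and the faces met
-- are hexagons. Descending into S therefore ends in a pentacap, and ascending from it passes through rings of five
-- hexagons until the opposite pentacap. The path of faces takes a pentagon, one of its neighbours, and then alternately
-- four faces and one face of the successive rings; vertices and faces met are distinct because they are exhausted
-- by lists of the right length.
module Submission where

open import Defs
open import Data.Nat using (ℕ; zero; suc; _+_; _*_; _∸_; _≤_; _<_; z≤n; s≤s; _≤?_; _≟_; _≤ᵇ_; _<ᵇ_; _%_)
open import Data.Nat.DivMod using ([m+kn]%n≡m%n)
open import Data.Nat.Properties hiding (_≟_)
open import Data.Nat.Tactic.RingSolver using (solve-∀)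
open import Data.Fin using (Fin; zero; suc; toℕ; fromℕ<; inject₁; fromℕ)
open import Data.Fin.Properties using (toℕ-fromℕ<; toℕ-injective; toℕ<n; fromℕ≢inject₁)
open import Data.Bool using (Bool; true; false; _∧_; _∨_; not; if_then_else_) renaming (T to So)
open import Data.Bool.Properties using (not-involutive; ∧-zeroʳ; ∨-zeroʳ)
open import Data.Product using (∃-syntax; _×_; _,_; proj₁; proj₂)
open import Data.Sum using (_⊎_; inj₁; inj₂)
open import Data.Empty using (⊥; ⊥-elim)
open import Data.Unit using (⊤; tt)
open import Data.Vec using (Vec; []; _∷_)
import Data.Vec as Vec
open import Data.List using (List; []; _∷_; _++_; map; length; lookup; cartesianProduct)
open import Data.List.Properties using (length-++; map-++; length-map)
open import Data.List.Membership.Propositional using (_∈_)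
open import Data.List.Membership.Propositional.Properties using (∈-++⁺ˡ; ∈-++⁺ʳ; ∈-++⁻; ∈-map⁺; ∈-map⁻; ∈-lookup)
open import Data.List.Relation.Unary.Any using (here; there; index)
open import Data.List.Relation.Unary.Any.Properties using (lookup-index)
open import Data.List.Relation.Unary.All using (All; []; _∷_)
import Data.List.Relation.Unary.All as All
import Data.List.Relation.Unary.All.Properties as All
open import Data.List.Relation.Unary.AllPairs using ([]; _∷_)
open import Data.List.Relation.Unary.Linked using (Linked; [-]; _∷_)
open import Data.List.Relation.Unary.Unique.Propositional using (Unique)
open import Function using (_∘_)
open import Relation.Nullary using (¬_; yes; no; Dec)
open import Relation.Binary.Definitions using (tri<; tri≈; tri>)
open import Relation.Binary.PropositionalEquality
open import Relation.Binary.Construct.Closure.ReflexiveTransitive using (Star; ε; _◅_)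

-- Finite sums

-- Planarity enters only through the number of faces, so separation is never read off a drawing.
-- Tightness replaces it: when pointwise inequalities have equal totals, `∑-tight` makes them
-- pointwise equalities, and global counts become facts about single faces and vertices. The bound 5
-- on cuts comes from connectivity, since a disconnected side would have two parts with at least
-- three outgoing edges each. `NonDeg` is the numerical form of containing a cycle; it passes to
-- smaller sides by arithmetic, without constructing new cycles. The boundary of the path is
-- Hamiltonian only if no vertex has its three faces all on or all off the path. Two neighbouring
-- faces of a ring with the same status thus force the other status on the face above both. Four
-- faces on the path force three off above them, one face on forces three on, whence the alternation
-- of four and one. There are `5 * k` hexagons in `k` rings, so the parity in the theorem is that of
-- `k`. After the first pentacap the alternation begins with four; for even `k` the last pentacap
-- contributes four pentagons around its centre, for odd `k` one of them and the centre.

𝟙 : Bool → ℕ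
𝟙 true  = 1
𝟙 false = 0

true≢false : true ≢ false
true≢false ()

∧-left : ∀ {a b} → (a ∧ b) ≡ true → a ≡ true
∧-left {true} _ = refl

∧-right : ∀ {a b} → (a ∧ b) ≡ true → b ≡ true
∧-right {true} p = p

∧-both : ∀ {a b} → a ≡ true → b ≡ true → (a ∧ b) ≡ true
∧-both refl refl = refl

not-true : ∀ {a} → not a ≡ true → a ≡ false
not-true {false} _ = refl

¬true⇒false : ∀ {a} → ¬ (a ≡ true) → a ≡ false
¬true⇒false {true}  h = ⊥-elim (h refl)
¬true⇒false {false} h = refl

true⊎false : ∀ a → a ≡ true ⊎ a ≡ false
true⊎false true  = inj₁ refl
true⊎false false = inj₂ refl

𝟙≤1 : ∀ a → 𝟙 a ≤ 1
𝟙≤1 true  = s≤s z≤n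
𝟙≤1 false = z≤n

𝟙-pos : ∀ {a} → 1 ≤ 𝟙 a → a ≡ true
𝟙-pos {true} _ = refl

𝟙-true : ∀ {a} → a ≡ true → 𝟙 a ≡ 1
𝟙-true refl = refl

𝟙-false : ∀ {a} → a ≡ false → 𝟙 a ≡ 0
𝟙-false refl = refl

Bool-ext : ∀ {a b} → (a ≡ true → b ≡ true) → (b ≡ true → a ≡ true) → a ≡ b
Bool-ext {true}  {true}  f g = refl
Bool-ext {true}  {false} f g = sym (f refl)
Bool-ext {false} {true}  f g = g refl
Bool-ext {false} {false} f g = refl

sumL : ∀ {A : Set} → List A → (A → ℕ) → ℕ
sumL []       f = 0
sumL (x ∷ xs) f = f x + sumL xs f

module _ {A : Set} where

  sumL-cong : ∀ {f g : A → ℕ} xs → (∀ x → f x ≡ g x) → sumL xs f ≡ sumL xs g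
  sumL-cong []       h = refl
  sumL-cong (x ∷ xs) h = cong₂ _+_ (h x) (sumL-cong xs h)

  sumL-mono : ∀ {f g : A → ℕ} xs → (∀ x → f x ≤ g x) → sumL xs f ≤ sumL xs g
  sumL-mono []       h = z≤n
  sumL-mono (x ∷ xs) h = +-mono-≤ (h x) (sumL-mono xs h)

  +-interchange : ∀ a b c d → (a + b) + (c + d) ≡ (a + c) + (b + d)
  +-interchange = solve-∀

  sumL-+ : ∀ (f g : A → ℕ) xs → sumL xs (λ x → f x + g x) ≡ sumL xs f + sumL xs g
  sumL-+ f g []       = refl
  sumL-+ f g (x ∷ xs) rewrite sumL-+ f g xs = +-interchange (f x) (g x) (sumL xs f) (sumL xs g)

  sumL-0 : ∀ (xs : List A) → sumL xs (λ _ → 0) ≡ 0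
  sumL-0 []       = refl
  sumL-0 (x ∷ xs) = sumL-0 xs

  sumL-*ʳ : ∀ (f : A → ℕ) c xs → sumL xs (λ x → f x * c) ≡ sumL xs f * c
  sumL-*ʳ f c []       = refl
  sumL-*ʳ f c (x ∷ xs) rewrite sumL-*ʳ f c xs = sym (*-distribʳ-+ c (f x) (sumL xs f))

  sumL-++ : ∀ (f : A → ℕ) xs ys → sumL (xs ++ ys) f ≡ sumL xs f + sumL ys f
  sumL-++ f []       ys = refl
  sumL-++ f (x ∷ xs) ys rewrite sumL-++ f xs ys = sym (+-assoc (f x) _ _)

  sumL-witness : ∀ (P : A → Bool) xs → 1 ≤ sumL xs (λ x → 𝟙 (P x)) → ∃[ x ] P x ≡ true
  sumL-witness P (x ∷ xs) h with P x in eq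
  ... | true  = x , eq
  ... | false = sumL-witness P xs h

sumL-map : ∀ {A B : Set} (h : A → B) (f : B → ℕ) xs → sumL (map h xs) f ≡ sumL xs (λ x → f (h x))
sumL-map h f []       = refl
sumL-map h f (x ∷ xs) = cong (f (h x) +_) (sumL-map h f xs)

sumL-swap : ∀ {A B : Set} (f : A → B → ℕ) xs ys →
  sumL xs (λ x → sumL ys (f x)) ≡ sumL ys (λ y → sumL xs (λ x → f x y))
sumL-swap f []       ys = sym (sumL-0 ys)
sumL-swap f (x ∷ xs) ys rewrite sumL-swap f xs ys = sym (sumL-+ (f x) (λ y → sumL xs (λ z → f z y)) ys)

sumL-× : ∀ {A B : Set} (f : A × B → ℕ) xs ys →
  sumL (cartesianProduct xs ys) f ≡ sumL xs (λ x → sumL ys (λ y → f (x , y)))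
sumL-× f []       ys = refl
sumL-× f (x ∷ xs) ys = trans (sumL-++ f (map (x ,_) ys) _)
  (cong₂ _+_ (sumL-map (x ,_) f ys) (sumL-× f xs ys))

-- Finiteness in a form made for counting: `once` says that `els` lists every element exactly once
-- up to Boolean equality, so cardinalities are sums of `𝟙` and double counting is an exchange of
-- sums.
record Enum (A : Set) : Set where
  infix 4 _==_
  field
    els   : List A
    _==_  : A → A → Bool
    ==-refl  : ∀ x → (x == x) ≡ true
    ==-sound : ∀ {x y} → (x == y) ≡ true → x ≡ y
    once  : ∀ a → sumL els (λ x → 𝟙 (x == a)) ≡ 1

open Enum {{...}} public

_==F_ : ∀ {n} → Fin n → Fin n → Bool
zero  ==F zero  = true
zero  ==F suc _ = false
suc _ ==F zero  = false
suc i ==F suc j = i ==F j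

elsF : ∀ n → List (Fin n)
elsF zero    = []
elsF (suc n) = zero ∷ map suc (elsF n)

==F-refl : ∀ {n} (x : Fin n) → (x ==F x) ≡ true
==F-refl zero    = refl
==F-refl (suc x) = ==F-refl x

==F-sound : ∀ {n} {x y : Fin n} → (x ==F y) ≡ true → x ≡ y
==F-sound {x = zero}  {zero}  _ = refl
==F-sound {x = suc x} {suc y} h = cong suc (==F-sound h)

onceF : ∀ n (a : Fin n) → sumL (elsF n) (λ x → 𝟙 (x ==F a)) ≡ 1
onceF (suc n) zero    = cong suc (trans (sumL-map suc _ (elsF n)) (sumL-0 (elsF n)))
onceF (suc n) (suc a) = trans (sumL-map suc _ (elsF n)) (onceF n a)

instance
  EnumFin : ∀ {n} → Enum (Fin n)
  EnumFin {n} = record { els = elsF n ; _==_ = _==F_ ; ==-refl = ==F-refl ; ==-sound = ==F-sound ; once = onceF n }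

∧-𝟙 : ∀ a b → 𝟙 (a ∧ b) ≡ 𝟙 a * 𝟙 b
∧-𝟙 true  b = sym (+-identityʳ (𝟙 b))
∧-𝟙 false b = refl

once× : ∀ {A B : Set} (EA : Enum A) (EB : Enum B) (p : A × B) →
  sumL (cartesianProduct (Enum.els EA) (Enum.els EB)) (λ q → 𝟙 (Enum._==_ EA (proj₁ q) (proj₁ p) ∧ Enum._==_ EB (proj₂ q) (proj₂ p))) ≡ 1
once× {A} {B} EA EB (a , b) = begin
  sumL (cartesianProduct xs ys) (λ q → 𝟙 (eqA (proj₁ q) a ∧ eqB (proj₂ q) b))
    ≡⟨ sumL-× (λ q → 𝟙 (eqA (proj₁ q) a ∧ eqB (proj₂ q) b)) xs ys ⟩
  sumL xs (λ x → sumL ys (λ y → 𝟙 (eqA x a ∧ eqB y b)))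
    ≡⟨ sumL-cong xs row ⟩
  sumL xs (λ x → 𝟙 (eqA x a))
    ≡⟨ Enum.once EA a ⟩
  1 ∎
  where
  open ≡-Reasoning
  xs = Enum.els EA
  ys = Enum.els EB
  eqA = Enum._==_ EA
  eqB = Enum._==_ EB
  row : ∀ x → sumL ys (λ y → 𝟙 (eqA x a ∧ eqB y b)) ≡ 𝟙 (eqA x a)
  row x with eqA x a
  ... | true  = Enum.once EB b
  ... | false = sumL-0 ys

instance
  Enum× : ∀ {A B : Set} {{_ : Enum A}} {{_ : Enum B}} → Enum (A × B)
  Enum× {{EA}} {{EB}} = record
    { els   = cartesianProduct els els
    ; _==_  = λ p q → (proj₁ p == proj₁ q) ∧ (proj₂ p == proj₂ q)
    ; ==-refl  = λ p → ∧-both (==-refl (proj₁ p)) (==-refl (proj₂ p))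
    ; ==-sound = λ h → cong₂ _,_ (==-sound (∧-left h)) (==-sound (∧-right h))
    ; once  = once× EA EB
    }

opaque

  ∑ : ∀ {A : Set} {{_ : Enum A}} → (A → ℕ) → ℕ
  ∑ f = sumL els f

# : ∀ {A : Set} {{_ : Enum A}} → (A → Bool) → ℕ
# P = ∑ (λ x → 𝟙 (P x))

opaque
  unfolding ∑

  ∑-cong : ∀ {A : Set} {{_ : Enum A}} {f g : A → ℕ} → (∀ x → f x ≡ g x) → ∑ f ≡ ∑ g
  ∑-cong = sumL-cong els

  ∑-mono : ∀ {A : Set} {{_ : Enum A}} {f g : A → ℕ} → (∀ x → f x ≤ g x) → ∑ f ≤ ∑ g
  ∑-mono = sumL-mono els

  ∑-+ : ∀ {A : Set} {{_ : Enum A}} (f g : A → ℕ) → ∑ (λ x → f x + g x) ≡ ∑ f + ∑ g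
  ∑-+ f g = sumL-+ f g els

  ∑-*ʳ : ∀ {A : Set} {{_ : Enum A}} (f : A → ℕ) c → ∑ (λ x → f x * c) ≡ ∑ f * c
  ∑-*ʳ f c = sumL-*ʳ f c els

  ∑-0 : ∀ {A : Set} {{_ : Enum A}} → ∑ {A} (λ _ → 0) ≡ 0
  ∑-0 {{E}} = sumL-0 (Enum.els E)

  #-== : ∀ {A : Set} {{_ : Enum A}} (a : A) → # (λ x → x == a) ≡ 1
  #-== = once

  #-witness : ∀ {A : Set} {{_ : Enum A}} (P : A → Bool) → 1 ≤ # P → ∃[ x ] P x ≡ true
  #-witness P = sumL-witness P els

  ∑-swap : ∀ {A B : Set} {{_ : Enum A}} {{_ : Enum B}} (f : A → B → ℕ) →
    ∑ (λ x → ∑ (f x)) ≡ ∑ (λ y → ∑ (λ x → f x y))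
  ∑-swap f = sumL-swap f els els

  ∑-× : ∀ {A B : Set} {{_ : Enum A}} {{_ : Enum B}} (f : A × B → ℕ) →
    ∑ f ≡ ∑ (λ x → ∑ (λ y → f (x , y)))
  ∑-× f = sumL-× f els els

  ∑-Fin0 : ∀ (f : Fin 0 → ℕ) → ∑ f ≡ 0
  ∑-Fin0 f = refl

  ∑-Fin-suc : ∀ {n} (f : Fin (suc n) → ℕ) → ∑ f ≡ f zero + ∑ (λ i → f (suc i))
  ∑-Fin-suc {n} f = cong (f zero +_) (sumL-map suc f (elsF n))

  ∑-sumL : ∀ {A B : Set} {{_ : Enum A}} (f : A → B → ℕ) ys →
    ∑ (λ x → sumL ys (f x)) ≡ sumL ys (λ y → ∑ (λ x → f x y))
  ∑-sumL f ys = sumL-swap f els ys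

module _ {A : Set} {{EA : Enum A}} where

  ==-false : ∀ {x y : A} → x ≢ y → (x == y) ≡ false
  ==-false h = ¬true⇒false (λ e → h (==-sound e))

  ==-≢ : ∀ {x y : A} → (x == y) ≡ false → x ≢ y
  ==-≢ {x} h refl = true≢false (trans (sym (==-refl x)) h)

  ==-≡ : ∀ {x y : A} → x ≡ y → (x == y) ≡ true
  ==-≡ {x} refl = ==-refl x

  _≟E_ : (x y : A) → Dec (x ≡ y)
  x ≟E y with x == y in eq
  ... | true  = yes (==-sound eq)
  ... | false = no (==-≢ eq)

  ==-sym : ∀ (x y : A) → (x == y) ≡ (y == x)
  ==-sym x y = Bool-ext (λ h → ==-≡ (sym (==-sound h))) (λ h → ==-≡ (sym (==-sound h)))

  ∑-select : ∀ a (F : A → ℕ) → ∑ (λ x → 𝟙 (x == a) * F x) ≡ F a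
  ∑-select a F = trans (∑-cong pt) (trans (∑-*ʳ _ (F a)) (trans (cong (_* F a) (#-== a)) (+-identityʳ _)))
    where
    pt : ∀ x → 𝟙 (x == a) * F x ≡ 𝟙 (x == a) * F a
    pt x with x == a in eq
    ... | true  = cong (λ z → F z + 0) (==-sound eq)
    ... | false = refl

  𝟙*≤ : ∀ b m → 𝟙 b * m ≤ m
  𝟙*≤ true  m = ≤-reflexive (+-identityʳ m)
  𝟙*≤ false m = z≤n

  ∑-term : ∀ (F : A → ℕ) a → F a ≤ ∑ F
  ∑-term F a = subst (_≤ ∑ F) (∑-select a F) (∑-mono (λ x → 𝟙*≤ (x == a) (F x)))

  ∑-two : ∀ (F : A → ℕ) {a b} → a ≢ b → F a + F b ≤ ∑ F
  ∑-two F {a} {b} a≢b = subst (_≤ ∑ F) (trans (∑-+ _ _) (cong₂ _+_ (∑-select a F) (∑-select b F))) (∑-mono pt)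
    where
    pt : ∀ x → 𝟙 (x == a) * F x + 𝟙 (x == b) * F x ≤ F x
    pt x with x == a in e₁ | x == b in e₂
    ... | true  | true  = ⊥-elim (a≢b (trans (sym (==-sound e₁)) (==-sound e₂)))
    ... | true  | false = ≤-reflexive (trans (+-identityʳ _) (+-identityʳ _))
    ... | false | c     = 𝟙*≤ c (F x)

  ∑≡0 : ∀ (F : A → ℕ) → ∑ F ≡ 0 → ∀ a → F a ≡ 0
  ∑≡0 F h a = n≤0⇒n≡0 (subst (F a ≤_) h (∑-term F a))

  -- The differences `g x ∸ f x` sum to zero, hence all vanish. This tool turns an equality of
  -- totals into local information.
  ∑-tight : ∀ {f g : A → ℕ} → (∀ x → f x ≤ g x) → ∑ g ≤ ∑ f → ∀ x → f x ≡ g x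
  ∑-tight {f} {g} f≤g h x = ≤-antisym (f≤g x) (m∸n≡0⇒m≤n (∑≡0 (λ x → g x ∸ f x) diff x))
    where
    split : ∑ g ≡ ∑ f + ∑ (λ x → g x ∸ f x)
    split = trans (∑-cong (λ x → sym (m+[n∸m]≡n (f≤g x)))) (∑-+ f _)
    diff : ∑ (λ x → g x ∸ f x) ≡ 0
    diff = n≤0⇒n≡0 (+-cancelˡ-≤ (∑ f) _ 0 (subst₂ _≤_ split (sym (+-identityʳ _)) h))

  search : (P : A → Bool) → (∃[ x ] P x ≡ true) ⊎ (∀ x → P x ≡ false)
  search P with # P in eq
  ... | suc _ = inj₁ (#-witness P (subst (1 ≤_) (sym eq) (s≤s z≤n)))
  ... | zero  = inj₂ (λ x → 𝟙0 (∑≡0 (λ y → 𝟙 (P y)) eq x))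
    where
    𝟙0 : ∀ {b} → 𝟙 b ≡ 0 → b ≡ false
    𝟙0 {false} _ = refl

  #-pos : ∀ (P : A → Bool) {a} → P a ≡ true → 1 ≤ # P
  #-pos P {a} h = subst (_≤ # P) (𝟙-true h) (∑-term (λ x → 𝟙 (P x)) a)

  #-unique : ∀ (P : A → Bool) → # P ≤ 1 → ∀ {a b} → P a ≡ true → P b ≡ true → a ≡ b
  #-unique P h {a} {b} pa pb with a ≟E b
  ... | yes e = e
  ... | no ¬e = ⊥-elim (<-irrefl refl (≤-trans
      (subst₂ (λ m n → m + n ≤ # P) (𝟙-true pa) (𝟙-true pb) (∑-two (λ x → 𝟙 (P x)) ¬e)) h))

module _ {A B : Set} {{EA : Enum A}} {{EB : Enum B}} where

  ∑-fibre : ∀ (h : A → B) (F : A → ℕ) → ∑ (λ b → ∑ (λ a → 𝟙 (b == h a) * F a)) ≡ ∑ F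
  ∑-fibre h F = trans (∑-swap _) (∑-cong (λ a → ∑-select (h a) (λ _ → F a)))

  #-bijection : ∀ (P : A → Bool) (g : B → A) → (∀ x y → g x ≡ g y → x ≡ y) → (∀ b → P (g b) ≡ true) →
    (∀ a → P a ≡ true → ∃[ b ] g b ≡ a) → # P ≡ ∑ {B} (λ _ → 1)
  #-bijection P g inj sound complete =
    -- Double counting of the pairs with `a ≡ g b`: each `a` satisfying `P` has one such `b`, and
    -- each `b` one such `a`.
    trans (∑-cong pt) (trans (∑-swap (λ a b → 𝟙 (a == g b))) (∑-cong (λ b → #-== (g b))))
    where
    pt : ∀ a → 𝟙 (P a) ≡ ∑ (λ b → 𝟙 (a == g b))
    pt a with P a in eq
    ... | true  = let (b , e) = complete a eq in
      sym (trans (∑-cong (λ b' → cong 𝟙 (Bool-ext (λ h → ==-≡ (inj b' b (trans (sym (==-sound h)) (sym e))))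
                                                   (λ h → ==-≡ (trans (sym e) (cong g (sym (==-sound h))))))))
                 (#-== b))
    ... | false = sym (trans (∑-cong (λ b → 𝟙-false (==-false (λ e → true≢false
                    (trans (sym (sound b)) (trans (cong P (sym e)) eq)))))) ∑-0)

-- Each `F (α x)` is written as a sum over `e` that selects `e ≡ α x`; after the exchange of sums
-- the condition reads `x ≡ α e`.
∑-involution : ∀ {A : Set} {{EA : Enum A}} (α : A → A) → (∀ x → α (α x) ≡ x) → (F : A → ℕ) →
  ∑ (λ x → F (α x)) ≡ ∑ F
∑-involution α inv F =
  trans (∑-cong (λ x → sym (∑-select (α x) F)))
 (trans (∑-swap _)
        (∑-cong (λ e → trans (∑-cong (λ x → cong (λ b → 𝟙 b * F e)
             (Bool-ext (λ h → ==-≡ (trans (sym (inv x)) (cong α (sym (==-sound h)))))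
                       (λ h → ==-≡ (trans (sym (inv e)) (cong α (sym (==-sound h))))))))
           (∑-select (α e) (λ _ → F e)))))

∑1-Fin : ∀ n → ∑ {Fin n} (λ _ → 1) ≡ n
∑1-Fin zero    = ∑-Fin0 _
∑1-Fin (suc n) = trans (∑-Fin-suc _) (cong suc (∑1-Fin n))

module _ {A : Set} {{EA : Enum A}} where

  occ : A → List A → ℕ
  occ a xs = sumL xs (λ x → 𝟙 (a == x))

  occ-∈ : ∀ {a xs} → a ∈ xs → 1 ≤ occ a xs
  occ-∈ {a} (here refl) rewrite ==-refl a = s≤s z≤n
  occ-∈ (there p) = ≤-trans (occ-∈ p) (m≤n+m _ _)

  length-sumL : ∀ (xs : List A) → sumL xs (λ _ → 1) ≡ length xs
  length-sumL []       = refl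
  length-sumL (x ∷ xs) = cong suc (length-sumL xs)

  ∑-occ : ∀ xs → ∑ (λ a → occ a xs) ≡ length xs
  ∑-occ xs = trans (∑-sumL _ xs) (trans (sumL-cong xs #-==) (length-sumL xs))

  occ-unique : ∀ xs → (∀ a → occ a xs ≤ 1) → Unique xs
  occ-unique []       h = []
  occ-unique (x ∷ xs) h = fresh xs (λ p → <-irrefl refl (≤-trans (s≤s (occ-∈ p)) (subst (_≤ 1) (cong (λ b → 𝟙 b + occ x xs) (==-refl x)) (h x))))
                        ∷ occ-unique xs (λ a → ≤-trans (m≤n+m _ _) (h a))
    where
    fresh : ∀ {x} ys → ¬ (x ∈ ys) → All (x ≢_) ys
    fresh []       p = []
    fresh (y ∷ ys) p = (λ e → p (here e)) ∷ fresh ys (λ q → p (there q))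

  #-list-unique : ∀ (P : A → Bool) xs → (∀ a → P a ≡ true → a ∈ xs) → length xs ≤ # P → Unique xs
  #-list-unique P xs cov len = occ-unique xs (λ a → subst (_≤ 1) (∑-tight le bound a) (𝟙≤1 (P a)))
    where
    -- A covering list has multiplicities at least `𝟙 (P a)`, and their total is its length. If that
    -- is at most `# P`, all are equal and nothing repeats. Distinctness of vertices and faces is
    -- later obtained this way, without comparing any two of them.
    le : ∀ a → 𝟙 (P a) ≤ occ a xs
    le a with P a in eq
    ... | true  = occ-∈ (cov a eq)
    ... | false = z≤n
    bound : ∑ (λ a → occ a xs) ≤ # P
    bound = subst (_≤ # P) (sym (∑-occ xs)) len

  unique-occ : ∀ {xs : List A} → Unique xs → ∀ a → occ a xs ≤ 1
  unique-occ []       a = z≤n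
  unique-occ {x ∷ xs} (px ∷ u) a with a == x in eq
  ... | false = unique-occ u a
  ... | true  = s≤s (subst (_≤ 0) refl (absent xs (subst (λ z → All (z ≢_) xs) (sym (==-sound eq)) px)))
    where
    absent : ∀ ys → All (a ≢_) ys → occ a ys ≤ 0
    absent []       []       = z≤n
    absent (y ∷ ys) (p ∷ ps) rewrite ==-false p = absent ys ps

  occ-notin : ∀ (P : A → Bool) {xs a} → All (λ x → P x ≡ true) xs → P a ≡ false → occ a xs ≡ 0
  occ-notin P []       h = refl
  occ-notin P {x ∷ xs} (p ∷ ps) h
    rewrite ==-false (λ e → true≢false (trans (sym p) (trans (cong P (sym e)) h))) = occ-notin P ps h

  #-list-≤ : ∀ (P : A → Bool) {xs} → Unique xs → All (λ x → P x ≡ true) xs → length xs ≤ # P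
  #-list-≤ P {xs} u ps = subst (_≤ # P) (∑-occ xs) (∑-mono le)
    where
    le : ∀ a → occ a xs ≤ 𝟙 (P a)
    le a with P a in eq
    ... | true  = unique-occ u a
    ... | false = ≤-reflexive (occ-notin P ps eq)

  occ-pos : ∀ {a xs} → 1 ≤ occ a xs → a ∈ xs
  occ-pos {a} {x ∷ xs} h with a == x in eq
  ... | true  = here (==-sound eq)
  ... | false = there (occ-pos h)

  #-list-complete : ∀ (P : A → Bool) {xs} → Unique xs → All (λ x → P x ≡ true) xs → # P ≤ length xs →
    ∀ {a} → P a ≡ true → a ∈ xs
  #-list-complete P {xs} u ps size {a} Pa =
    occ-pos (subst (1 ≤_) (sym (∑-tight le (subst (# P ≤_) (sym (∑-occ xs)) size) a)) (≤-reflexive (sym (𝟙-true Pa))))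
    where
    -- The same count from the other side: a list without repetitions inside `P` has multiplicities
    -- at most `𝟙 (P a)`, with equality once it is long enough.
    le : ∀ a → occ a xs ≤ 𝟙 (P a)
    le a with P a in eq
    ... | true  = unique-occ u a
    ... | false = ≤-reflexive (occ-notin P ps eq)

#-image-≤ : ∀ {A B : Set} {{_ : Enum A}} {{_ : Enum B}} (P : A → Bool) (g : B → A) →
  (∀ a → P a ≡ true → ∃[ b ] g b ≡ a) → # P ≤ ∑ {B} (λ _ → 1)
#-image-≤ P g complete =
  subst (# P ≤_) (trans (∑-swap (λ a b → 𝟙 (a == g b))) (∑-cong (λ b → #-== (g b)))) (∑-mono le)
  where
  le : ∀ a → 𝟙 (P a) ≤ ∑ (λ b → 𝟙 (a == g b))
  le a with P a in eq
  ... | false = z≤n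
  ... | true  = let (b , e) = complete a eq in #-pos (λ b → a == g b) {b} (==-≡ (sym e))

-- Linear arithmetic

infixl 6 _⊕_
infixl 7 _⊗_
infix 5 _≼_

data Lin (n : ℕ) : Set where
  var : Fin n → Lin n
  con : ℕ → Lin n
  _⊕_ : Lin n → Lin n → Lin n
  _⊗_ : ℕ → Lin n → Lin n

⟦_⟧ : ∀ {n} → Lin n → Vec ℕ n → ℕ
⟦ var i ⟧ ρ = Vec.lookup ρ i
⟦ con c ⟧ ρ = c
⟦ a ⊕ b ⟧ ρ = ⟦ a ⟧ ρ + ⟦ b ⟧ ρ
⟦ c ⊗ a ⟧ ρ = c * ⟦ a ⟧ ρ

dot : ∀ {n} → Vec ℕ n → Vec ℕ n → ℕ
dot []       []       = 0
dot (c ∷ cs) (x ∷ xs) = c * x + dot cs xs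

dot-+ : ∀ {n} (a b : Vec ℕ n) x → dot (Vec.zipWith _+_ a b) x ≡ dot a x + dot b x
dot-+ []      []      []      = refl
dot-+ (a ∷ as) (b ∷ bs) (x ∷ xs) rewrite dot-+ as bs xs = lem a b x (dot as xs) (dot bs xs)
  where
  lem : ∀ a b x p q → (a + b) * x + (p + q) ≡ (a * x + p) + (b * x + q)
  lem = solve-∀

dot-* : ∀ {n} c (a : Vec ℕ n) x → dot (Vec.map (c *_) a) x ≡ c * dot a x
dot-* c []       []       = sym (*-zeroʳ c)
dot-* c (a ∷ as) (x ∷ xs) rewrite dot-* c as xs = lem c a x (dot as xs)
  where
  lem : ∀ c a x p → c * a * x + c * p ≡ c * (a * x + p)
  lem = solve-∀

dot-0 : ∀ {n} (x : Vec ℕ n) → dot (Vec.replicate n 0) x ≡ 0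
dot-0 []       = refl
dot-0 (x ∷ xs) = dot-0 xs

unit : ∀ {n} → Fin n → Vec ℕ n
unit {suc n} zero    = 1 ∷ Vec.replicate n 0
unit         (suc i) = 0 ∷ unit i

dot-unit : ∀ {n} (i : Fin n) x → dot (unit i) x ≡ Vec.lookup x i
dot-unit zero    (x ∷ xs) rewrite dot-0 xs = lem x
  where
  lem : ∀ x → x + 0 + 0 ≡ x
  lem = solve-∀
dot-unit (suc i) (x ∷ xs) = dot-unit i xs

-- The head is the constant term; it is paired with the entry `1` put in front of the valuation.
coeffs : ∀ {n} → Lin n → Vec ℕ (suc n)
coeffs {n} (var i) = 0 ∷ unit i
coeffs {n} (con c) = c ∷ Vec.replicate n 0
coeffs     (a ⊕ b) = Vec.zipWith _+_ (coeffs a) (coeffs b)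
coeffs     (c ⊗ a) = Vec.map (c *_) (coeffs a)

coeffs-correct : ∀ {n} (a : Lin n) ρ → dot (coeffs a) (1 ∷ ρ) ≡ ⟦ a ⟧ ρ
coeffs-correct (var i) ρ = dot-unit i ρ
coeffs-correct (con c) ρ rewrite dot-0 ρ = lem c
  where
  lem : ∀ c → c * 1 + 0 ≡ c
  lem = solve-∀
coeffs-correct (a ⊕ b) ρ = trans (dot-+ (coeffs a) (coeffs b) (1 ∷ ρ)) (cong₂ _+_ (coeffs-correct a ρ) (coeffs-correct b ρ))
coeffs-correct (c ⊗ a) ρ = trans (dot-* c (coeffs a) (1 ∷ ρ)) (cong (c *_) (coeffs-correct a ρ))

below : ∀ {n} → Vec ℕ n → Vec ℕ n → Bool
below []       []       = true
below (a ∷ as) (b ∷ bs) = (a ≤ᵇ b) ∧ below as bs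

below-correct : ∀ {n} (a b x : Vec ℕ n) → So (below a b) → dot a x ≤ dot b x
below-correct []       []       []       _ = z≤n
below-correct (a ∷ as) (b ∷ bs) (x ∷ xs) h with a ≤ᵇ b in eq
... | true = +-mono-≤ (*-monoˡ-≤ x (≤ᵇ⇒≤ a b (subst So (sym eq) tt))) (below-correct as bs xs h)

data Ineq (n : ℕ) : Set where
  _≼_ : Lin n → Lin n → Ineq n

Holds : ∀ {n} → Vec ℕ n → Ineq n → Set
Holds ρ (l ≼ r) = ⟦ l ⟧ ρ ≤ ⟦ r ⟧ ρ

AllHold : ∀ {n} → Vec ℕ n → List (ℕ × Ineq n) → Set
AllHold ρ []             = ⊤
AllHold ρ ((_ , i) ∷ is) = Holds ρ i × AllHold ρ is

lhs rhs : ∀ {n} → List (ℕ × Ineq n) → Lin n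
lhs []                   = con 0
lhs ((c , (l ≼ r)) ∷ is) = c ⊗ l ⊕ lhs is
rhs []                   = con 0
rhs ((c , (l ≼ r)) ∷ is) = c ⊗ r ⊕ rhs is

combine : ∀ {n} (ρ : Vec ℕ n) is → AllHold ρ is → ⟦ lhs is ⟧ ρ ≤ ⟦ rhs is ⟧ ρ
combine ρ []                   _        = z≤n
combine ρ ((c , (l ≼ r)) ∷ is) (h , hs) = +-mono-≤ (*-monoʳ-≤ c h) (combine ρ is hs)

-- The hypotheses are moved across instead of subtracted, which keeps all coefficients natural
-- numbers.
Certificate : ∀ {n} → ℕ → List (ℕ × Ineq n) → Ineq n → Set
Certificate m is (l ≼ r) = So (below (coeffs (suc m ⊗ l ⊕ rhs is)) (coeffs (suc m ⊗ r ⊕ lhs is)))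

-- Farkas: (suc m) times the goal is the sum of the hypotheses with the given multipliers,
-- up to terms with nonnegative coefficients; Certificate is decided by evaluation.
farkas : ∀ {n} m (ρ : Vec ℕ n) (is : List (ℕ × Ineq n)) (g : Ineq n) → AllHold ρ is →
  {_ : Certificate m is g} → Holds ρ g
farkas m ρ is (l ≼ r) hs {ok} = *-cancelˡ-≤ (suc m) (+-cancelʳ-≤ (⟦ rhs is ⟧ ρ) _ _
  (≤-trans (subst₂ _≤_ (coeffs-correct (suc m ⊗ l ⊕ rhs is) ρ) (coeffs-correct (suc m ⊗ r ⊕ lhs is) ρ)
              (below-correct (coeffs (suc m ⊗ l ⊕ rhs is)) (coeffs (suc m ⊗ r ⊕ lhs is)) (1 ∷ ρ) ok))
           (+-monoʳ-≤ (suc m * ⟦ r ⟧ ρ) (combine ρ is hs))))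

x₀ : ∀ {n} → Lin (1 + n)
x₀ = var zero

x₁ : ∀ {n} → Lin (2 + n)
x₁ = var (suc zero)

x₂ : ∀ {n} → Lin (3 + n)
x₂ = var (suc (suc zero))

x₃ : ∀ {n} → Lin (4 + n)
x₃ = var (suc (suc (suc zero)))

x₄ : ∀ {n} → Lin (5 + n)
x₄ = var (suc (suc (suc (suc zero))))

x₅ : ∀ {n} → Lin (6 + n)
x₅ = var (suc (suc (suc (suc (suc zero)))))

x₆ : ∀ {n} → Lin (7 + n)
x₆ = var (suc (suc (suc (suc (suc (suc zero))))))

x₇ : ∀ {n} → Lin (8 + n)
x₇ = var (suc (suc (suc (suc (suc (suc (suc zero)))))))

-- Connectivity and Euler's inequality

next3³ : ∀ i → next3 (next3 (next3 i)) ≡ i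
next3³ zero             = refl
next3³ (suc zero)       = refl
next3³ (suc (suc zero)) = refl

σ³ : ∀ {V} (d : Dart V) → σ (σ (σ d)) ≡ d
σ³ (v , i) = cong (v ,_) (next3³ i)

∑-Fin3 : ∀ (f : Fin 3 → ℕ) i → ∑ f ≡ f i + f (next3 i) + f (next3 (next3 i))
∑-Fin3 f i = trans (trans (∑-Fin-suc f) (cong (f zero +_) (trans (∑-Fin-suc _) (cong (f (suc zero) +_) (trans (∑-Fin-suc _) (cong (f (suc (suc zero)) +_) (∑-Fin0 _))))))) (rot i)
  where
  rot : ∀ i → f zero + (f (suc zero) + (f (suc (suc zero)) + 0)) ≡ f i + f (next3 i) + f (next3 (next3 i))
  rot zero             = lem (f zero) (f (suc zero)) (f (suc (suc zero)))
    where lem : ∀ a b c → a + (b + (c + 0)) ≡ a + b + c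
          lem = solve-∀
  rot (suc zero)       = lem (f zero) (f (suc zero)) (f (suc (suc zero)))
    where lem : ∀ a b c → a + (b + (c + 0)) ≡ b + c + a
          lem = solve-∀
  rot (suc (suc zero)) = lem (f zero) (f (suc zero)) (f (suc (suc zero)))
    where lem : ∀ a b c → a + (b + (c + 0)) ≡ c + a + b
          lem = solve-∀

iter-+ : ∀ {A : Set} m n (f : A → A) x → iter (m + n) f x ≡ iter m f (iter n f x)
iter-+ zero    n f x = refl
iter-+ (suc m) n f x = cong f (iter-+ m n f x)

iter-inside : ∀ {A : Set} m (f : A → A) x → iter m f (f x) ≡ f (iter m f x)
iter-inside zero    f x = refl
iter-inside (suc m) f x = cong f (iter-inside m f x)

iter-* : ∀ {A : Set} (f : A → A) x L → iter L f x ≡ x → ∀ m → iter (m * L) f x ≡ x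
iter-* f x L h zero    = refl
iter-* f x L h (suc m) = trans (iter-+ L (m * L) f x) (trans (cong (iter L f) (iter-* f x L h m)) h)

orbit : ∀ {A : Set} (f : A → A) x L → iter L f x ≡ x → 1 ≤ L → ∀ m → ∃[ j ] iter m f x ≡ iter (toℕ {L} j) f x
orbit f x (suc L) h _ zero = zero , refl
orbit f x (suc L) h p (suc m) with orbit f x (suc L) h p m
... | j , e with suc (toℕ j) ≤? L
...   | yes q = fromℕ< (s≤s q) , trans (cong f e) (cong (λ z → iter z f x) (sym (toℕ-fromℕ< (s≤s q))))
...   | no ¬q = zero , trans (cong f e) (trans (cong (λ z → iter z f x) eq) h)
  where
  eq : suc (toℕ j) ≡ suc L
  eq = ≤-antisym (toℕ<n j) (≰⇒> ¬q)

SameFace-trans : ∀ {V} (α : Dart V → Dart V) {d e e'} → SameFace α d e → SameFace α e e' → SameFace α d e'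
SameFace-trans α {d} (k , p) (l , q) = l + k , trans (iter-+ l k (φ α) d) (trans (cong (iter l (φ α)) p) q)

pos : ℕ → Bool
pos zero    = false
pos (suc _) = true

pos-≥ : ∀ {m} → 1 ≤ m → pos m ≡ true
pos-≥ (s≤s _) = refl

≥-pos : ∀ {m} → pos m ≡ true → 1 ≤ m
≥-pos {suc m} _ = s≤s z≤n

module Fullerene {V : ℕ} (α : Dart V → Dart V) (full : IsFullerene α) where

  open IsFullerene full

  ϕ : Dart V → Dart V
  ϕ = φ α

  α-injective : ∀ {x y} → α x ≡ α y → x ≡ y
  α-injective {x} {y} h = trans (sym (α-invol x)) (trans (cong α h) (α-invol y))

  σ-injective : ∀ {x y : Dart V} → σ x ≡ σ y → x ≡ y
  σ-injective {x} {y} h = trans (sym (σ³ x)) (trans (cong (λ z → σ (σ z)) h) (σ³ y))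

  ϕ-injective : ∀ {x y} → ϕ x ≡ ϕ y → x ≡ y
  ϕ-injective h = α-injective (σ-injective h)

  α-fixpoint-free : ∀ d → α d ≢ d
  α-fixpoint-free d h = loopless d (cong vert h)

  iter-injective : ∀ m {x y} → iter m ϕ x ≡ iter m ϕ y → x ≡ y
  iter-injective zero    h = h
  iter-injective (suc m) h = iter-injective m (ϕ-injective h)

  period : ∀ d → ∃[ L ] iter (suc L) ϕ d ≡ d
  period d with faces d
  ... | inj₁ (_ , h , _) = 4 , h
  ... | inj₂ (_ , h , _) = 5 , h

  SameFace-sym : ∀ {d e} → SameFace α d e → SameFace α e d
  SameFace-sym {d} {e} (k , refl) = let (L , h) = period d in
    -- After the `k` steps from `d` to `e`, another `k * L` steps complete `k` turns of `suc L`
    -- steps.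
    k * L , trans (sym (iter-+ (k * L) k ϕ d))
      (trans (cong (λ z → iter z ϕ d) (trans (+-comm (k * L) k) (sym (*-suc k L)))) (iter-* ϕ d (suc L) h k))

  opaque

    nF : ℕ
    nF = proj₁ planar

    rep : Fin nF → Dart V
    rep = proj₁ (proj₁ (proj₂ planar))

    euler : 2 * V + 2 * nF ≡ 3 * V + 4
    euler = proj₂ (proj₂ planar)

    cover : ∀ d → ∃[ a ] SameFace α (rep a) d
    cover d = proj₂ (proj₂ (proj₂ (proj₁ (proj₂ planar)))) d tt

    face : Dart V → Fin nF
    face d = proj₁ (cover d)

    rep-face : ∀ d → SameFace α (rep (face d)) d
    rep-face d = proj₂ (cover d)

    face-cong : ∀ {d e} → SameFace α d e → face d ≡ face e
    face-cong {d} {e} h = proj₁ (proj₂ (proj₁ (proj₂ planar))) _ _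
      (SameFace-trans α (SameFace-trans α (rep-face d) h) (SameFace-sym (rep-face e)))

    face-rep : ∀ a → face (rep a) ≡ a
    face-rep a = proj₁ (proj₂ (proj₁ (proj₂ planar))) _ _ (rep-face (rep a))

  face-SameFace : ∀ {d e} → face d ≡ face e → SameFace α d e
  face-SameFace {d} {e} h = SameFace-trans α (SameFace-sym (rep-face d)) (subst (λ a → SameFace α (rep a) e) (sym h) (rep-face e))

  face-ϕ : ∀ d → face (ϕ d) ≡ face d
  face-ϕ d = sym (face-cong (1 , refl))

  face-σ : ∀ d → face (σ d) ≡ face (α d)
  face-σ d = trans (cong (face ∘ σ) (sym (α-invol d))) (face-ϕ (α d))

  face-iter : ∀ m d → face (iter m ϕ d) ≡ face d
  face-iter m d = sym (face-cong (m , refl))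

  len : Fin nF → ℕ
  len a = # (λ d → a == face d)

  FaceLen-apart : ∀ {d L i j} → FaceLen α d L → i < j → j < L → iter i ϕ d ≢ iter j ϕ d
  FaceLen-apart {d} {L} {i} {j} (_ , _ , prim) i<j j<L h = prim (j ∸ i) (m<n⇒0<n∸m i<j) (≤-trans (s≤s (m∸n≤m j i)) j<L)
    (sym (iter-injective i (trans h (trans (cong (λ z → iter z ϕ d) (sym (m+[n∸m]≡n (<⇒≤ i<j)))) (iter-+ i (j ∸ i) ϕ d)))))

  len-FaceLen : ∀ {d L} → FaceLen α d L → len (face d) ≡ L
  len-FaceLen {d} {L} (1≤L , per , prim) =
    trans (#-bijection _ (λ (j : Fin L) → iter (toℕ j) ϕ d) inj (λ j → ==-≡ (sym (face-iter (toℕ j) d))) complete) (∑1-Fin L)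
    where
    inj : ∀ (i j : Fin L) → iter (toℕ i) ϕ d ≡ iter (toℕ j) ϕ d → i ≡ j
    inj i j h with <-cmp (toℕ i) (toℕ j)
    ... | tri< p _ _ = ⊥-elim (FaceLen-apart (1≤L , per , prim) p (toℕ<n j) h)
    ... | tri≈ _ p _ = toℕ-injective p
    ... | tri> _ _ p = ⊥-elim (FaceLen-apart (1≤L , per , prim) p (toℕ<n i) (sym h))
    complete : ∀ e → (face d == face e) ≡ true → ∃[ j ] iter (toℕ {L} j) ϕ d ≡ e
    complete e h = let (m , q) = face-SameFace {d} {e} (==-sound h)
                       (j , r) = orbit ϕ d L per 1≤L m in j , trans (sym r) q

  pent : Fin nF → Bool
  pent a = len a ==ℕ5
    where
    _==ℕ5 : ℕ → Bool
    5 ==ℕ5 = true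
    _ ==ℕ5 = false

  len-cases : ∀ a → (len a ≡ 5 × pent a ≡ true) ⊎ (len a ≡ 6 × pent a ≡ false)
  len-cases a with faces (rep a)
  ... | inj₁ h = let e = trans (cong len (sym (face-rep a))) (len-FaceLen h) in inj₁ (e , pent5 e)
    where
    pent5 : len a ≡ 5 → pent a ≡ true
    pent5 e rewrite e = refl
  ... | inj₂ h = let e = trans (cong len (sym (face-rep a))) (len-FaceLen h) in inj₂ (e , pent6 e)
    where
    pent6 : len a ≡ 6 → pent a ≡ false
    pent6 e rewrite e = refl

  len+pent : ∀ a → len a + 𝟙 (pent a) ≡ 6
  len+pent a with len-cases a
  ... | inj₁ (p , q) rewrite p | q = refl
  ... | inj₂ (p , q) rewrite p | q = refl

  pent-Pentagon : ∀ d → pent (face d) ≡ true → Pentagon α d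
  pent-Pentagon d h with faces d
  ... | inj₁ p = p
  ... | inj₂ p with len-cases (face d)
  ...   | inj₁ (e , _) = ⊥-elim (6≢5 (trans (sym (len-FaceLen p)) e))
    where 6≢5 : 6 ≢ 5
          6≢5 ()
  ...   | inj₂ (_ , e) = ⊥-elim (true≢false (trans (sym h) e))

  pent-Hexagon : ∀ d → pent (face d) ≡ false → Hexagon α d
  pent-Hexagon d h with faces d
  ... | inj₂ p = p
  ... | inj₁ p with len-cases (face d)
  ...   | inj₂ (e , _) = ⊥-elim (5≢6 (trans (sym (len-FaceLen p)) e))
    where 5≢6 : 5 ≢ 6
          5≢6 ()
  ...   | inj₁ (_ , e) = ⊥-elim (true≢false (trans (sym e) h))

  ∑-α : ∀ (F : Dart V → ℕ) → ∑ (λ d → F (α d)) ≡ ∑ F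
  ∑-α = ∑-involution α α-invol

  ∑-vertex : ∀ (F : Dart V → ℕ) d → ∑ (λ i → F (vert d , i)) ≡ F d + F (σ d) + F (σ (σ d))
  ∑-vertex F (v , i) = ∑-Fin3 (λ j → F (v , j)) i

  ∑-face : ∀ (F : Dart V → ℕ) → ∑ (λ a → ∑ (λ d → 𝟙 (a == face d) * F d)) ≡ ∑ F
  ∑-face = ∑-fibre face

  ∑-face-len : ∀ (P : Fin nF → Bool) → ∑ (λ a → 𝟙 (P a) * len a) ≡ # (λ d → P (face d))
  ∑-face-len P = trans (∑-cong pt) (∑-face (λ d → 𝟙 (P (face d))))
    where
    pt : ∀ a → 𝟙 (P a) * len a ≡ ∑ (λ d → 𝟙 (a == face d) * 𝟙 (P (face d)))
    pt a = trans (*-comm (𝟙 (P a)) (len a)) (trans (sym (∑-*ʳ _ (𝟙 (P a)))) (∑-cong q))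
      where
      q : ∀ d → 𝟙 (a == face d) * 𝟙 (P a) ≡ 𝟙 (a == face d) * 𝟙 (P (face d))
      q d with a == face d in eq
      ... | true  = cong (λ z → 𝟙 (P z) + 0) (==-sound eq)
      ... | false = refl

  -- An edge of the cut has exactly one dart of this kind, so `δ` counts edges; `within` counts
  -- every edge twice.
  out : (Fin V → Bool) → Dart V → Bool
  out S d = S (vert d) ∧ not (S (vert (α d)))

  δ : (Fin V → Bool) → ℕ
  δ S = # (out S)

  out-intro : ∀ S {d} → S (vert d) ≡ true → S (vert (α d)) ≡ false → out S d ≡ true
  out-intro S p q rewrite p | q = refl

  out-from : ∀ S {d} → out S d ≡ true → S (vert d) ≡ true
  out-from S h = ∧-left h

  out-to : ∀ S {d} → out S d ≡ true → S (vert (α d)) ≡ false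
  out-to S h = not-true (∧-right h)

  -- The step of the path that leaves `S` is a cut edge, so its inner end is `x` or its outer end is
  -- `y`; but the path avoids both.
  crossing : ∀ (S : Fin V → Bool) x y {u v} → (∀ d → out S d ≡ true → vert d ≡ x ⊎ vert (α d) ≡ y) →
    Star (λ a b → Adj α a b × a ≢ x × a ≢ y × b ≢ x × b ≢ y) u v → S u ≡ true → S v ≡ false → ⊥
  crossing S x y h ε p q = true≢false (trans (sym p) q)
  crossing S x y h (_◅_ {j = w} ((i , refl) , u≢x , _ , _ , w≢y) rest) p q with S w in eq
  ... | true = crossing S x y h rest eq q
  ... | false with h (_ , i) (out-intro S {_ , i} p eq)
  ...   | inj₁ e = u≢x e
  ...   | inj₂ e = w≢y e

  private
    three-darts : ∀ (v : Fin V) → Unique {A = Dart V} ((v , zero) ∷ (v , suc zero) ∷ (v , suc (suc zero)) ∷ [])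
    three-darts v = ((λ ()) ∷ (λ ()) ∷ []) ∷ ((λ ()) ∷ []) ∷ [] ∷ []

    three-αdarts : ∀ (v : Fin V) → Unique (α (v , zero) ∷ α (v , suc zero) ∷ α (v , suc (suc zero)) ∷ [])
    three-αdarts v = ((λ e → 0≢1 (α-injective e)) ∷ (λ e → 0≢2 (α-injective e)) ∷ []) ∷ ((λ e → 1≢2 (α-injective e)) ∷ []) ∷ [] ∷ []
      where
      0≢1 : _≢_ {A = Dart V} (v , zero) (v , suc zero)
      0≢1 ()
      0≢2 : _≢_ {A = Dart V} (v , zero) (v , suc (suc zero))
      0≢2 ()
      1≢2 : _≢_ {A = Dart V} (v , suc zero) (v , suc (suc zero))
      1≢2 ()

  -- For a cut of at most two edges, x is an end in S of one edge and y an end outside S of the other.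
  separated : ∀ S x y → S x ≡ true → S y ≡ false → (∀ d → out S d ≡ true → vert d ≡ x ⊎ vert (α d) ≡ y) → 3 ≤ δ S
  separated S x y Sx Sy h with search (λ w → S w ∧ not (w == x)) | search (λ w → not (S w) ∧ not (w == y))
  -- Both sides keep a vertex when `x` and `y` are deleted, and 3-connectivity joins these two
  -- vertices by a path.
  ... | inj₁ (w , p) | inj₁ (z , q) = ⊥-elim (crossing S x y h
          (proj₂ threeConn x y w z (==-≢ (not-true (∧-right {S w} p))) (differ (∧-left p) Sy)
             (λ e → differ Sx (not-true (∧-left q)) (sym e)) (==-≢ (not-true (∧-right {not (S z)} q))))
          (∧-left p) (not-true (∧-left q)))
    where
    differ : ∀ {a b} → S a ≡ true → S b ≡ false → a ≢ b
    differ p q refl = true≢false (trans (sym p) q)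
  -- `S` consists of `x` alone, and without loops its three darts all leave `S`. The next case is
  -- the same for `y` and the complement.
  ... | inj₂ none | _ = #-list-≤ (out S) (three-darts x) (all zero ∷ all (suc zero) ∷ all (suc (suc zero)) ∷ [])
    where
    all : ∀ i → out S (x , i) ≡ true
    all i with S (vert (α (x , i))) in eq
    ... | false = ∧-both Sx refl
    ... | true  = ⊥-elim (true≢false (trans (sym (∧-both eq (cong not (==-false (loopless (x , i)))))) (none _)))
  ... | inj₁ _ | inj₂ none = #-list-≤ (out S) (three-αdarts y) (all zero ∷ all (suc zero) ∷ all (suc (suc zero)) ∷ [])
    where
    all : ∀ i → out S (α (y , i)) ≡ true
    all i with S (vert (α (y , i))) in eq
    ... | true  = cong not (trans (cong (S ∘ vert) (α-invol (y , i))) Sy)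
    ... | false = ⊥-elim (true≢false (trans (sym (∧-both (cong not eq) (cong not (==-false (loopless (y , i)))))) (none _)))

  -- Three distinct cut edges are sought one after another. If the search stops early, `separated`
  -- applies to the inner end of the first edge and the outer end of the second, with `u` or `v` in
  -- place of a missing edge.
  cut≥3 : ∀ S {u v} → S u ≡ true → S v ≡ false → 3 ≤ δ S
  cut≥3 S {u} {v} Su Sv with search (out S)
  ... | inj₂ none = separated S u v Su Sv (λ d h → ⊥-elim (true≢false (trans (sym h) (none d))))
  ... | inj₁ (d₁ , p₁) with search (λ d → out S d ∧ not (d == d₁))
  ...   | inj₂ none = separated S (vert d₁) v (out-from S p₁) Sv only
    where
    only : ∀ d → out S d ≡ true → vert d ≡ vert d₁ ⊎ vert (α d) ≡ v
    only d h with d == d₁ in eq | none d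
    ... | true  | _ = inj₁ (cong vert (==-sound {x = d} {d₁} eq))
    ... | false | r = ⊥-elim (true≢false (trans (sym (∧-both h refl)) r))
  ...   | inj₁ (d₂ , p₂) with search (λ d → out S d ∧ (not (d == d₁) ∧ not (d == d₂)))
  ...     | inj₂ none = separated S (vert d₁) (vert (α d₂)) (out-from S p₁) (out-to S (∧-left p₂)) only
    where
    only : ∀ d → out S d ≡ true → vert d ≡ vert d₁ ⊎ vert (α d) ≡ vert (α d₂)
    only d h with d == d₁ in e₁ | d == d₂ in e₂ | none d
    ... | true  | _     | _ = inj₁ (cong vert (==-sound {x = d} {d₁} e₁))
    ... | false | true  | _ = inj₂ (cong (vert ∘ α) (==-sound {x = d} {d₂} e₂))
    ... | false | false | r = ⊥-elim (true≢false (trans (sym (∧-both h refl)) r))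
  ...     | inj₁ (d₃ , p₃) = #-list-≤ (out S)
      (((λ e → ==-≢ {x = d₂} {d₁} (not-true (∧-right {out S d₂} p₂)) (sym e)) ∷ (λ e → ==-≢ {x = d₃} {d₁} (not-true (∧-left (∧-right {out S d₃} p₃))) (sym e)) ∷ [])
        ∷ ((λ e → ==-≢ {x = d₃} {d₂} (not-true (∧-right {not (d₃ == d₁)} (∧-right {out S d₃} p₃))) (sym e)) ∷ []) ∷ [] ∷ [])
      (p₁ ∷ ∧-left p₂ ∷ ∧-left p₃ ∷ [])

  out-constant : ∀ A → (∀ d → A (vert d) ≡ A (vert (α d))) → ∀ d → out A d ≡ false
  out-constant A h d rewrite h d with A (vert (α d))
  ... | true  = refl
  ... | false = refl

  labelling-constant : ∀ (A : Fin V → Bool) → (∀ d → A (vert d) ≡ A (vert (α d))) → ∀ u v → A u ≡ true → A v ≡ true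
  labelling-constant A h u v Au with A v in eq
  ... | true  = refl
  ... | false = ⊥-elim (no3 (subst (3 ≤_) (trans (∑-cong (λ d → 𝟙-false (out-constant A h d))) ∑-0) (cut≥3 A Au eq)))
    where no3 : ¬ (3 ≤ 0)
          no3 ()

  -- Connectivity is tested on Boolean labellings instead of paths. To delete an edge it then
  -- suffices that a labelling constant along the remaining darts has equal values at the ends of
  -- the deleted one.
  Connected : (Fin V → Bool) → (Dart V → Bool) → Set
  Connected S Y = ∀ (A : Fin V → Bool) → (∀ d → Y d ≡ true → A (vert d) ≡ A (vert (α d))) →
    ∀ u v → S u ≡ true → S v ≡ true → A u ≡ true → A v ≡ true

  within : (Fin V → Bool) → Dart V → Bool
  within S d = S (vert d) ∧ S (vert (α d))

  -- Both parts of a disconnected side would have at least three edges to the other side.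
  side-connected : ∀ S → δ S ≤ 5 → Connected S (within S)
  side-connected S δ≤5 A h u v Su Sv Au with A v in Av
  ... | true  = refl
  ... | false = ⊥-elim (<-irrefl refl (≤-trans (≤-trans (+-mono-≤ (cut≥3 T {u} {v} (∧-both Su Au) Tv) (cut≥3 T' {v} {u} (∧-both Sv (cong not Av)) T'u)) sum≤) δ≤5))
    where
    T T' : Fin V → Bool
    T  w = S w ∧ A w
    T' w = S w ∧ not (A w)
    Tv : T v ≡ false
    Tv rewrite Sv | Av = refl
    T'u : T' u ≡ false
    T'u rewrite Su | Au = refl
    -- No edge within `S` changes its label, so an edge leaving one of the two parts leaves `S`, and
    -- no edge leaves both.
    bool : ∀ s a s' a' → ((s ∧ s') ≡ true → a ≡ a') →
      𝟙 ((s ∧ a) ∧ not (s' ∧ a')) + 𝟙 ((s ∧ not a) ∧ not (s' ∧ not a')) ≤ 𝟙 (s ∧ not s')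
    bool false a s' a' _ = z≤n
    bool true true  true  a' e rewrite sym (e refl) = z≤n
    bool true false true  a' e rewrite sym (e refl) = z≤n
    bool true true  false a' e = s≤s z≤n
    bool true false false a' e = s≤s z≤n
    sum≤ : δ T + δ T' ≤ δ S
    sum≤ = subst (_≤ δ S) (∑-+ _ _) (∑-mono (λ d → bool (S (vert d)) (A (vert d)) (S (vert (α d))) (A (vert (α d))) (h d)))

  pair-sum : ∀ d → ∑ (λ x → 𝟙 (x == d) + 𝟙 (x == α d)) ≡ 2
  pair-sum d = trans (∑-+ _ _) (cong₂ _+_ (#-== d) (#-== (α d)))

  module _ (S : Fin V → Bool) (Y : Dart V → Bool) (Y-sym : ∀ d → Y d ≡ true → Y (α d) ≡ true)
           (Y-in : ∀ d → Y d ≡ true → S (vert d) ≡ true) (conn : Connected S Y) where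

    private
      inside : (Fin V → Bool) → Dart V → Bool
      inside A d = Y d ∧ within A d

      -- The tree bound `e ≥ n - 1`, doubled because `Y` contains both darts of an edge. The set `A`
      -- grows from one vertex; each new vertex brings the edge that reached it, adding 2 on the
      -- left of the invariant and at least 2 on the right. When no edge of `Y` leaves `A`,
      -- connectivity gives that `A` contains `S`.
      grow : ∀ fuel A → V < # A + fuel → ∀ {u} → S u ≡ true → A u ≡ true → 2 * # A ≤ # (inside A) + 2 → 2 * # S ≤ # Y + 2
      grow fuel A big {u} Su Au inv with search (λ d → Y d ∧ (A (vert d) ∧ not (A (vert (α d)))))
      grow fuel A big {u} Su Au inv | inj₂ none = ≤-trans (*-monoʳ-≤ 2 (∑-mono S≤A)) (≤-trans inv (+-monoˡ-≤ 2 (∑-mono (λ d → ≤Y (Y d)))))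
        where
        closed : ∀ d → Y d ≡ true → A (vert d) ≡ true → A (vert (α d)) ≡ true
        closed d y a with A (vert (α d)) in eq
        ... | true  = refl
        ... | false = ⊥-elim (true≢false (trans (sym (∧-both y (∧-both a (cong not eq)))) (none d)))
        S≤A : ∀ v → 𝟙 (S v) ≤ 𝟙 (A v)
        S≤A v with S v in eq
        ... | false = z≤n
        ... | true  = ≤-reflexive (sym (𝟙-true (conn A (λ d y → Bool-ext (closed d y)
                (λ a → subst (λ z → A (vert z) ≡ true) (α-invol d) (closed (α d) (Y-sym d y) a))) u v Su eq Au)))
        ≤Y : ∀ y {c} → 𝟙 (y ∧ c) ≤ 𝟙 y
        ≤Y true  = 𝟙≤1 _
        ≤Y false = z≤n
      grow zero A big Su Au inv | inj₁ _ = ⊥-elim (<-irrefl refl (≤-trans big (subst (_≤ V) (sym (+-identityʳ _))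
          (subst (# A ≤_) (∑1-Fin V) (∑-mono (λ v → 𝟙≤1 (A v)))))))
      grow (suc fuel) A big {u} Su Au inv | inj₁ (d , p) = grow fuel A' (subst (V <_) (trans (+-suc _ fuel) (cong (_+ fuel) (sym size))) big)
          Su (cong (_∨ (u == w)) Au) (subst (λ z → 2 * z ≤ # (inside A') + 2) (sym size) step)
        where
        yd : Y d ≡ true
        yd = ∧-left p
        ad : A (vert d) ≡ true
        ad = ∧-left (∧-right {Y d} p)
        nad : A (vert (α d)) ≡ false
        nad = not-true (∧-right {A (vert d)} (∧-right {Y d} p))
        w = vert (α d)
        A' : Fin V → Bool
        A' v = A v ∨ (v == w)
        size : # A' ≡ suc (# A)
        size = trans (∑-cong pt) (trans (∑-+ _ _) (trans (cong (# A +_) (#-== w)) (+-comm (# A) 1)))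
          where
          pt : ∀ v → 𝟙 (A' v) ≡ 𝟙 (A v) + 𝟙 (v == w)
          pt v with A v in e₁ | v == w in e₂
          ... | true  | true  = ⊥-elim (true≢false (trans (sym e₁) (trans (cong A (==-sound e₂)) nad)))
          ... | true  | false = refl
          ... | false | c     = refl
        le : ∀ x → 𝟙 (inside A x) + (𝟙 (x == d) + 𝟙 (x == α d)) ≤ 𝟙 (inside A' x)
        le x with x == d in e₁
        ... | true = lem (==-sound e₁)
          where
          lem : x ≡ d → 𝟙 (inside A x) + (1 + 𝟙 (x == α d)) ≤ 𝟙 (inside A' x)
          lem refl rewrite yd | nad | ad | ==-refl w | ==-false (λ e → α-fixpoint-free d (sym e)) = ≤-refl
        ... | false with x == α d in e₂
        ...   | true = lem (==-sound e₂)
          where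
          lem : x ≡ α d → 𝟙 (inside A x) + 1 ≤ 𝟙 (inside A' x)
          lem refl rewrite Y-sym d yd | nad | ==-refl w | α-invol d | ad = ≤-refl
        ...   | false = subst (_≤ 𝟙 (inside A' x)) (sym (+-identityʳ _)) (mono (Y x) (A (vert x)) (A (vert (α x))))
          where
          mono : ∀ y a b {c e} → 𝟙 (y ∧ (a ∧ b)) ≤ 𝟙 (y ∧ ((a ∨ c) ∧ (b ∨ e)))
          mono false a b = z≤n
          mono true false b = z≤n
          mono true true false = z≤n
          mono true true true = ≤-refl
        step : 2 * suc (# A) ≤ # (inside A') + 2
        step = ≤-trans (≤-reflexive (*-suc 2 (# A))) (≤-trans (+-monoʳ-≤ 2 inv) (≤-trans (≤-reflexive (+-comm 2 _))
            (+-monoˡ-≤ 2 (subst (_≤ # (inside A')) (trans (∑-+ _ _) (cong (# (inside A) +_) (pair-sum d))) (∑-mono le)))))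

    connected-edges : ∀ {u} → S u ≡ true → 2 * # S ≤ # Y + 2
    connected-edges {u} Su = grow V (_== u) (≤-reflexive (cong (_+ V) (sym (#-== u)))) Su (==-refl u)
      (≤-trans (≤-reflexive (cong (2 *_) (#-== u))) (m≤n+m 2 _))

  delete : (Dart V → Bool) → Dart V → Dart V → Bool
  delete Y d x = Y x ∧ not ((x == d) ∨ (x == α d))

  delete-intro : ∀ Y {d x} → Y x ≡ true → x ≢ d → x ≢ α d → delete Y d x ≡ true
  delete-intro Y y p q rewrite y | ==-false p | ==-false q = refl

  delete-sym : ∀ Y d → (∀ x → Y x ≡ true → Y (α x) ≡ true) → ∀ x → delete Y d x ≡ true → delete Y d (α x) ≡ true
  delete-sym Y d s x h with x == d in e₁ | x == α d in e₂
  ... | true  | _     = ⊥-elim (true≢false (sym (∧-right {Y x} h)))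
  ... | false | true  = ⊥-elim (true≢false (sym (∧-right {Y x} h)))
  ... | false | false = delete-intro Y (s x (∧-left h)) (λ e → ==-≢ e₂ (trans (sym (α-invol x)) (cong α e)))
      (λ e → ==-≢ e₁ (α-injective e))

  delete-count : ∀ Y d → Y d ≡ true → Y (α d) ≡ true → # Y ≡ # (delete Y d) + 2
  delete-count Y d y y' = trans (∑-cong pt) (trans (∑-+ _ _) (cong (# (delete Y d) +_) (pair-sum d)))
    where
    pt : ∀ x → 𝟙 (Y x) ≡ 𝟙 (delete Y d x) + (𝟙 (x == d) + 𝟙 (x == α d))
    pt x with x == d in e₁
    ... | true = lem (==-sound e₁)
      where
      lem : x ≡ d → 𝟙 (Y x) ≡ 𝟙 (Y x ∧ false) + (1 + 𝟙 (x == α d))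
      lem refl rewrite y | ==-false (λ e → α-fixpoint-free d (sym e)) = refl
    ... | false with x == α d in e₂
    ...   | true = trans (𝟙-true (trans (cong Y (==-sound e₂)) y')) (lem (Y x))
      where
      lem : ∀ b → 1 ≡ 𝟙 (b ∧ false) + 1
      lem true = refl
      lem false = refl
    ...   | false = lem (Y x)
      where
      lem : ∀ b → 𝟙 b ≡ 𝟙 (b ∧ true) + 0
      lem true = refl
      lem false = refl

  -- Otherwise the darts of the faces in Φ would be closed under α and ϕ, hence under σ = ϕ ∘ α.
  dual-connected : ∀ (Φ : Fin nF → Bool) {a b} → Φ a ≡ true → Φ b ≡ false →
    ∃[ d ] (Φ (face d) ≡ true × Φ (face (α d)) ≡ false)
  dual-connected Φ {a} {b} Φa Φb with search (λ d → Φ (face d) ∧ not (Φ (face (α d))))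
  ... | inj₁ (d , p) = d , ∧-left p , not-true (∧-right {Φ (face d)} p)
  ... | inj₂ none = ⊥-elim (true≢false (trans (sym reach) Φb))
    where
    closed : ∀ d → Φ (face d) ≡ true → Φ (face (α d)) ≡ true
    closed d p with Φ (face (α d)) in eq
    ... | true  = refl
    ... | false = ⊥-elim (true≢false (trans (sym (∧-both p (cong not eq))) (none d)))
    closedσ : ∀ d → Φ (face d) ≡ true → Φ (face (σ d)) ≡ true
    closedσ d p = trans (cong Φ (face-σ d)) (closed d p)
    A : Fin V → Bool
    A v = Φ (face (v , zero))
    toA : ∀ d → Φ (face d) ≡ true → A (vert d) ≡ true
    toA (v , zero)             p = p
    toA (v , suc zero)         p = closedσ _ (closedσ _ p)
    toA (v , suc (suc zero))   p = closedσ _ p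
    fromA : ∀ d → A (vert d) ≡ true → Φ (face d) ≡ true
    fromA (v , zero)           p = p
    fromA (v , suc zero)       p = closedσ _ p
    fromA (v , suc (suc zero)) p = closedσ _ (closedσ _ p)
    dir : ∀ d → A (vert d) ≡ true → A (vert (α d)) ≡ true
    dir d p = toA (α d) (closed d (fromA d p))
    reach : Φ b ≡ true
    reach = trans (cong Φ (sym (face-rep b))) (fromA (rep b) (labelling-constant A
      (λ d → Bool-ext (dir d) (λ p → subst (λ z → A (vert z) ≡ true) (α-invol d) (dir (α d) p)))
      (vert (rep a)) _ (toA (rep a) (trans (cong Φ (face-rep a)) Φa))))

  module _ (S : Fin V → Bool) {u : Fin V} (Su : S u ≡ true) where

    -- Deleting an edge between a face of Φ and a face outside Φ keeps Y connected, because the rest of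
    -- the boundary of the former face is still in Y; so |Φ| edges can be deleted from a connected graph.
    peel : ∀ m (Φ : Fin nF → Bool) → # Φ ≡ m → (Y : Dart V → Bool) →
      (∀ d → Y d ≡ true → Y (α d) ≡ true) → (∀ d → Y d ≡ true → S (vert d) ≡ true) →
      (∀ d → Φ (face d) ≡ true → Y d ≡ true) → ∀ {b} → Φ b ≡ false → Connected S Y →
      2 * m + 2 * # S ≤ # Y + 2
    peel zero Φ size Y Y-sym Y-in ΦY Φb conn = connected-edges S Y Y-sym Y-in conn Su
    peel (suc m) Φ size Y Y-sym Y-in ΦY {b} Φb conn = begin
      2 * suc m + 2 * # S         ≡⟨ cong (_+ 2 * # S) (*-suc 2 m) ⟩
      2 + (2 * m + 2 * # S)       ≤⟨ +-monoʳ-≤ 2 (peel m Φ' size' (delete Y d) (delete-sym Y d Y-sym) (λ x h → Y-in x (∧-left h)) ΦY' {b} Φ'b conn') ⟩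
      2 + (# (delete Y d) + 2)    ≡⟨ +-comm 2 _ ⟩
      # (delete Y d) + 2 + 2      ≡⟨ cong (_+ 2) (sym (delete-count Y d (ΦY d Φd) (Y-sym d (ΦY d Φd)))) ⟩
      # Y + 2 ∎
      where
      open ≤-Reasoning
      inΦ = #-witness Φ (subst (1 ≤_) (sym size) (s≤s z≤n))
      bd = dual-connected Φ (proj₂ inΦ) Φb
      d = proj₁ bd
      Φd = proj₁ (proj₂ bd)
      Φαd = proj₂ (proj₂ bd)
      Φ' : Fin nF → Bool
      Φ' a = Φ a ∧ not (a == face d)
      Φ'b : Φ' b ≡ false
      Φ'b = cong (_∧ not (b == face d)) Φb
      size' : # Φ' ≡ m
      size' = suc-injective (trans (trans (+-comm 1 (# Φ')) (trans (cong (# Φ' +_) (sym (#-== (face d)))) (trans (sym (∑-+ _ _)) (∑-cong pt)))) size)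
        where
        pt : ∀ a → 𝟙 (Φ' a) + 𝟙 (a == face d) ≡ 𝟙 (Φ a)
        pt a with a == face d in eq
        ... | true  = lem (Φ a) (trans (cong Φ (==-sound eq)) Φd)
          where
          lem : ∀ b → b ≡ true → 𝟙 (b ∧ false) + 1 ≡ 𝟙 b
          lem true _ = refl
        ... | false = lem (Φ a)
          where
          lem : ∀ b → 𝟙 (b ∧ true) + 0 ≡ 𝟙 b
          lem true = refl
          lem false = refl
      ΦY' : ∀ x → Φ' (face x) ≡ true → delete Y d x ≡ true
      ΦY' x h = delete-intro Y (ΦY x (∧-left h))
        (λ e → ==-≢ (not-true (∧-right {Φ (face x)} h)) (cong face e))
        (λ e → true≢false (trans (sym (∧-left h)) (trans (cong (Φ ∘ face) e) Φαd)))
      conn' : Connected S (delete Y d)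
      conn' A h = conn A const
        where
        -- The way round the face of `d`: its darts differ from `d` until the face closes up, and
        -- from `α d` because the face of `α d` is outside `Φ`.
        walk : ∀ m → (∀ j → j < m → iter j ϕ (ϕ d) ≢ d) → A (vert (α d)) ≡ A (vert (iter m ϕ (ϕ d)))
        walk zero    ne = refl
        walk (suc m) ne = trans (walk m (λ j p → ne j (m<n⇒m<1+n p)))
          (h x (delete-intro Y (ΦY x (trans (cong Φ fx) Φd)) (ne m ≤-refl)
             (λ e → true≢false (trans (sym (trans (cong Φ fx) Φd)) (trans (cong (Φ ∘ face) e) Φαd)))))
          where
          x = iter m ϕ (ϕ d)
          fx : face x ≡ face d
          fx = trans (face-iter m (ϕ d)) (face-ϕ d)
        around : ∀ {L} → FaceLen α d (suc L) → A (vert (α d)) ≡ A (vert d)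
        around {L} (_ , per , prim) = trans (walk L (λ j p e → prim (suc j) (s≤s z≤n) (s≤s p) (trans (sym (iter-inside j ϕ d)) e)))
          (cong (A ∘ vert) (trans (iter-inside L ϕ d) per))
        edge : A (vert (α d)) ≡ A (vert d)
        edge with faces d
        ... | inj₁ p = around p
        ... | inj₂ p = around p
        const : ∀ x → Y x ≡ true → A (vert x) ≡ A (vert (α x))
        const x y with x ≟E d | x ≟E α d
        ... | yes refl | _ = sym edge
        ... | no _ | yes refl = trans edge (cong (A ∘ vert) (sym (α-invol d)))
        ... | no p | no q = h x (delete-intro Y y p q)

-- Counting faces along a cut

module Cuts {V : ℕ} (α : Dart V → Dart V) (full : IsFullerene α) where

  open IsFullerene full
  open Fullerene α full public

  co : (Fin V → Bool) → Fin V → Bool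
  co S v = not (S v)

  co-true : ∀ S {v} → S v ≡ false → co S v ≡ true
  co-true S h rewrite h = refl

  co-false : ∀ S {v} → S v ≡ true → co S v ≡ false
  co-false S h rewrite h = refl

  touch : (Fin V → Bool) → Fin nF → Bool
  touch S a = pos (# (λ d → (a == face d) ∧ S (vert d)))

  touch-intro : ∀ S d → S (vert d) ≡ true → touch S (face d) ≡ true
  touch-intro S d h = pos-≥ (#-pos (λ e → (face d == face e) ∧ S (vert e)) {d} (∧-both (==-refl (face d)) h))

  touch-elim : ∀ S a → touch S a ≡ true → ∃[ d ] (face d ≡ a × S (vert d) ≡ true)
  touch-elim S a h = let (d , p) = #-witness _ (≥-pos h) in d , sym (==-sound (∧-left p)) , ∧-right {a == face d} p

  inner : (Fin V → Bool) → Fin nF → Bool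
  inner S a = not (touch (co S) a)

  cut : (Fin V → Bool) → Fin nF → Bool
  cut S a = touch S a ∧ touch (co S) a

  inner-all : ∀ S d → inner S (face d) ≡ true → S (vert d) ≡ true
  inner-all S d h with S (vert d) in eq
  ... | true  = refl
  ... | false = ⊥-elim (true≢false (trans (sym (touch-intro (co S) d (co-true S eq))) (not-true h)))

  touch-co-co : ∀ S a → touch (co (co S)) a ≡ touch S a
  touch-co-co S a = cong pos (∑-cong (λ d → cong (λ b → 𝟙 ((a == face d) ∧ b)) (not-involutive (S (vert d)))))

  cut-co : ∀ S a → cut (co S) a ≡ cut S a
  cut-co S a rewrite touch-co-co S a with touch S a | touch (co S) a
  ... | true  | true  = refl
  ... | true  | false = refl
  ... | false | true  = refl
  ... | false | false = refl

  out-α : ∀ S d → out S (α d) ≡ out (co S) d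
  out-α S d rewrite α-invol d with S (vert d) | S (vert (α d))
  ... | true  | true  = refl
  ... | true  | false = refl
  ... | false | true  = refl
  ... | false | false = refl

  δ-co : ∀ S → δ (co S) ≡ δ S
  δ-co S = trans (∑-cong (λ d → cong 𝟙 (sym (out-α S d)))) (∑-α _)

  #-co : ∀ S → # S + # (co S) ≡ V
  #-co S = trans (sym (∑-+ _ _)) (trans (∑-cong pt) (∑1-Fin V))
    where
    pt : ∀ v → 𝟙 (S v) + 𝟙 (co S v) ≡ 1
    pt v with S v
    ... | true  = refl
    ... | false = refl

  out-cut : ∀ S {d} → out S d ≡ true → cut S (face d) ≡ true
  out-cut S {d} h = ∧-both (touch-intro S d (out-from S h))
    (subst (λ a → touch (co S) a ≡ true) (face-ϕ d) (touch-intro (co S) (ϕ d) (co-true S (out-to S h))))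

  out-cut-α : ∀ S {d} → out S d ≡ true → cut S (face (α d)) ≡ true
  out-cut-α S {d} h = trans (sym (cut-co S (face (α d)))) (out-cut (co S) {α d} (trans (sym (out-α S (α d))) (trans (cong (out S) (α-invol d)) h)))

  -- Following the face from a corner in `S` to a corner outside, some step leaves `S`.
  cut-out : ∀ S a → cut S a ≡ true → ∃[ d ] (face d ≡ a × out S d ≡ true)
  cut-out S a h with touch-elim S a (∧-left h) | touch-elim (co S) a (∧-right {touch S a} h)
  ... | d , fd , Sd | e , fe , Se = let (m , r) = face-SameFace {d} {e} (trans fd (sym fe)) in
    let (x , fx , ox) = walk m (not-true (trans (cong (co S ∘ vert) r) Se)) in x , trans fx fd , ox
    where
    walk : ∀ m → S (vert (iter m ϕ d)) ≡ false → ∃[ x ] (face x ≡ face d × out S x ≡ true)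
    walk zero    p = ⊥-elim (true≢false (trans (sym Sd) p))
    walk (suc m) p with S (vert (iter m ϕ d)) in eq
    ... | false = walk m eq
    ... | true  = iter m ϕ d , face-iter m d , out-intro S {iter m ϕ d} eq p

  face-kinds : ∀ S → # (inner S) + # (inner (co S)) + # (cut S) ≡ nF
  face-kinds S = trans (cong (_+ # (cut S)) (sym (∑-+ _ _))) (trans (sym (∑-+ _ _)) (trans (∑-cong pt) (∑1-Fin nF)))
    where
    some : ∀ a → touch S a ≡ false → touch (co S) a ≡ true
    some a h with S (vert (rep a)) in eq
    ... | true  = ⊥-elim (true≢false (trans (sym (subst (λ b → touch S b ≡ true) (face-rep a) (touch-intro S (rep a) eq))) h))
    ... | false = subst (λ b → touch (co S) b ≡ true) (face-rep a) (touch-intro (co S) (rep a) (co-true S eq))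
    pt : ∀ a → 𝟙 (inner S a) + 𝟙 (inner (co S) a) + 𝟙 (cut S a) ≡ 1
    pt a rewrite touch-co-co S a with touch S a in e₁
    ... | false rewrite some a e₁ = refl
    ... | true with touch (co S) a
    ...   | true  = refl
    ...   | false = refl

  #-cut≤δ : ∀ S a → 𝟙 (cut S a) ≤ ∑ (λ d → 𝟙 (a == face d) * 𝟙 (out S d))
  #-cut≤δ S a with cut S a in eq
  ... | false = z≤n
  ... | true  = let (d , fd , od) = cut-out S a eq in
    ≤-trans (≤-reflexive (sym (cong₂ (λ x y → 𝟙 x * 𝟙 y) (==-≡ (sym fd)) od))) (∑-term (λ d → 𝟙 (a == face d) * 𝟙 (out S d)) d)

  ∑-darts-at : ∀ (F : Fin V → ℕ) → ∑ {Dart V} (λ d → F (vert d)) ≡ ∑ F * 3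
  ∑-darts-at F = trans (∑-× _) (trans (∑-cong (λ v → trans (∑-Fin3 (λ _ → F v) zero) (lem (F v)))) (∑-*ʳ F 3))
    where
    lem : ∀ x → x + x + x ≡ x * 3
    lem = solve-∀

  within+δ : ∀ S → # (within S) + δ S ≡ # S * 3
  within+δ S = trans (sym (∑-+ _ _)) (trans (∑-cong pt) (∑-darts-at (λ v → 𝟙 (S v))))
    where
    pt : ∀ d → 𝟙 (within S d) + 𝟙 (out S d) ≡ 𝟙 (S (vert d))
    pt d with S (vert d) | S (vert (α d))
    ... | true  | true  = refl
    ... | true  | false = refl
    ... | false | _     = refl

  -- The outer boundary walk of the subgraph induced on S.
  bd : (Fin V → Bool) → Dart V → Bool
  bd S d = within S d ∧ cut S (face d)

  -- A dart of an inner face stays in `S`, because the next dart of that face starts at its other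
  -- end.
  within-split : ∀ S → # (λ d → inner S (face d)) + # (bd S) ≡ # (within S)
  within-split S = trans (sym (∑-+ _ _)) (∑-cong pt)
    where
    pt : ∀ d → 𝟙 (inner S (face d)) + 𝟙 (bd S d) ≡ 𝟙 (within S d)
    pt d with S (vert d) in e₁ | S (vert (α d)) in e₂ | touch (co S) (face d) in e₃
    ... | true  | true  | true  rewrite touch-intro S d e₁ = refl
    ... | true  | true  | false = cong (λ b → 1 + 𝟙 b) (∧-zero (touch S (face d)))
      where ∧-zero : ∀ b → (b ∧ false) ≡ false
            ∧-zero true = refl
            ∧-zero false = refl
    ... | true  | false | true  = refl
    ... | true  | false | false = ⊥-elim (true≢false (trans (sym (touch-intro (co S) (ϕ d) (co-true S e₂))) (trans (cong (touch (co S)) (face-ϕ d)) e₃)))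
    ... | false | _     | true  = refl
    ... | false | _     | false = ⊥-elim (true≢false (trans (sym (touch-intro (co S) d (co-true S e₁))) e₃))

  -- Every face has six darts, less one for a pentagon.
  pents : ∀ (P : Fin nF → Bool) → # (λ d → P (face d)) + # (λ a → P a ∧ pent a) ≡ # P * 6
  pents P = trans (cong (_+ # (λ a → P a ∧ pent a)) (sym (∑-face-len P))) (trans (sym (∑-+ _ _)) (trans (∑-cong pt) (∑-*ʳ _ 6)))
    where
    pt : ∀ a → 𝟙 (P a) * len a + 𝟙 (P a ∧ pent a) ≡ 𝟙 (P a) * 6
    pt a with P a
    ... | false = refl
    ... | true  = trans (cong (_+ 𝟙 (pent a)) (+-identityʳ (len a))) (len+pent a)

  cut-darts : ∀ S → # (λ d → cut S (face d)) ≡ (# (bd S) + # (bd (co S))) + (δ S + δ (co S))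
  cut-darts S = trans (∑-cong pt) (trans (∑-+ _ _) (cong₂ _+_ (∑-+ _ _) (∑-+ _ _)))
    where
    pt : ∀ d → 𝟙 (cut S (face d)) ≡ (𝟙 (bd S d) + 𝟙 (bd (co S) d)) + (𝟙 (out S d) + 𝟙 (out (co S) d))
    pt d rewrite cut-co S (face d) with S (vert d) in e₁ | S (vert (α d)) in e₂
    ... | true  | true  = lem (𝟙 (cut S (face d)))
      where lem : ∀ x → x ≡ x + 0 + (0 + 0)
            lem x = sym (trans (+-identityʳ _) (+-identityʳ x))
    ... | true  | false = 𝟙-true (out-cut S {d} (out-intro S {d} e₁ e₂))
    ... | false | true  = 𝟙-true (trans (sym (cut-co S (face d))) (out-cut (co S) {d} (out-intro (co S) {d} (co-true S e₁) (co-false S e₂))))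
    ... | false | false = sym (+-identityʳ _)

  -- In terms of edges this is `f + n ≤ e + 1` for the graph induced on `S`. A face at the vertex
  -- `v` outside `S` is not inner, so `peel` can always reach an edge that borders a face outside
  -- its set.
  euler-side : ∀ S {u v} → S u ≡ true → S v ≡ false → δ S ≤ 5 → 2 * # (inner S) + 2 * # S ≤ # (within S) + 2
  euler-side S {u} {v} Su Sv δ≤5 = peel S Su _ (inner S) refl (within S)
    (λ d h → ∧-both (∧-right {S (vert d)} h) (trans (cong (S ∘ vert) (α-invol d)) (∧-left h)))
    (λ d h → ∧-left h)
    (λ d h → ∧-both (inner-all S d h) (inner-all S (ϕ d) (trans (cong (inner S) (face-ϕ d)) h)))
    {face (v , zero)} (cong not (touch-intro (co S) (v , zero) (co-true S Sv)))
    (side-connected S δ≤5)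

  -- Euler's inequality on the two sides adds up to Euler's formula, so it is an equality on both.
  record Package (S : Fin V → Bool) : Set where
    field
      faces-S    : 2 * # (inner S) + δ S ≡ # S + 2
      faces-co   : 2 * # (inner (co S)) + δ S ≡ # (co S) + 2
      cut-faces  : # (cut S) ≡ δ S
      unique-out : ∀ {d e} → out S d ≡ true → out S e ≡ true → face d ≡ face e → d ≡ e
      pent-S     : # (λ a → inner S a ∧ pent a) + 2 * δ S ≡ 6 + # (bd S)
      pent-co    : # (λ a → inner (co S) a ∧ pent a) + 2 * δ S ≡ 6 + # (bd (co S))
      pent-cut   : # (bd S) + # (bd (co S)) + # (λ a → cut S a ∧ pent a) ≡ 4 * δ S

  package : ∀ S {u v} → S u ≡ true → S v ≡ false → δ S ≤ 5 → Package S
  package S {u} {v} Su Sv δ≤5 = record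
    { faces-S = eqS ; faces-co = eqC ; cut-faces = ≤-antisym K≤k k≤K ; unique-out = uniq
    ; pent-S = pentS ; pent-co = pentC ; pent-cut = pentK }
    where
    k = δ S
    n = # S
    n' = # (co S)
    f = # (inner S)
    f' = # (inner (co S))
    K = # (cut S)
    -- Cubicity, `w + k ≡ n * 3`, eliminates the number of darts within the side.
    le : ∀ (f n w k : ℕ) → 2 * f + 2 * n ≤ w + 2 → w + k ≡ n * 3 → 2 * f + k ≤ n + 2
    le f n w k p q = farkas 0 (f ∷ n ∷ w ∷ k ∷ []) ((1 , 2 ⊗ x₀ ⊕ 2 ⊗ x₁ ≼ x₂ ⊕ con 2) ∷ (1 , x₂ ⊕ x₃ ≼ 3 ⊗ x₁) ∷ [])
      (2 ⊗ x₀ ⊕ x₃ ≼ x₁ ⊕ con 2) (p , ≤-reflexive (trans q (*-comm n 3)) , tt)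
    leS : 2 * f + k ≤ n + 2
    leS = le f n (# (within S)) k (euler-side S Su Sv δ≤5) (within+δ S)
    leC : 2 * f' + k ≤ n' + 2
    leC = le f' n' (# (within (co S))) k (euler-side (co S) {v} {u} (co-true S Sv) (co-false S Su) (subst (_≤ 5) (sym (δ-co S)) δ≤5))
            (trans (cong (# (within (co S)) +_) (sym (δ-co S))) (within+δ (co S)))
    K≤k : K ≤ k
    K≤k = subst (K ≤_) (∑-face _) (∑-mono (#-cut≤δ S))
    eulerV : 2 * nF ≡ (n + n') + 4
    eulerV = trans (+-cancelˡ-≡ (2 * V) _ _ (trans euler (lem V))) (cong (_+ 4) (sym (#-co S)))
      where
      lem : ∀ V → 3 * V + 4 ≡ 2 * V + (V + 4)
      lem = solve-∀
    eulerK : 2 * (f + f' + K) ≡ (n + n') + 4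
    eulerK = trans (cong (2 *_) (face-kinds S)) eulerV
    -- The two side inequalities add up to `2 (f + f' + k) ≤ n + n' + 4`, and by Euler's formula the
    -- right side is `2 (f + f' + K)`.
    k≤K : k ≤ K
    k≤K = farkas 1 (k ∷ K ∷ f ∷ f' ∷ n ∷ n' ∷ [])
      ((1 , 2 ⊗ x₂ ⊕ x₀ ≼ x₄ ⊕ con 2) ∷ (1 , 2 ⊗ x₃ ⊕ x₀ ≼ x₅ ⊕ con 2) ∷ (1 , (x₄ ⊕ x₅) ⊕ con 4 ≼ 2 ⊗ (x₂ ⊕ x₃ ⊕ x₁)) ∷ [])
      (x₀ ≼ x₁) (leS , leC , ≤-reflexive (sym eulerK) , tt)
    eqS : 2 * f + k ≡ n + 2
    eqS = ≤-antisym leS (farkas 0 (k ∷ K ∷ f ∷ f' ∷ n ∷ n' ∷ [])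
      ((1 , 2 ⊗ x₃ ⊕ x₀ ≼ x₅ ⊕ con 2) ∷ (1 , (x₄ ⊕ x₅) ⊕ con 4 ≼ 2 ⊗ (x₂ ⊕ x₃ ⊕ x₁)) ∷ (2 , x₁ ≼ x₀) ∷ [])
      (x₄ ⊕ con 2 ≼ 2 ⊗ x₂ ⊕ x₀) (leC , ≤-reflexive (sym eulerK) , K≤k , tt))
    eqC : 2 * f' + k ≡ n' + 2
    eqC = ≤-antisym leC (farkas 0 (k ∷ K ∷ f ∷ f' ∷ n ∷ n' ∷ [])
      ((1 , 2 ⊗ x₂ ⊕ x₀ ≼ x₄ ⊕ con 2) ∷ (1 , (x₄ ⊕ x₅) ⊕ con 4 ≼ 2 ⊗ (x₂ ⊕ x₃ ⊕ x₁)) ∷ (2 , x₁ ≼ x₀) ∷ [])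
      (x₅ ⊕ con 2 ≼ 2 ⊗ x₃ ⊕ x₀) (leS , ≤-reflexive (sym eulerK) , K≤k , tt))
    uniq : ∀ {d e} → out S d ≡ true → out S e ≡ true → face d ≡ face e → d ≡ e
    uniq {d} {e} od oe h = #-unique (λ x → (face d == face x) ∧ out S x) le1 {d} {e}
        (∧-both (==-refl (face d)) od) (∧-both (==-≡ h) oe)
      where
      -- Every cut face has at least one dart leaving `S`, and `K ≡ k` says that the totals agree,
      -- so it has exactly one.
      le1 : # (λ x → (face d == face x) ∧ out S x) ≤ 1
      le1 = subst (_≤ 1) (trans (∑-tight (#-cut≤δ S) (subst (_≤ K) (sym (∑-face _)) k≤K) (face d))
              (∑-cong (λ x → sym (∧-𝟙 (face d == face x) (out S x))))) (𝟙≤1 (cut S (face d)))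
    -- The inner faces have `6 f - p` darts, which is also `w - b`; substituting for `w` and then
    -- for `n` cancels `f`.
    pentLem : ∀ f n k I b w p → 2 * f + k ≡ n + 2 → w + k ≡ n * 3 → I + b ≡ w → I + p ≡ f * 6 → p + 2 * k ≡ 6 + b
    pentLem f n k I b w p e₁ e₂ e₃ e₄ = ≤-antisym
      (farkas 0 ρ ((3 , 2 ⊗ x₀ ⊕ x₂ ≼ x₁ ⊕ con 2) ∷ (1 , 3 ⊗ x₁ ≼ x₅ ⊕ x₂) ∷ (1 , x₅ ≼ x₃ ⊕ x₄) ∷ (1 , x₃ ⊕ x₆ ≼ 6 ⊗ x₀) ∷ [])
         (x₆ ⊕ 2 ⊗ x₂ ≼ con 6 ⊕ x₄) (≤-reflexive e₁ , ≤-reflexive (trans (*-comm 3 n) (sym e₂)) , ≤-reflexive (sym e₃) , ≤-reflexive (trans e₄ (*-comm f 6)) , tt))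
      (farkas 0 ρ ((3 , x₁ ⊕ con 2 ≼ 2 ⊗ x₀ ⊕ x₂) ∷ (1 , x₅ ⊕ x₂ ≼ 3 ⊗ x₁) ∷ (1 , x₃ ⊕ x₄ ≼ x₅) ∷ (1 , 6 ⊗ x₀ ≼ x₃ ⊕ x₆) ∷ [])
         (con 6 ⊕ x₄ ≼ x₆ ⊕ 2 ⊗ x₂) (≤-reflexive (sym e₁) , ≤-reflexive (trans e₂ (*-comm n 3)) , ≤-reflexive e₃ , ≤-reflexive (trans (*-comm 6 f) (sym e₄)) , tt))
      where ρ = f ∷ n ∷ k ∷ I ∷ b ∷ w ∷ p ∷ []
    pentS : # (λ a → inner S a ∧ pent a) + 2 * k ≡ 6 + # (bd S)
    pentS = pentLem f n k _ _ (# (within S)) _ eqS (within+δ S) (within-split S) (pents (inner S))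
    pentC : # (λ a → inner (co S) a ∧ pent a) + 2 * k ≡ 6 + # (bd (co S))
    pentC = pentLem f' n' k _ _ (# (within (co S))) _ eqC (trans (cong (# (within (co S)) +_) (sym (δ-co S))) (within+δ (co S)))
      (within-split (co S)) (pents (inner (co S)))
    -- The `k` cut faces have `6 k - p` darts: the two boundary walks and both darts of every cut
    -- edge.
    pentK : # (bd S) + # (bd (co S)) + # (λ a → cut S a ∧ pent a) ≡ 4 * k
    pentK = lem (# (bd S)) (# (bd (co S))) (# (λ a → cut S a ∧ pent a)) k K _ (trans (cut-darts S) (cong (λ z → # (bd S) + # (bd (co S)) + (k + z)) (δ-co S)))
      (pents (cut S)) (≤-antisym K≤k k≤K)
      where
      lem : ∀ b b' p k K D → D ≡ (b + b') + (k + k) → D + p ≡ K * 6 → K ≡ k → b + b' + p ≡ 4 * k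
      lem b b' p k .k .((b + b') + (k + k)) refl e refl = +-cancelʳ-≡ (k + k) _ _ (trans (r b b' p k) (trans e (s k)))
        where
        r : ∀ b b' p k → b + b' + p + (k + k) ≡ (b + b') + (k + k) + p
        r = solve-∀
        s : ∀ k → k * 6 ≡ 4 * k + (k + k)
        s = solve-∀

-- Moving a cut inwards

module Shift {V : ℕ} (α : Dart V → Dart V) (full : IsFullerene α) where

  open IsFullerene full
  open Cuts α full public

  outs : (Fin V → Bool) → Fin V → ℕ
  outs S v = # (λ i → out S (v , i))

  Single : (Fin V → Bool) → Set
  Single S = ∀ v → outs S v ≤ 1

  -- The rim of S: the vertices of its outer boundary walk.
  bv : (Fin V → Bool) → Fin V → Bool
  bv S v = S v ∧ pos (# (λ i → cut S (face (v , i))))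

  bv-intro : ∀ S {d} → S (vert d) ≡ true → cut S (face d) ≡ true → bv S (vert d) ≡ true
  bv-intro S {v , i} p q = ∧-both p (pos-≥ (#-pos (λ i → cut S (face (v , i))) {i} q))

  bv-elim : ∀ S {v} → bv S v ≡ true → ∃[ i ] cut S (face (v , i)) ≡ true
  bv-elim S {v} h = #-witness _ (≥-pos (∧-right {S v} h))

  shift : (Fin V → Bool) → Fin V → Bool
  shift S v = S v ∧ not (bv S v)

  shift-sub : ∀ S {v} → shift S v ≡ true → S v ≡ true
  shift-sub S h = ∧-left h

  shift-cut : ∀ S {d} → cut S (face d) ≡ true → shift S (vert d) ≡ false
  shift-cut S {d} h with true⊎false (S (vert d))
  ... | inj₂ e = cong (_∧ not (bv S (vert d))) e
  ... | inj₁ e = trans (cong (λ b → S (vert d) ∧ not b) (bv-intro S {d} e h)) (∧-zeroʳ _)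

  shift-cut-ϕ : ∀ S {d} → cut S (face d) ≡ true → shift S (vert (α d)) ≡ false
  shift-cut-ϕ S {d} h = shift-cut S {ϕ d} (trans (cong (cut S) (face-ϕ d)) h)

  -- `ϕ` takes `α (σ (σ d))` to `d`, so both darts lie on the same cut face.
  shift-cut-σσ : ∀ S {d} → cut S (face d) ≡ true → shift S (vert (α (σ (σ d)))) ≡ false
  shift-cut-σσ S {d} h = shift-cut S {α (σ (σ d))} (trans (cong (cut S) (trans (sym (face-σ (σ (σ d)))) (cong face (σ³ d)))) h)

  shift-size : ∀ S → # (shift S) + # (bv S) ≡ # S
  shift-size S = trans (sym (∑-+ _ _)) (∑-cong (λ v → pt (S v)))
    where
    pt : ∀ s {c} → 𝟙 (s ∧ not (s ∧ c)) + 𝟙 (s ∧ c) ≡ 𝟙 s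
    pt false = refl
    pt true {true}  = refl
    pt true {false} = refl

  co-shift-size : ∀ S → # (co S) ≤ # (co (shift S))
  co-shift-size S = ∑-mono (λ v → pt (S v))
    where
    pt : ∀ s {c} → 𝟙 (not s) ≤ 𝟙 (not (s ∧ c))
    pt true  = z≤n
    pt false = ≤-refl

  bd-intro : ∀ S {d} → S (vert d) ≡ true → S (vert (α d)) ≡ true → cut S (face d) ≡ true → bd S d ≡ true
  bd-intro S p q r rewrite p | q = r

  -- Each rim vertex starts a dart of the boundary walk: its dart on a cut face or, when that one
  -- leaves `S`, the next in the rotation, which lies on the cut face across the cut edge and stays
  -- in `S` by `Single`.
  bv≤bd : ∀ S → Single S → # (bv S) ≤ # (bd S)
  bv≤bd S single = subst (# (bv S) ≤_) (sym (∑-× _)) (∑-mono pt)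
    where
    pt : ∀ v → 𝟙 (bv S v) ≤ # (λ i → bd S (v , i))
    pt v with bv S v in eq
    ... | false = z≤n
    ... | true with bv-elim S eq
    ...   | i , c with S (vert (α (v , i))) in e
    ...     | true  = #-pos (λ i → bd S (v , i)) {i} (bd-intro S {v , i} (∧-left eq) e c)
    ...     | false = #-pos (λ i → bd S (v , i)) {next3 i} (bd-intro S {v , next3 i} (∧-left eq) stay
                        (trans (cong (cut S) (face-σ (v , i))) (out-cut-α S {v , i} o)))
      where
      o : out S (v , i) ≡ true
      o = out-intro S {v , i} (∧-left eq) e
      i≢next : ∀ j → j ≢ next3 j
      i≢next zero ()
      i≢next (suc zero) ()
      i≢next (suc (suc zero)) ()
      stay : S (vert (α (v , next3 i))) ≡ true
      stay with S (vert (α (v , next3 i))) in e'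
      ... | true  = refl
      ... | false = ⊥-elim (i≢next i (#-unique (λ j → out S (v , j)) (single v) o (out-intro S {v , next3 i} (∧-left eq) e')))

  co-shift-miss : ∀ S e → shift S (vert (α e)) ≡ false → 𝟙 (out (co (shift S)) e) ≡ 0
  co-shift-miss S e h = trans (cong (λ b → 𝟙 (co (shift S) (vert e) ∧ not (not b))) h) (cong 𝟙 (∧-zeroʳ _))

  -- A rim vertex with an edge leaving S has no edge into shift S, since its other two edges lie on cut faces.
  shift-point : ∀ S → Single S → ∀ v → outs (co (shift S)) v + outs S v ≤ 𝟙 (bv S v)
  shift-point S single v with true⊎false (S v)
  ... | inj₂ Sv = ≤-trans (≤-reflexive (cong₂ _+_ (trans (∑-cong no-in) ∑-0) (trans (∑-cong (λ i → cong (λ b → 𝟙 (b ∧ not (S (vert (α (v , i)))))) Sv)) ∑-0))) z≤n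
    where
    no-in : ∀ i → 𝟙 (out (co (shift S)) (v , i)) ≡ 0
    no-in i = 𝟙-false (¬true⇒false λ h → true≢false (trans (sym (trans (sym (not-involutive _)) (∧-right {co (shift S) v} h)))
      (shift-cut S {α (v , i)} (out-cut S {α (v , i)} (out-intro S {α (v , i)} (∧-left (trans (sym (not-involutive _)) (∧-right {co (shift S) v} h)))
        (trans (cong (S ∘ vert) (α-invol (v , i))) Sv))))))
  ... | inj₁ Sv with true⊎false (pos (# (λ i → cut S (face (v , i)))))
  ...   | inj₂ eq = ≤-trans (≤-reflexive (cong₂ _+_ (trans (∑-cong no-in) ∑-0) (trans (∑-cong no-out) ∑-0))) z≤n
    where
    shv : shift S v ≡ true
    shv = cong₂ (λ x y → x ∧ not (x ∧ y)) Sv eq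
    no-in : ∀ i → 𝟙 (out (co (shift S)) (v , i)) ≡ 0
    no-in i = cong (λ b → 𝟙 (not b ∧ not (co (shift S) (vert (α (v , i)))))) shv
    no-out : ∀ i → 𝟙 (out S (v , i)) ≡ 0
    no-out i = 𝟙-false (¬true⇒false λ h → true≢false (trans (sym shv) (shift-cut S {v , i} (out-cut S {v , i} h))))
  ...   | inj₁ eq with search (λ i → out S (v , i))
  ...     | inj₁ (i , o) = subst₂ _≤_ (cong (_+ outs S v) (sym zero-in)) (sym (𝟙-true (∧-both Sv eq))) (single v)
    where
    d : Dart V
    d = v , i
    zero-in : outs (co (shift S)) v ≡ 0
    zero-in = trans (∑-vertex (λ e → 𝟙 (out (co (shift S)) e)) d)
      (cong₂ _+_ (cong₂ _+_ (co-shift-miss S d (shift-cut-ϕ S {d} (out-cut S {d} o)))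
                            (co-shift-miss S (σ d) (shift-cut-ϕ S {σ d} (trans (cong (cut S) (face-σ d)) (out-cut-α S {d} o)))))
                 (co-shift-miss S (σ (σ d)) (shift-cut-σσ S {d} (out-cut S {d} o))))
  ...     | inj₂ none = subst₂ _≤_ (cong (outs (co (shift S)) v +_) (sym (trans (∑-cong (λ i → 𝟙-false (none i))) ∑-0))) (sym (𝟙-true (∧-both Sv eq)))
                          (subst (_≤ 1) (sym (+-identityʳ _)) one-in)
    where
    c = bv-elim S {v} (∧-both Sv eq)
    d : Dart V
    d = v , proj₁ c
    -- Both ends of `d` and of `σ (σ d)` lie on the cut face, so only `σ d` can lead into `shift S`.
    one-in : outs (co (shift S)) v ≤ 1
    one-in = subst (_≤ 1) (sym (trans (∑-vertex (λ e → 𝟙 (out (co (shift S)) e)) d)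
        (trans (cong₂ _+_ (cong (_+ 𝟙 (out (co (shift S)) (σ d))) (co-shift-miss S d (shift-cut-ϕ S {d} (proj₂ c)))) (co-shift-miss S (σ (σ d)) (shift-cut-σσ S {d} (proj₂ c)))) (+-identityʳ _))))
      (𝟙≤1 (out (co (shift S)) (σ d)))

  ∑-outs : ∀ S → ∑ (outs S) ≡ δ S
  ∑-outs S = sym (∑-× _)

  shift-sum : ∀ S → ∑ (λ v → outs (co (shift S)) v + outs S v) ≡ δ (shift S) + δ S
  shift-sum S = trans (∑-+ _ _) (cong₂ _+_ (trans (∑-outs (co (shift S))) (δ-co (shift S))) (∑-outs S))

  -- Every edge leaving `S` or entering `shift S` has its end at a rim vertex, and no rim vertex
  -- carries two of them.
  shift-δ : ∀ S → Single S → δ (shift S) + δ S ≤ # (bv S)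
  shift-δ S single = subst (_≤ # (bv S)) (shift-sum S) (∑-mono (shift-point S single))

  shift-tight : ∀ S → Single S → # (bv S) ≤ δ (shift S) + δ S → ∀ v → outs (co (shift S)) v + outs S v ≡ 𝟙 (bv S v)
  shift-tight S single h = ∑-tight (shift-point S single) (subst (# (bv S) ≤_) (sym (shift-sum S)) h)

  ∑-at : ∀ w (F : Dart V → ℕ) → ∑ (λ d → 𝟙 (vert d == w) * F d) ≡ ∑ (λ i → F (w , i))
  ∑-at w F = trans (∑-× _) (trans (∑-cong pt) (∑-select w (λ v → ∑ (λ i → F (v , i)))))
    where
    pt : ∀ v → ∑ (λ i → 𝟙 (v == w) * F (v , i)) ≡ 𝟙 (v == w) * ∑ (λ i → F (v , i))
    pt v with v == w
    ... | true  = trans (∑-cong (λ i → +-identityʳ _)) (sym (+-identityʳ _))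
    ... | false = ∑-0

  remove : (Fin V → Bool) → Fin V → Fin V → Bool
  remove S w v = S v ∧ not (v == w)

  remove-size : ∀ S {w} → S w ≡ true → # (remove S w) + 1 ≡ # S
  remove-size S {w} Sw = trans (cong (# (remove S w) +_) (sym (#-== w))) (trans (sym (∑-+ _ _)) (∑-cong pt))
    where
    pt : ∀ v → 𝟙 (remove S w v) + 𝟙 (v == w) ≡ 𝟙 (S v)
    pt v with v == w in eq
    ... | true  rewrite ==-sound {x = v} {w} eq | Sw = refl
    ... | false with S v
    ...   | true  = refl
    ...   | false = refl

  co-remove-size : ∀ S w → # (co S) ≤ # (co (remove S w))
  co-remove-size S w = ∑-mono (λ v → pt (S v))
    where
    pt : ∀ s {c} → 𝟙 (not s) ≤ 𝟙 (not (s ∧ c))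
    pt true  = z≤n
    pt false = ≤-refl

  outs-compl : ∀ S {w} → S w ≡ true → ∑ (λ i → 𝟙 (S (vert (α (w , i))))) + outs S w ≡ 3
  outs-compl S {w} Sw = trans (sym (∑-+ _ _)) (trans (∑-cong pt) (∑1-Fin 3))
    where
    pt : ∀ i → 𝟙 (S (vert (α (w , i)))) + 𝟙 (out S (w , i)) ≡ 1
    pt i rewrite Sw with S (vert (α (w , i)))
    ... | true  = refl
    ... | false = refl

  -- Moving `w` to the other side exchanges its two or three cut edges for the at most one edge that
  -- it has inside `S`.
  remove-δ : ∀ S {w} → S w ≡ true → 2 ≤ outs S w → δ (remove S w) + 1 ≤ δ S
  remove-δ S {w} Sw two = arith _ _ _ _
      (subst₂ _≤_ (trans (∑-+ _ _) (cong (δ (remove S w) +_) (∑-at w (λ d → 𝟙 (out S d)))))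
                  (trans (∑-+ _ _) (cong (δ S +_) ins)) (∑-mono pt))
      (outs-compl S Sw) two
    where
    ins : ∑ (λ d → 𝟙 (vert (α d) == w) * 𝟙 (S (vert d))) ≡ ∑ (λ i → 𝟙 (S (vert (α (w , i)))))
    ins = trans (∑-cong (λ d → cong (λ e → 𝟙 (vert (α d) == w) * 𝟙 (S (vert e))) (sym (α-invol d))))
         (trans (∑-α (λ d → 𝟙 (vert d == w) * 𝟙 (S (vert (α d))))) (∑-at w (λ d → 𝟙 (S (vert (α d))))))
    arith : ∀ δ' o δ i → δ' + o ≤ δ + i → i + o ≡ 3 → 2 ≤ o → δ' + 1 ≤ δ
    arith δ' o δ i p q r = farkas 0 (δ' ∷ o ∷ δ ∷ i ∷ []) ((1 , x₀ ⊕ x₁ ≼ x₂ ⊕ x₃) ∷ (1 , x₃ ⊕ x₁ ≼ con 3) ∷ (2 , con 2 ≼ x₁) ∷ [])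
      (x₀ ⊕ con 1 ≼ x₂) (p , ≤-reflexive q , r , tt)
    pt : ∀ d → 𝟙 (out (remove S w) d) + 𝟙 (vert d == w) * 𝟙 (out S d) ≤ 𝟙 (out S d) + 𝟙 (vert (α d) == w) * 𝟙 (S (vert d))
    pt d = bool (S (vert d)) (vert d == w) (S (vert (α d))) (vert (α d) == w)
      where
      bool : ∀ s e s' e' → 𝟙 ((s ∧ not e) ∧ not (s' ∧ not e')) + 𝟙 e * 𝟙 (s ∧ not s') ≤ 𝟙 (s ∧ not s') + 𝟙 e' * 𝟙 s
      bool false true  s' e' = z≤n
      bool false false s' e' = z≤n
      bool true true true e' = z≤n
      bool true true false e' = s≤s z≤n
      bool true false true true = ≤-refl
      bool true false true false = ≤-refl
      bool true false false e' = s≤s z≤n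

  -- A connected side has at least as many vertices as cut edges exactly when it contains a cycle,
  -- because 3 |S| = 2 e(S) + δ S.
  record NonDeg (S : Fin V → Bool) : Set where
    constructor nondeg
    field
      S≥1  : 1 ≤ # S
      co≥1 : 1 ≤ # (co S)
      S≥δ  : δ S ≤ # S
      co≥δ : δ S ≤ # (co S)

  NonDeg-package : ∀ S → NonDeg S → δ S ≤ 5 → Package S
  NonDeg-package S (nondeg p q _ _) δ≤5 =
    package S (proj₂ (#-witness S p)) (not-true (proj₂ (#-witness (co S) q))) δ≤5

  #-co-co : ∀ S → # (co (co S)) ≡ # S
  #-co-co S = ∑-cong (λ v → cong 𝟙 (not-involutive (S v)))

  NonDeg-co : ∀ S → NonDeg S → NonDeg (co S)
  NonDeg-co S (nondeg p q r s) = nondeg q (subst (1 ≤_) (sym (#-co-co S)) p)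
    (subst (_≤ # (co S)) (sym (δ-co S)) s) (subst₂ _≤_ (sym (δ-co S)) (sym (#-co-co S)) r)

  Small : ℕ → Set
  Small k = ∀ S → NonDeg S → k ≤ δ S

  small-3 : Small 3
  small-3 S (nondeg p q _ _) = cut≥3 S (proj₂ (#-witness S p)) (not-true (proj₂ (#-witness (co S) q)))

  -- A vertex with two cut edges could be moved to the other side. The side loses one vertex and the
  -- cut at least one edge, so the new cut is again nondegenerate, against minimality.
  small-single : ∀ {k} → 3 ≤ k → Small k → ∀ S → NonDeg S → δ S ≡ k → Single S
  small-single {k} 3≤k small S (nondeg S≥1 co≥1 S≥δ co≥δ) e v with outs S v ≤? 1
  ... | yes p = p
  ... | no ¬p = ⊥-elim (<-irrefl refl (≤-trans (≤-trans (≤-reflexive (+-comm 1 k)) (+-monoˡ-≤ 1 k≤δ')) (≤-trans δ'<k (≤-reflexive e))))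
    where
    Sv : S v ≡ true
    Sv with true⊎false (S v)
    ... | inj₁ h  = h
    ... | inj₂ eq = ⊥-elim (¬p (≤-trans (≤-reflexive (trans (∑-cong (λ i → cong (λ b → 𝟙 (b ∧ not (S (vert (α (v , i)))))) eq)) ∑-0)) z≤n))
    S' = remove S v
    δ'<k : δ S' + 1 ≤ δ S
    δ'<k = remove-δ S Sv (≰⇒> ¬p)
    δ'≤n' : δ S' ≤ # S'
    δ'≤n' = +-cancelʳ-≤ 1 _ _ (≤-trans δ'<k (≤-trans S≥δ (≤-reflexive (sym (remove-size S Sv)))))
    k≤δ' : k ≤ δ S'
    k≤δ' = small S' (nondeg (+-cancelʳ-≤ 1 _ _ (≤-trans (≤-trans (s≤s (s≤s z≤n)) (≤-trans 3≤k (≤-reflexive (sym e))))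
                              (≤-trans S≥δ (≤-reflexive (sym (remove-size S Sv))))))
                            (≤-trans co≥1 (co-remove-size S v))
                            δ'≤n'
                            (≤-trans (≤-trans (m≤m+n (δ S') 1) δ'<k) (≤-trans co≥δ (co-remove-size S v))))

  record Shifted (S : Fin V → Bool) : Set where
    field
      bd≡    : # (bd S) ≡ 2 * δ S
      bv≡    : # (bv S) ≡ 2 * δ S
      δ≡     : δ (shift S) ≡ δ S
      degree : NonDeg (shift S)

  inner∧pent≤ : ∀ S a → 𝟙 (inner S a ∧ pent a) ≤ 𝟙 (inner S a)
  inner∧pent≤ S a with inner S a
  ... | true  = 𝟙≤1 (pent a)
  ... | false = z≤n

  inner-pent≤ : ∀ S → # (λ a → inner S a ∧ pent a) ≤ # (inner S)
  inner-pent≤ S = ∑-mono (inner∧pent≤ S)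

  -- The identities `p + 2k = 6 + b` and `2f + k = n + 2` with `p ≤ f` give `n ≥ 10 + 2b - 3k`.
  -- Deleting the at most `b` rim vertices leaves `n₁ ≥ 10 + b - 3k`; this and `k₁ + k ≤ b` decide
  -- the cases.
  shift-step : ∀ {k} → 3 ≤ k → k ≤ 5 → Small k → ∀ S → NonDeg S → δ S ≡ k → # (bd S) ≤ 2 * k →
    (k ≡ 5 × # S ≡ 5) ⊎ Shifted S
  shift-step {k} 3≤k k≤5 small S nd e b≤2k = main
    where
    open NonDeg nd
    open Package (NonDeg-package S nd (subst (_≤ 5) (sym e) k≤5))
    single = small-single 3≤k small S nd e
    S₁ = shift S
    n n₁ b B k₁ f p : ℕ
    n = # S
    n₁ = # S₁
    b = # (bd S)
    B = # (bv S)
    k₁ = δ S₁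
    f = # (inner S)
    p = # (λ a → inner S a ∧ pent a)
    h₁ : k₁ + k ≤ B
    h₁ = subst (λ z → k₁ + z ≤ B) e (shift-δ S single)
    h₂ : B ≤ b
    h₂ = bv≤bd S single
    h₃ : n₁ + B ≡ n
    h₃ = shift-size S
    h₄ : p + 2 * k ≡ 6 + b
    h₄ = subst (λ z → p + 2 * z ≡ 6 + b) e pent-S
    h₅ : 2 * f + k ≡ n + 2
    h₅ = subst (λ z → 2 * f + z ≡ n + 2) e faces-S
    h₆ : p ≤ f
    h₆ = inner-pent≤ S
    h₇ : k ≤ n
    h₇ = subst (_≤ n) e S≥δ
    ρ = n ∷ n₁ ∷ b ∷ B ∷ k₁ ∷ f ∷ p ∷ k ∷ []
    main : (k ≡ 5 × n ≡ 5) ⊎ Shifted S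
    main with 1 ≤? n₁
    -- Here `n ≤ b`, so `n + 10 ≤ 3k`; with `k ≤ n` and `k ≤ 5` only `k = n = 5` remains.
    ... | no ¬1≤n₁ = inj₁ (k≡5 , ≤-antisym n≤5 (subst (_≤ n) k≡5 h₇))
      where
      n₁≤0 : n₁ ≤ 0
      n₁≤0 = ≤-pred (≰⇒> ¬1≤n₁)
      n≤ : n + 10 ≤ 3 * k
      n≤ = farkas 0 ρ
        ((2 , con 6 ⊕ x₂ ≼ x₆ ⊕ 2 ⊗ x₇) ∷ (2 , x₆ ≼ x₅) ∷ (1 , 2 ⊗ x₅ ⊕ x₇ ≼ x₀ ⊕ con 2) ∷ (2 , x₀ ≼ x₁ ⊕ x₃) ∷ (2 , x₃ ≼ x₂) ∷ (2 , x₁ ≼ con 0) ∷ [])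
        (x₀ ⊕ con 10 ≼ 3 ⊗ x₇)
        (≤-reflexive (sym h₄) , h₆ , ≤-reflexive h₅ , ≤-reflexive (sym h₃) , h₂ , n₁≤0 , tt)
      k≡5 : k ≡ 5
      k≡5 = ≤-antisym k≤5 (farkas 1 ρ ((1 , x₀ ⊕ con 10 ≼ 3 ⊗ x₇) ∷ (1 , x₇ ≼ x₀) ∷ []) (con 5 ≼ x₇) (n≤ , h₇ , tt))
      n≤5 : n ≤ 5
      n≤5 = farkas 0 ρ ((1 , x₀ ⊕ con 10 ≼ 3 ⊗ x₇) ∷ (3 , x₇ ≼ con 5) ∷ []) (x₀ ≼ con 5) (n≤ , k≤5 , tt)
    ... | yes 1≤n₁ with k₁ ≤? n₁
    -- `n₁ < k₁ ≤ b - k` would give `11 ≤ 2k`, against `k ≤ 5`.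
    ...   | no ¬k₁≤n₁ = ⊥-elim (no1 (farkas 0 ρ
        ((2 , con 6 ⊕ x₂ ≼ x₆ ⊕ 2 ⊗ x₇) ∷ (2 , x₆ ≼ x₅) ∷ (1 , 2 ⊗ x₅ ⊕ x₇ ≼ x₀ ⊕ con 2) ∷ (1 , x₀ ≼ x₁ ⊕ x₃) ∷ (2 , x₃ ≼ x₂) ∷
         (1 , con 1 ⊕ x₁ ≼ x₄) ∷ (1 , x₄ ⊕ x₇ ≼ x₃) ∷ (2 , x₇ ≼ con 5) ∷ [])
        (con 1 ≼ con 0)
        (≤-reflexive (sym h₄) , h₆ , ≤-reflexive h₅ , ≤-reflexive (sym h₃) , h₂ , ≰⇒> ¬k₁≤n₁ , h₁ , k≤5 , tt)))
      where no1 : ¬ (1 ≤ 0)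
            no1 ()
    -- `shift S` is nondegenerate, so `k ≤ k₁` by minimality, and the chain
    -- `2k ≤ k₁ + k ≤ B ≤ b ≤ 2k` collapses.
    ...   | yes k₁≤n₁ = inj₂ (record
        { bd≡ = trans (≤-antisym b≤2k 2k≤b) 2k≡ ; bv≡ = trans (≤-antisym (≤-trans h₂ b≤2k) 2k≤B) 2k≡
        ; δ≡ = trans (≤-antisym k₁≤k k≤k₁) (sym e) ; degree = nd₁ })
      where
      2k≡ : 2 * k ≡ 2 * δ S
      2k≡ = cong (2 *_) (sym e)
      k₁≤k : k₁ ≤ k
      k₁≤k = farkas 0 ρ ((1 , x₄ ⊕ x₇ ≼ x₃) ∷ (1 , x₃ ≼ x₂) ∷ (1 , x₂ ≼ 2 ⊗ x₇) ∷ []) (x₄ ≼ x₇) (h₁ , h₂ , b≤2k , tt)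
      nd₁ : NonDeg S₁
      nd₁ = nondeg 1≤n₁ (≤-trans co≥1 (co-shift-size S)) k₁≤n₁
        (≤-trans k₁≤k (≤-trans (subst (_≤ # (co S)) e co≥δ) (co-shift-size S)))
      k≤k₁ : k ≤ k₁
      k≤k₁ = small S₁ nd₁
      2k≤B : 2 * k ≤ B
      2k≤B = farkas 0 ρ ((1 , x₄ ⊕ x₇ ≼ x₃) ∷ (1 , x₇ ≼ x₄) ∷ []) (2 ⊗ x₇ ≼ x₃) (h₁ , k≤k₁ , tt)
      2k≤b : 2 * k ≤ b
      2k≤b = ≤-trans 2k≤B h₂

  bd-total : ∀ S → NonDeg S → δ S ≤ 5 → # (bd S) + # (bd (co S)) ≤ 4 * δ S
  bd-total S nd p = ≤-trans (m≤m+n _ _) (≤-reflexive (Package.pent-cut (NonDeg-package S nd p)))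

  -- If the boundary walk of `S` is longer than `2k`, that of the complement is shorter; but
  -- `shift-step` for the complement allows only length `2k`, the pentagon case needing `k = 5`.
  -- Otherwise `shift S` is a smaller counterexample.
  small-descent : ∀ {k} → 3 ≤ k → k ≤ 4 → Small k → ∀ fuel S → # S ≤ fuel → NonDeg S → δ S ≡ k → ⊥
  small-descent {k} 3≤k k≤4 small fuel S size nd e with # (bd S) ≤? 2 * k
  ... | no ¬p = other
    where
    k≤5 = ≤-trans k≤4 (n≤1+n 4)
    b' = # (bd (co S))
    total : # (bd S) + b' ≤ 4 * k
    total = subst (λ z → # (bd S) + b' ≤ 4 * z) e (bd-total S nd (subst (_≤ 5) (sym e) k≤5))
    b'<2k : b' + 1 ≤ 2 * k
    b'<2k = farkas 0 (# (bd S) ∷ b' ∷ k ∷ []) ((1 , x₀ ⊕ x₁ ≼ 4 ⊗ x₂) ∷ (1 , con 1 ⊕ 2 ⊗ x₂ ≼ x₀) ∷ []) (x₁ ⊕ con 1 ≼ 2 ⊗ x₂) (total , ≰⇒> ¬p , tt)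
    conclude : (k ≡ 5 × # (co S) ≡ 5) ⊎ Shifted (co S) → ⊥
    conclude (inj₁ (k≡5 , _)) = <-irrefl k≡5 (s≤s k≤4)
    conclude (inj₂ sh) = <-irrefl (trans (Shifted.bd≡ sh) (cong (2 *_) (trans (δ-co S) e))) (subst (_≤ 2 * k) (+-comm b' 1) b'<2k)
    other : ⊥
    other = conclude (shift-step 3≤k k≤5 small (co S) (NonDeg-co S nd) (trans (δ-co S) e) (≤-trans (m≤m+n b' 1) b'<2k))
  ... | yes p with shift-step 3≤k (≤-trans k≤4 (n≤1+n 4)) small S nd e p
  ...   | inj₁ (k≡5 , _) = <-irrefl k≡5 (s≤s k≤4)
  ...   | inj₂ sh with fuel
  ...     | zero = <-irrefl refl (≤-trans (NonDeg.S≥1 nd) size)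
  ...     | suc fuel' = small-descent 3≤k k≤4 small fuel' (shift S) smaller (Shifted.degree sh) (trans (Shifted.δ≡ sh) e)
    where
    smaller : # (shift S) ≤ fuel'
    smaller = farkas 0 (# (shift S) ∷ # (bv S) ∷ # S ∷ k ∷ fuel' ∷ [])
      ((1 , x₀ ⊕ x₁ ≼ x₂) ∷ (1 , 2 ⊗ x₃ ≼ x₁) ∷ (2 , con 3 ≼ x₃) ∷ (1 , x₂ ≼ con 1 ⊕ x₄) ∷ []) (x₀ ≼ x₄)
      (≤-reflexive (shift-size S) , ≤-reflexive (sym (trans (Shifted.bv≡ sh) (cong (2 *_) e))) , 3≤k , size , tt)

  small-suc : ∀ {k} → 3 ≤ k → k ≤ 4 → Small k → Small (suc k)
  small-suc {k} 3≤k k≤4 small S nd with k ≤? δ S | suc k ≤? δ S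
  ... | _     | yes q = q
  ... | no ¬p | no _  = ⊥-elim (¬p (small S nd))
  ... | yes p | no ¬q = ⊥-elim (small-descent 3≤k k≤4 small (# S) S ≤-refl nd (≤-antisym (≤-pred (≰⇒> ¬q)) p))

  small-5 : Small 5
  small-5 = small-suc {4} (n≤1+n 3) ≤-refl (small-suc {3} ≤-refl (n≤1+n 3) small-3)

  five-single : ∀ S → NonDeg S → δ S ≡ 5 → Single S
  five-single = small-single {5} (s≤s (s≤s (s≤s z≤n))) small-5

  five-step : ∀ S → NonDeg S → δ S ≡ 5 → # (bd S) ≤ 10 → # S ≡ 5 ⊎ Shifted S
  five-step S nd e p with shift-step {5} (s≤s (s≤s (s≤s z≤n))) ≤-refl small-5 S nd e p
  ... | inj₁ (_ , q) = inj₁ q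
  ... | inj₂ q = inj₂ q

  -- A shorter walk is impossible: up to length 10, the equalities in `Shifted` make the length
  -- exactly 10.
  five-bd : ∀ S → NonDeg S → δ S ≡ 5 → # S ≢ 5 → 10 ≤ # (bd S)
  five-bd S nd e n≢5 with # (bd S) ≤? 10
  ... | no ¬p = <⇒≤ (≰⇒> ¬p)
  ... | yes p with five-step S nd e p
  ...   | inj₁ q = ⊥-elim (n≢5 q)
  ...   | inj₂ q = ≤-reflexive (sym (trans (Shifted.bd≡ q) (cong (2 *_) e)))

  -- Both walks have length at least 10, while their lengths and the number of cut pentagons add up
  -- to 20.
  five-tight : ∀ S → NonDeg S → δ S ≡ 5 → # S ≢ 5 → # (co S) ≢ 5 →
    # (bd S) ≡ 10 × # (λ a → cut S a ∧ pent a) ≡ 0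
  five-tight S nd e n≢5 n'≢5 =
      ≤-antisym (farkas 0 ρ ((1 , x₀ ⊕ x₁ ⊕ x₂ ≼ con 20) ∷ (1 , con 10 ≼ x₁) ∷ []) (x₀ ≼ con 10) (total , h' , tt)) h
    , n≤0⇒n≡0 (farkas 0 ρ ((1 , x₀ ⊕ x₁ ⊕ x₂ ≼ con 20) ∷ (1 , con 10 ≼ x₁) ∷ (1 , con 10 ≼ x₀) ∷ []) (x₂ ≼ con 0) (total , h' , h , tt))
    where
    ρ = # (bd S) ∷ # (bd (co S)) ∷ # (λ a → cut S a ∧ pent a) ∷ []
    h = five-bd S nd e n≢5
    h' = five-bd (co S) (NonDeg-co S nd) (trans (δ-co S) e) n'≢5
    total : # (bd S) + # (bd (co S)) + # (λ a → cut S a ∧ pent a) ≤ 20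
    total = ≤-reflexive (trans (Package.pent-cut (NonDeg-package S nd (≤-reflexive e))) (cong (4 *_) e))

-- Pentacaps

CycEdge-sym : ∀ {V} {R : Fin V → Fin V → Set} (C : Cycle R) {u v} → CycEdge C u v → CycEdge C v u
CycEdge-sym C (inj₁ (i , inj₁ p)) = inj₁ (i , inj₂ p)
CycEdge-sym C (inj₁ (i , inj₂ p)) = inj₁ (i , inj₁ p)
CycEdge-sym C (inj₂ (inj₁ p))     = inj₂ (inj₂ p)
CycEdge-sym C (inj₂ (inj₂ p))     = inj₂ (inj₁ p)

module Caps {V : ℕ} (α : Dart V → Dart V) (full : IsFullerene α) where

  open IsFullerene full
  open Shift α full public

  Single-eq : ∀ S → Single S → ∀ {x y} → out S x ≡ true → out S y ≡ true → vert x ≡ vert y → x ≡ y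
  Single-eq S single {v , i} {.v , j} ox oy refl = cong (v ,_) (#-unique (λ i → out S (v , i)) (single v) ox oy)

  inner-not-cut : ∀ S a → inner S a ≡ true → cut S a ≡ true → ⊥
  inner-not-cut S a p q = true≢false (trans (sym (∧-right {touch S a} q)) (not-true p))

  ϕα : ∀ d → ϕ (α d) ≡ σ d
  ϕα d = cong σ (α-invol d)

  σσϕ : ∀ d → σ (σ (ϕ d)) ≡ α d
  σσϕ d = σ³ (α d)

  record Penta (S : Fin V → Bool) : Set where
    field
      z        : Dart V
      pentagon : Pentagon α z
      spoke    : ∀ i → out S (σ (iter i ϕ z)) ≡ true
      distinct : ∀ {i j} → i < j → j < 5 → vert (iter i ϕ z) ≢ vert (iter j ϕ z)
      covers   : ∀ {v} → S v ≡ true → ∃[ i ] vert (iter (toℕ {5} i) ϕ z) ≡ v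

  module PentaProof (S : Fin V → Bool) (nd : NonDeg S) (e : δ S ≡ 5) (n≡5 : # S ≡ 5) where

    open NonDeg nd
    open Package (NonDeg-package S nd (≤-reflexive e))
    single = five-single S nd e
    outs≤ : ∀ v → outs S v ≤ 𝟙 (S v)
    outs≤ v with true⊎false (S v)
    ... | inj₁ p = subst (outs S v ≤_) (sym (𝟙-true p)) (single v)
    ... | inj₂ p = ≤-trans (≤-reflexive (trans (∑-cong (λ i → cong (λ b → 𝟙 (b ∧ not (S (vert (α (v , i)))))) p)) ∑-0)) z≤n
    -- Five vertices with at most one of the five cut edges each, so exactly one.
    outs≡ : ∀ v → outs S v ≡ 𝟙 (S v)
    outs≡ = ∑-tight outs≤ (≤-reflexive (trans n≡5 (trans (sym e) (sym (∑-outs S)))))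
    -- The dart `x` and the reverse of `σ (σ x)` lie on an inner face, so neither edge is cut, and
    -- the cut edge at `vert x` is `σ x`.
    spoke-at : ∀ x → inner S (face x) ≡ true → out S (σ x) ≡ true
    spoke-at x h = 𝟙-pos (≤-reflexive (sym (trans (sym (trans (cong₂ _+_ (cong (_+ 𝟙 (out S (σ x))) no₀) no₂) (+-identityʳ _)))
        (trans (sym (∑-vertex (λ y → 𝟙 (out S y)) x)) (trans (outs≡ (vert x)) (𝟙-true (inner-all S x h)))))))
      where
      no₀ : 𝟙 (out S x) ≡ 0
      no₀ = 𝟙-false (¬true⇒false λ o → inner-not-cut S (face x) h (out-cut S {x} o))
      no₂ : 𝟙 (out S (σ (σ x))) ≡ 0
      no₂ = 𝟙-false (¬true⇒false λ o → inner-not-cut S (face x) h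
        (subst (λ a → cut S a ≡ true) (trans (sym (face-σ (σ (σ x)))) (cong face (σ³ x))) (out-cut-α S {σ (σ x)} o)))
    -- The number of inner pentagons is `b - 4`, and `b` is at least the number of rim vertices,
    -- hence at least `δ S`, which is 5.
    one : 1 ≤ # (λ a → inner S a ∧ pent a)
    one = farkas 0 (# (λ a → inner S a ∧ pent a) ∷ δ S ∷ # (bd S) ∷ # (bv S) ∷ δ (shift S) ∷ [])
      ((1 , con 6 ⊕ x₂ ≼ x₀ ⊕ 2 ⊗ x₁) ∷ (1 , x₃ ≼ x₂) ∷ (1 , x₄ ⊕ x₁ ≼ x₃) ∷ (1 , x₁ ≼ con 5) ∷ []) (con 1 ≼ x₀)
      (≤-reflexive (sym pent-S) , bv≤bd S single , shift-δ S single , ≤-reflexive e , tt)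
    P : Fin nF → Bool
    P a = inner S a ∧ pent a
    a : Fin nF
    a = proj₁ (#-witness P one)
    a-inner : inner S a ≡ true
    a-inner = ∧-left (proj₂ (#-witness P one))
    z = rep a
    pz : Pentagon α z
    pz = pent-Pentagon z (trans (cong pent (face-rep a)) (∧-right {inner S a} (proj₂ (#-witness P one))))
    inner-iter : ∀ i → inner S (face (iter i ϕ z)) ≡ true
    inner-iter i = trans (cong (inner S) (trans (face-iter i z) (face-rep a))) a-inner
    differ : ∀ {i j} → i < j → j < 5 → vert (iter i ϕ z) ≢ vert (iter j ϕ z)
    differ {i} {j} i<j j<5 h = FaceLen-apart {z} {5} {i} {j} pz i<j j<5 (σ-injective
      (Single-eq S single (spoke-at (iter i ϕ z) (inner-iter i)) (spoke-at (iter j ϕ z) (inner-iter j)) h))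
    ne : ∀ i j {_ : So (i <ᵇ j)} {_ : So (j <ᵇ 5)} → vert (iter i ϕ z) ≢ vert (iter j ϕ z)
    ne i j {p} {q} = differ {i} {j} (<ᵇ⇒< i j p) (<ᵇ⇒< j 5 q)
    zs : List (Fin V)
    zs = vert z ∷ vert (iter 1 ϕ z) ∷ vert (iter 2 ϕ z) ∷ vert (iter 3 ϕ z) ∷ vert (iter 4 ϕ z) ∷ []
    zs-unique : Unique zs
    zs-unique = (ne 0 1 ∷ ne 0 2 ∷ ne 0 3 ∷ ne 0 4 ∷ []) ∷ (ne 1 2 ∷ ne 1 3 ∷ ne 1 4 ∷ []) ∷ (ne 2 3 ∷ ne 2 4 ∷ []) ∷ (ne 3 4 ∷ []) ∷ [] ∷ []
    zs-in : All (λ v → S v ≡ true) zs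
    zs-in = at 0 ∷ at 1 ∷ at 2 ∷ at 3 ∷ at 4 ∷ []
      where
      at : ∀ i → S (vert (iter i ϕ z)) ≡ true
      at i = inner-all S (iter i ϕ z) (inner-iter i)
    position : ∀ {v} → v ∈ zs → ∃[ i ] vert (iter (toℕ {5} i) ϕ z) ≡ v
    position (here p) = zero , sym p
    position (there (here p)) = suc zero , sym p
    position (there (there (here p))) = suc (suc zero) , sym p
    position (there (there (there (here p)))) = suc (suc (suc zero)) , sym p
    position (there (there (there (there (here p))))) = suc (suc (suc (suc zero))) , sym p

    covers : ∀ {v} → S v ≡ true → ∃[ i ] vert (iter (toℕ {5} i) ϕ z) ≡ v
    covers h = position (#-list-complete S zs-unique zs-in (≤-reflexive n≡5) h)

    result : Penta S
    result = record { z = z ; pentagon = pz ; spoke = λ i → spoke-at (iter i ϕ z) (inner-iter i)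
                    ; distinct = λ {i} {j} → differ {i} {j} ; covers = covers }

  penta : ∀ S → NonDeg S → δ S ≡ 5 → # S ≡ 5 → Penta S
  penta = PentaProof.result

  dart-at : ∀ (x : Dart V) j → ((vert x , j) ≡ x) ⊎ (((vert x , j) ≡ σ x) ⊎ ((vert x , j) ≡ σ (σ x)))
  dart-at (v , zero)             zero             = inj₁ refl
  dart-at (v , zero)             (suc zero)       = inj₂ (inj₁ refl)
  dart-at (v , zero)             (suc (suc zero)) = inj₂ (inj₂ refl)
  dart-at (v , suc zero)         zero             = inj₂ (inj₂ refl)
  dart-at (v , suc zero)         (suc zero)       = inj₁ refl
  dart-at (v , suc zero)         (suc (suc zero)) = inj₂ (inj₁ refl)
  dart-at (v , suc (suc zero))   zero             = inj₂ (inj₁ refl)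
  dart-at (v , suc (suc zero))   (suc zero)       = inj₂ (inj₂ refl)
  dart-at (v , suc (suc zero))   (suc (suc zero)) = inj₁ refl

  Penta-induces : ∀ {T} → Penta T → (X : Fin V → Set) → (∀ v → X v → T v ≡ true) → (∀ v → T v ≡ true → X v) → Induces5Cycle α X
  Penta-induces {T} P X to from = C , refl , (λ v x → covers (to v x)) , (λ i → from _ (at i)) , induced
    where
    open Penta P
    at : ∀ i → T (vert (iter (toℕ {5} i) ϕ z)) ≡ true
    at i = out-from T {σ (iter (toℕ i) ϕ z)} (spoke (toℕ i))
    per : iter 5 ϕ z ≡ z
    per = proj₁ (proj₂ pentagon)
    C : Cycle (Adj α)
    C = record { m = 2 ; vtx = λ i → vert (iter (toℕ i) ϕ z)
               ; inj = inj
               ; step = λ { zero → _ , refl ; (suc zero) → _ , refl ; (suc (suc zero)) → _ , refl ; (suc (suc (suc zero))) → _ , refl }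
               ; close = proj₂ (iter 4 ϕ z) , cong vert per }
      where
      inj : ∀ (i j : Fin 5) → vert (iter (toℕ i) ϕ z) ≡ vert (iter (toℕ j) ϕ z) → i ≡ j
      inj i j h with <-cmp (toℕ i) (toℕ j)
      ... | tri< p _ _ = ⊥-elim (distinct {toℕ i} {toℕ j} p (toℕ<n j) h)
      ... | tri≈ _ p _ = toℕ-injective p
      ... | tri> _ _ p = ⊥-elim (distinct {toℕ j} {toℕ i} p (toℕ<n i) (sym h))
    edge : ∀ (i : Fin 5) {u v} → vert (iter (toℕ i) ϕ z) ≡ u → vert (iter (suc (toℕ i)) ϕ z) ≡ v → CycEdge C u v
    edge zero p q = inj₁ (zero , inj₁ (p , q))
    edge (suc zero) p q = inj₁ (suc zero , inj₁ (p , q))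
    edge (suc (suc zero)) p q = inj₁ (suc (suc zero) , inj₁ (p , q))
    edge (suc (suc (suc zero))) p q = inj₁ (suc (suc (suc zero)) , inj₁ (p , q))
    edge (suc (suc (suc (suc zero)))) p q = inj₂ (inj₁ (p , trans (sym (cong vert per)) q))
    pred : ∀ (i : Fin 5) → ∃[ j ] iter (suc (toℕ {5} j)) ϕ z ≡ iter (toℕ i) ϕ z
    pred zero = suc (suc (suc (suc zero))) , per
    pred (suc zero) = zero , refl
    pred (suc (suc zero)) = suc zero , refl
    pred (suc (suc (suc zero))) = suc (suc zero) , refl
    pred (suc (suc (suc (suc zero)))) = suc (suc (suc zero)) , refl
    induced : ∀ u v → X u → X v → Adj α u v → CycEdge C u v
    induced u v xu xv (j , adj) with covers (to u xu)
    ... | i , refl with dart-at (iter (toℕ i) ϕ z) j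
    ...   | inj₁ q = edge i refl (trans (sym (cong (vert ∘ α) q)) adj)
    -- The second dart is a spoke and leaves `T`; the third runs back along the pentagon.
    ...   | inj₂ (inj₁ q) = ⊥-elim (true≢false (trans (sym (to v xv)) (trans (cong T (trans (sym adj) (cong (vert ∘ α) q))) (out-to T {σ (iter (toℕ i) ϕ z)} (spoke (toℕ i))))))
    ...   | inj₂ (inj₂ q) with pred i
    ...     | i' , e = CycEdge-sym C (edge i' (trans (cong vert (sym (α-invol _))) (trans (cong (vert ∘ α) (trans (sym (σσϕ _)) (trans (cong (σ ∘ σ) e) (sym q)))) adj)) (cong vert e))

  -- From the given cut to a pentacap

  fin-chain : ∀ {A : Set} n (f : Fin (suc n) → A) → (∀ i → f (inject₁ i) ≡ f (suc i)) → f zero ≡ f (fromℕ n)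
  fin-chain zero    f h = refl
  fin-chain (suc n) f h = trans (h zero) (fin-chain n (f ∘ suc) (λ i → h (suc i)))

  -- Deleting an edge of the cycle leaves the side connected.
  cyclic-side : ∀ {R : Fin V → Fin V → Set} (T : Fin V → Bool) → δ T ≤ 5 → (∀ {u v} → R u v → Adj α u v) →
    (C : Cycle R) → (∀ i → T (Cycle.vtx C i) ≡ true) → δ T ≤ # T
  cyclic-side {R} T δ≤5 adj C inT = farkas 0 (δ T ∷ # T ∷ # Y ∷ # (within T) ∷ [])
      ((1 , 2 ⊗ x₁ ≼ x₂ ⊕ con 2) ∷ (1 , x₂ ⊕ con 2 ≼ x₃) ∷ (1 , x₃ ⊕ x₀ ≼ 3 ⊗ x₁) ∷ []) (x₀ ≼ x₁)
      (connected-edges T Y (delete-sym (within T) e within-sym) (λ d h → ∧-left (∧-left h)) conn (inT zero)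
      , ≤-reflexive (sym (delete-count (within T) e We (within-sym e We)))
      , ≤-reflexive (trans (within+δ T) (*-comm (# T) 3)) , tt)
    where
    open Cycle C
    last : Fin (suc (suc (suc m)))
    last = fromℕ (suc (suc m))
    e : Dart V
    e = vtx last , proj₁ (adj close)
    e-to : vert (α e) ≡ vtx zero
    e-to = proj₂ (adj close)
    Y : Dart V → Bool
    Y = delete (within T) e
    within-sym : ∀ d → within T d ≡ true → within T (α d) ≡ true
    within-sym d h = ∧-both (∧-right {T (vert d)} h) (trans (cong (T ∘ vert) (α-invol d)) (∧-left h))
    We : within T e ≡ true
    We = ∧-both (inT last) (trans (cong T e-to) (inT zero))
    conn : Connected T Y
    conn A h = side-connected T δ≤5 A const
      where
      stepA : ∀ i → A (vtx (inject₁ i)) ≡ A (vtx (suc i))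
      stepA i = trans (h x (delete-intro (within T) (∧-both (inT (inject₁ i)) (trans (cong T x-to) (inT (suc i)))) x≢e x≢αe)) (cong A x-to)
        where
        x : Dart V
        x = vtx (inject₁ i) , proj₁ (adj (step i))
        x-to : vert (α x) ≡ vtx (suc i)
        x-to = proj₂ (adj (step i))
        x≢e : x ≢ e
        x≢e q = fromℕ≢inject₁ (sym (inj _ _ (cong vert q)))
        x≢αe : x ≢ α e
        x≢αe q = contra i (inj _ _ (trans (cong vert q) e-to)) (inj _ _ (trans (sym x-to) (trans (cong (vert ∘ α) q) (cong vert (α-invol e)))))
          where
          -- `x ≡ α e` would make `i` zero and its successor the last index, but a cycle has at
          -- least three vertices.
          contra : ∀ (i : Fin (suc (suc m))) → inject₁ i ≡ zero → suc i ≡ last → ⊥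
          contra zero    _ ()
          contra (suc i) () _
      edge : A (vert e) ≡ A (vert (α e))
      edge = trans (sym (fin-chain _ (A ∘ vtx) stepA)) (cong A (sym e-to))
      const : ∀ x → within T x ≡ true → A (vert x) ≡ A (vert (α x))
      const x w with x ≟E e | x ≟E α e
      ... | yes refl | _ = edge
      ... | no _ | yes refl = trans (sym edge) (cong (A ∘ vert) (sym (α-invol e)))
      ... | no p | no q = h x (delete-intro (within T) w p q)

  -- Every edge between the sides is among the five given ones, as a surviving edge would be a path
  -- that `Cyclic5Cut` forbids. The cycles on the sides make the cut nondegenerate, `small-5` turns
  -- `δ S ≤ 5` into equality, and a side with five vertices would be the excluded 5-cycle.
  cut-start : HasNontrivialCyclic5Cut α → ∃[ S ] (NonDeg S × δ S ≡ 5 × # S ≢ 5 × # (co S) ≢ 5)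
  cut-start (es , S , (_ , _ , apart , ends , cycles) , nontrivial) = S , nd , e , S≢5 , co≢5
    where
    removed? : ∀ d → Removed α es d ⊎ ¬ Removed α es d
    removed? d with search (λ a → (d == es a) ∨ (α d == es a))
    ... | inj₁ (a , p) = inj₁ (a , or p)
      where
      or : ((d == es a) ∨ (α d == es a)) ≡ true → d ≡ es a ⊎ α d ≡ es a
      or p with d ≟E es a
      ... | yes q = inj₁ q
      ... | no ¬q = inj₂ (==-sound {x = α d} {es a} (subst (λ b → (b ∨ (α d == es a)) ≡ true) (==-false ¬q) p))
    ... | inj₂ none = inj₂ not-removed
      where
      not-removed : ¬ Removed α es d
      not-removed (a , inj₁ q) = true≢false (trans (sym (cong (_∨ (α d == es a)) (==-≡ q))) (none a))
      not-removed (a , inj₂ q) = true≢false (trans (sym (trans (cong ((d == es a) ∨_) (==-≡ q)) (∨-zeroʳ _))) (none a))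
    pick : Fin 5 → Dart V
    pick a = if out S (es a) then es a else α (es a)
    picked : ∀ d → out S d ≡ true → ∃[ a ] pick a ≡ d
    picked d o with removed? d
    ... | inj₂ nr = ⊥-elim (apart (vert d) (vert (α d)) (λ q → true≢false (trans (sym (out-from S {d} o)) (trans q (out-to S {d} o))))
                      ((proj₂ d , refl , nr) ◅ ε))
    ... | inj₁ (a , inj₁ refl) = a , cong (λ b → if b then d else α d) o
    ... | inj₁ (a , inj₂ q) = a , trans (cong (λ b → if b then es a else α (es a)) unpicked) (trans (cong α (sym q)) (α-invol d))
      where
      unpicked : out S (es a) ≡ false
      unpicked = trans (cong (out S) (sym q)) (cong (_∧ not (S (vert (α (α d))))) (out-to S {d} o))
    δ≤5 : δ S ≤ 5
    δ≤5 = subst (δ S ≤_) (∑1-Fin 5) (#-image-≤ (out S) pick picked)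
    u = ends true
    w = ends false
    nd : NonDeg S
    nd = nondeg (#-pos S (proj₂ u)) (#-pos (co S) (co-true S (proj₂ w)))
      (cyclic-side S δ≤5 (λ { (i , p , _) → i , p }) (proj₁ (cycles true)) (proj₂ (cycles true)))
      (subst (_≤ # (co S)) (δ-co S) (cyclic-side (co S) (subst (_≤ 5) (sym (δ-co S)) δ≤5) (λ { (i , p , _) → i , p }) (proj₁ (cycles false))
         (λ i → co-true S (proj₂ (cycles false) i))))
    e : δ S ≡ 5
    e = ≤-antisym δ≤5 (small-5 S nd)
    S≢5 : # S ≢ 5
    S≢5 q = nontrivial true (Penta-induces (penta S nd e q) _ (λ v p → p) (λ v p → p))
    co≢5 : # (co S) ≢ 5
    co≢5 q = nontrivial false (Penta-induces (penta (co S) (NonDeg-co S nd) (trans (δ-co S) e) q) _ (λ v p → co-true S p) (λ v p → not-true p))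

  -- The vertices of the central pentagon of a pentacap. The bound `co≥6` replaces `# (co S) ≢ 5`
  -- because it persists when the complement grows.
  record CapSet : Set where
    field
      S      : Fin V → Bool
      degree : NonDeg S
      δ5     : δ S ≡ 5
      size5  : # S ≡ 5
      co≥6   : 6 ≤ # (co S)
      pents5 : ∀ d → S (vert d) ≡ true → pent (face d) ≡ true

  ≢5⇒≥6 : ∀ {n} → 5 ≤ n → n ≢ 5 → 6 ≤ n
  ≢5⇒≥6 p q = ≤∧≢⇒< p (λ e → q (sym e))

  module CapStep (S : Fin V → Bool) (nd : NonDeg S) (e : δ S ≡ 5) (co≥6 : 6 ≤ # (co S)) (bd10 : # (bd S) ≡ 10) (sh : Shifted S) where

    open Package (NonDeg-package S nd (≤-reflexive e))

    bv10 : # (bv S) ≡ 10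
    bv10 = trans (Shifted.bv≡ sh) (cong (2 *_) e)

    smaller : ∀ {fuel} → # S ≤ suc fuel → # (shift S) ≤ fuel
    smaller {fuel} size = farkas 0 (# (shift S) ∷ # (bv S) ∷ # S ∷ fuel ∷ [])
      ((1 , x₀ ⊕ x₁ ≼ x₂) ∷ (1 , con 10 ≼ x₁) ∷ (1 , x₂ ≼ con 1 ⊕ x₃) ∷ []) (x₀ ≼ x₃)
      (≤-reflexive (shift-size S) , ≤-reflexive (sym bv10) , size , tt)

    -- Here `S` has 15 vertices, hence `(15 + 2 - 5) / 2 = 6` inner faces, and a boundary walk of
    -- length 10 requires six inner pentagons.
    all-pent : # (shift S) ≡ 5 → # (inner S) ≤ # (λ a → inner S a ∧ pent a)
    all-pent q = farkas 1 (# (inner S) ∷ # (λ a → inner S a ∧ pent a) ∷ # S ∷ # (bd S) ∷ δ S ∷ # (shift S) ∷ # (bv S) ∷ [])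
      ((1 , 2 ⊗ x₀ ⊕ x₄ ≼ x₂ ⊕ con 2) ∷ (2 , con 6 ⊕ x₃ ≼ x₁ ⊕ 2 ⊗ x₄) ∷ (2 , con 10 ≼ x₃) ∷ (4 , x₄ ≼ con 5) ∷ (1 , con 5 ≼ x₄) ∷
       (1 , x₂ ≼ x₅ ⊕ x₆) ∷ (1 , x₅ ≼ con 5) ∷ (1 , x₆ ≼ con 10) ∷ [])
      (x₀ ≼ x₁)
      (≤-reflexive faces-S , ≤-reflexive (sym pent-S) , ≤-reflexive (sym bd10) , ≤-reflexive e , ≤-reflexive (sym e)
      , ≤-reflexive (sym (shift-size S)) , ≤-reflexive q , ≤-reflexive bv10 , tt)

    inner-shift : ∀ d → shift S (vert d) ≡ true → inner S (face d) ≡ true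
    inner-shift d h with true⊎false (touch (co S) (face d))
    ... | inj₂ r = cong not r
    ... | inj₁ r = ⊥-elim (true≢false (trans (sym h) (shift-cut S {d} (∧-both (touch-intro S d (shift-sub S {vert d} h)) r))))

    pents5 : # (shift S) ≡ 5 → ∀ d → shift S (vert d) ≡ true → pent (face d) ≡ true
    pents5 q d h = ∧-right {inner S (face d)} (𝟙-pos (≤-reflexive (sym (trans
      (∑-tight (inner∧pent≤ S) (all-pent q) (face d)) (𝟙-true (inner-shift d h))))))

    cap : # (shift S) ≡ 5 → CapSet
    cap q = record { S = shift S ; degree = Shifted.degree sh ; δ5 = trans (Shifted.δ≡ sh) e ; size5 = q
                   ; co≥6 = ≤-trans co≥6 (co-shift-size S) ; pents5 = pents5 q }

  cap-descent : ∀ fuel S → # S ≤ fuel → NonDeg S → δ S ≡ 5 → # S ≢ 5 → 6 ≤ # (co S) → CapSet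
  cap-descent zero S size nd e n≢5 co≥6 = ⊥-elim (<-irrefl refl (≤-trans (NonDeg.S≥1 nd) size))
  cap-descent (suc fuel) S size nd e n≢5 co≥6 = conclude (five-step S nd e (≤-reflexive bd10))
    where
    bd10 : # (bd S) ≡ 10
    bd10 = proj₁ (five-tight S nd e n≢5 (λ q → <-irrefl (sym q) co≥6))
    recurse : Shifted S → Dec (# (shift S) ≡ 5) → CapSet
    recurse sh (yes q) = CapStep.cap S nd e co≥6 bd10 sh q
    recurse sh (no ¬q) = cap-descent fuel (shift S) (CapStep.smaller S nd e co≥6 bd10 sh size) (Shifted.degree sh)
      (trans (Shifted.δ≡ sh) e) ¬q (≤-trans co≥6 (co-shift-size S))
    conclude : # S ≡ 5 ⊎ Shifted S → CapSet
    conclude (inj₁ q)  = ⊥-elim (n≢5 q)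
    conclude (inj₂ sh) = recurse sh (# (shift S) ≟ 5)

  cap-set : HasNontrivialCyclic5Cut α → CapSet
  cap-set H = from (cut-start H)
    where
    from : ∃[ S ] (NonDeg S × δ S ≡ 5 × # S ≢ 5 × # (co S) ≢ 5) → CapSet
    from (S , nd , e , n≢5 , co≢5) =
      cap-descent (# S) S ≤-refl nd e n≢5 (≢5⇒≥6 (subst (_≤ # (co S)) e (NonDeg.co≥δ nd)) co≢5)

-- Rings of hexagons

five : List ℕ
five = 0 ∷ 1 ∷ 2 ∷ 3 ∷ 4 ∷ []

-- Cyclic positions are natural numbers and families have period 5: the next position is `suc i`,
-- the previous one `4 + i`, and claims are checked at 0 to 4.
mod5 : ∀ (P : ℕ → Set) → (∀ i → P i → P (5 + i)) → P 0 → P 1 → P 2 → P 3 → P 4 → ∀ i → P i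
mod5 P s p₀ p₁ p₂ p₃ p₄ 0 = p₀
mod5 P s p₀ p₁ p₂ p₃ p₄ 1 = p₁
mod5 P s p₀ p₁ p₂ p₃ p₄ 2 = p₂
mod5 P s p₀ p₁ p₂ p₃ p₄ 3 = p₃
mod5 P s p₀ p₁ p₂ p₃ p₄ 4 = p₄
mod5 P s p₀ p₁ p₂ p₃ p₄ (suc (suc (suc (suc (suc i))))) = s i (mod5 P s p₀ p₁ p₂ p₃ p₄ i)

mod5-values : ∀ {A : Set} (P : A → Set) (f : ℕ → A) → (∀ i → f (5 + i) ≡ f i) →
  P (f 0) → P (f 1) → P (f 2) → P (f 3) → P (f 4) → ∀ i → P (f i)
mod5-values P f per = mod5 (λ i → P (f i)) (λ i → subst P (sym (per i)))

∈-five : ∀ {A : Set} (f : ℕ → A) → (∀ i → f (5 + i) ≡ f i) → ∀ i → f i ∈ map f five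
∈-five f per = mod5-values (_∈ map f five) f per
  (here refl) (there (here refl)) (there (there (here refl))) (there (there (there (here refl)))) (there (there (there (there (here refl)))))

module _ {A : Set} where

  unique-++-disjoint : ∀ {xs ys : List A} → Unique (xs ++ ys) → ∀ {x y} → x ∈ xs → y ∈ ys → x ≢ y
  unique-++-disjoint {xs = _ ∷ xs} (p ∷ _) (here refl) y∈ e = All.lookup p (∈-++⁺ʳ xs y∈) e
  unique-++-disjoint (_ ∷ u) (there x∈) y∈ e = unique-++-disjoint u x∈ y∈ e

  unique-++ʳ : ∀ (xs : List A) {ys} → Unique (xs ++ ys) → Unique ys
  unique-++ʳ []       u       = u
  unique-++ʳ (x ∷ xs) (_ ∷ u) = unique-++ʳ xs u

unique-map⁻ : ∀ {A B : Set} {f : A → B} {xs} → Unique (map f xs) → Unique xs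
unique-map⁻ {xs = []}     []      = []
unique-map⁻ {f = f} {xs = x ∷ xs} (p ∷ u) = All.map (λ q e → q (cong f e)) (All.map⁻ p) ∷ unique-map⁻ u

module Tubes {V : ℕ} (α : Dart V → Dart V) (full : IsFullerene α) where

  open IsFullerene full
  open Caps α full public

  -- If d are the spokes (indexed modulo 5) leaving one ring, then E d are those leaving the next ring.
  E : (ℕ → Dart V) → ℕ → Dart V
  E d i = σ (ϕ (ϕ (d (suc i))))

  -- `d` lists the cut edges in cyclic order. The face between two consecutive spokes has `2 + low`
  -- vertices in `S`; `low` is 0 at the central pentagon of a pentacap and 1 further out.
  record Frame (S : Fin V → Bool) (d : ℕ → Dart V) (low : ℕ) : Set where
    field
      periodic : ∀ i → d (5 + i) ≡ d i
      outd     : ∀ i → out S (d i) ≡ true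
      alld     : ∀ x → out S x ≡ true → ∃[ i ] d i ≡ x
      link     : ∀ i → iter (2 + low) ϕ (α (d i)) ≡ d (suc i)
      below-in : ∀ i m → m ≤ 1 + low → S (vert (iter (suc m) ϕ (α (d i)))) ≡ true

    face-link : ∀ i → face (α (d i)) ≡ face (d (suc i))
    face-link i = trans (sym (face-iter (2 + low) (α (d i)))) (cong face (link i))

    alld-suc : ∀ x → out S x ≡ true → ∃[ i ] d (suc i) ≡ x
    alld-suc x o with alld x o
    ... | zero  , e = 4 , trans (periodic 0) e
    ... | suc i , e = i , e

    in-d : ∀ i → S (vert (d i)) ≡ true
    in-d i = out-from S {d i} (outd i)

    out-αd : ∀ i → S (vert (α (d i))) ≡ false
    out-αd i = out-to S {d i} (outd i)

    co-out : ∀ i → out (co S) (α (d i)) ≡ true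
    co-out i = trans (sym (out-α S (α (d i)))) (trans (cong (out S) (α-invol (d i))) (outd i))

    co-all : ∀ x → out (co S) x ≡ true → ∃[ i ] α (d i) ≡ x
    co-all x o = let (i , e) = alld (α x) (trans (out-α S x) o) in i , trans (cong α e) (α-invol x)

    cut-d : ∀ i → cut S (face (d i)) ≡ true
    cut-d i = out-cut S {d i} (outd i)

  E-periodic : ∀ {d : ℕ → Dart V} → (∀ i → d (5 + i) ≡ d i) → ∀ i → E d (5 + i) ≡ E d i
  E-periodic per i = cong (λ x → σ (ϕ (ϕ x))) (per (suc i))

  -- The face between the spokes d i and d (suc i) has one vertex between their far ends; under Top it has none.
  Up : (ℕ → Dart V) → Set
  Up d = ∀ i → ϕ (ϕ (ϕ (d (suc i)))) ≡ α (d i)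

  Top : (ℕ → Dart V) → Set
  Top d = ∀ i → ϕ (ϕ (d (suc i))) ≡ α (d i)

  σE : ∀ (d : ℕ → Dart V) i → σ (E d i) ≡ α (ϕ (d (suc i)))
  σE d i = σσϕ (ϕ (d (suc i)))

  σσE : ∀ (d : ℕ → Dart V) i → σ (σ (E d i)) ≡ ϕ (ϕ (d (suc i)))
  σσE d i = σ³ (ϕ (ϕ (d (suc i))))

  ϕσE : ∀ (d : ℕ → Dart V) i → ϕ (σ (E d i)) ≡ σ (ϕ (d (suc i)))
  ϕσE d i = trans (cong ϕ (σE d i)) (ϕα (ϕ (d (suc i))))

  up-turn : ∀ {d : ℕ → Dart V} → Up d → ∀ i → σ (ϕ (d (suc i))) ≡ α (ϕ (ϕ (d (suc (suc i)))))
  up-turn {d} up i = trans (cong (σ ∘ σ) (sym (up (suc i)))) (σσϕ (ϕ (ϕ (d (suc (suc i))))))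

  -- Between consecutive new spokes the lower side of a face has one vertex, the outer end of the
  -- old spoke `d (suc i)`.
  E-link : ∀ {d : ℕ → Dart V} → Up d → ∀ i → ϕ (ϕ (σ (E d i))) ≡ E d (suc i)
  E-link {d} up i = trans (cong ϕ (trans (ϕσE d i) (up-turn {d} up i))) (ϕα (ϕ (ϕ (d (suc (suc i))))))

  module Outward {low : ℕ} (S : Fin V → Bool) (d : ℕ → Dart V) (frame : Frame S d low) (nd : NonDeg S) (δ5 : δ S ≡ 5)
                 (up : Up d) (bd10 : # (bd (co S)) ≡ 10) (sh : Shifted (co S)) where

    open Frame frame

    S⁺ : Fin V → Bool
    S⁺ = co (shift (co S))

    e : ℕ → Dart V
    e = E d

    e-per : ∀ i → e (5 + i) ≡ e i
    e-per = E-periodic {d} periodic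

    coδ5 : δ (co S) ≡ 5
    coδ5 = trans (δ-co S) δ5

    single : Single (co S)
    single = five-single (co S) (NonDeg-co S nd) coδ5

    -- The rim of the complement: the outer ends `w` of the spokes and the vertices `u` between
    -- them. `W` covers the rim and has as many entries, which makes them distinct.
    ws us W : List (Fin V)
    ws = map (λ i → vert (α (d i))) five
    us = map (λ i → vert (e i)) five
    W = ws ++ us

    w∈ : ∀ i → vert (α (d i)) ∈ ws
    w∈ = ∈-five (λ i → vert (α (d i))) (λ i → cong (vert ∘ α) (periodic i))

    u∈ : ∀ i → vert (e i) ∈ us
    u∈ = ∈-five (λ i → vert (e i)) (λ i → cong vert (e-per i))

    per-face : ∀ i → iter (3 + (2 + low)) ϕ (d (suc i)) ≡ d (suc i)
    per-face i = trans (cong (λ m → iter m ϕ (d (suc i))) (+-comm 3 (2 + low))) (trans (iter-+ (2 + low) 3 ϕ (d (suc i)))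
      (trans (cong (iter (2 + low) ϕ) (up i)) (link i)))

    -- Positions 1, 2, 3 after `d (suc i)` are `w`, `u`, `w`. Position 0 is the foot of the spoke,
    -- and from 4 on `below-in` keeps the walk in `S`.
    orbit-W : ∀ i m → m < 3 + (2 + low) → S (vert (iter m ϕ (d (suc i)))) ≡ false → vert (iter m ϕ (d (suc i))) ∈ W
    orbit-W i 0 _ h = ⊥-elim (true≢false (trans (sym (in-d (suc i))) h))
    orbit-W i 1 _ h = ∈-++⁺ˡ (w∈ (suc i))
    orbit-W i 2 _ h = ∈-++⁺ʳ ws (u∈ i)
    orbit-W i 3 _ h = ∈-++⁺ˡ (subst (_∈ ws) (cong vert (sym (up i))) (w∈ i))
    orbit-W i (suc (suc (suc (suc m)))) lt h = ⊥-elim (true≢false (trans (sym (below-in i m (≤-trans (n≤1+n m) (≤-pred (≤-pred (≤-pred (≤-pred lt))))))) (trans (cong (S ∘ vert) eq) h)))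
      where
      eq : iter (suc m) ϕ (α (d i)) ≡ iter (4 + m) ϕ (d (suc i))
      eq = trans (cong (iter (suc m) ϕ) (sym (up i))) (trans (sym (iter-+ (suc m) 3 ϕ (d (suc i)))) (cong (λ n → iter (suc n) ϕ (d (suc i))) (+-comm m 3)))

    -- A rim vertex lies on a cut face, every cut face carries a spoke, and walking round the face
    -- from that spoke reaches the vertex.
    W-cover : ∀ v → bv (co S) v ≡ true → v ∈ W
    W-cover v h = from-cut (bv-elim (co S) {v} h)
      where
      Sv : S v ≡ false
      Sv = not-true (∧-left h)
      from-orbit : ∀ (x : Dart V) → vert x ≡ v → ∀ i → SameFace α (d (suc i)) x → v ∈ W
      from-orbit x xv i (m , eq) = subst (_∈ W) (trans (cong vert (sym (proj₂ o))) (trans (cong vert eq) xv))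
          (orbit-W i (toℕ (proj₁ o)) (toℕ<n (proj₁ o)) (trans (cong (S ∘ vert) (trans (sym (proj₂ o)) eq)) (trans (cong S xv) Sv)))
        where
        o : ∃[ j ] iter m ϕ (d (suc i)) ≡ iter (toℕ {3 + (2 + low)} j) ϕ (d (suc i))
        o = orbit ϕ (d (suc i)) (3 + (2 + low)) (per-face i) (s≤s z≤n) m
      from-out : ∀ (x : Dart V) → vert x ≡ v → (∃[ y ] (face y ≡ face x × out S y ≡ true)) → v ∈ W
      from-out x xv (y , fy , oy) = let (i , di) = alld-suc y oy in
        from-orbit x xv i (face-SameFace {d (suc i)} {x} (trans (cong face di) fy))
      from-cut : ∃[ i ] cut (co S) (face (v , i)) ≡ true → v ∈ W
      from-cut (i , c) = from-out (v , i) refl (cut-out S (face (v , i)) (trans (sym (cut-co S (face (v , i)))) c))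

    bv10 : # (bv (co S)) ≡ 10
    bv10 = trans (Shifted.bv≡ sh) (cong (2 *_) coδ5)

    W-unique : Unique W
    W-unique = #-list-unique (bv (co S)) W W-cover (≤-reflexive (sym bv10))

    u≢w : ∀ i j → vert (e i) ≢ vert (α (d j))
    u≢w i j h = unique-++-disjoint W-unique (w∈ j) (u∈ i) (sym h)

    open Package (NonDeg-package (co S) (NonDeg-co S nd) (≤-reflexive coδ5)) using (unique-out)

    -- Otherwise ϕ (d (suc i)) would be a second edge through which its face returns to S.
    u-out : ∀ i → S (vert (e i)) ≡ false
    u-out i with true⊎false (S (vert (e i)))
    ... | inj₂ h = h
    ... | inj₁ h = ⊥-elim (ϕϕ-moves (ϕ (d (suc i))) (trans (up i) (sym same)))
      where
      ϕϕ-moves : ∀ x → ϕ (ϕ x) ≢ x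
      ϕϕ-moves x q with faces x
      ... | inj₁ (_ , _ , prim) = prim 2 (s≤s z≤n) (s≤s (s≤s (s≤s z≤n))) q
      ... | inj₂ (_ , _ , prim) = prim 2 (s≤s z≤n) (s≤s (s≤s (s≤s z≤n))) q
      back : out (co S) (ϕ (d (suc i))) ≡ true
      back = out-intro (co S) {ϕ (d (suc i))} (co-true S (out-αd (suc i))) (co-false S h)
      same : ϕ (d (suc i)) ≡ α (d i)
      same = unique-out {ϕ (d (suc i))} {α (d i)} back (co-out i) (trans (face-ϕ (d (suc i))) (sym (face-link i)))

    cut-co-d : ∀ i m → cut (co S) (face (iter m ϕ (d (suc i)))) ≡ true
    cut-co-d i m = trans (cong (cut (co S)) (face-iter m (d (suc i)))) (trans (cut-co S (face (d (suc i)))) (cut-d (suc i)))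

    in⁺ : ∀ i m → S⁺ (vert (iter m ϕ (d (suc i)))) ≡ true
    in⁺ i m = cong not (shift-cut (co S) {iter m ϕ (d (suc i))} (cut-co-d i m))

    -- By `shift-tight` a rim vertex has exactly one edge leading back to `S` or out of `S⁺`. At a
    -- `u` vertex none leads to `S`, and two of the darts run along a cut face, so the third is the
    -- new spoke.
    e-out : ∀ i → out S⁺ (e i) ≡ true
    e-out i = 𝟙-pos (≤-reflexive (sym (trans (sym three) total)))
      where
      no-old : outs (co S) (vert (e i)) ≡ 0
      no-old = trans (∑-cong (λ j → 𝟙-false (¬true⇒false λ o → let (t , q) = co-all (vert (e i) , j) o in u≢w i t (cong vert (sym q))))) ∑-0
      is-bv : bv (co S) (vert (e i)) ≡ true
      is-bv = bv-intro (co S) {iter 2 ϕ (d (suc i))} (co-true S (u-out i)) (cut-co-d i 2)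
      total : outs S⁺ (vert (e i)) ≡ 1
      total = trans (sym (+-identityʳ _)) (trans (cong (outs S⁺ (vert (e i)) +_) (sym no-old))
        (trans (shift-tight (co S) single (≤-reflexive (trans bv10 (sym (cong₂ _+_ (trans (Shifted.δ≡ sh) coδ5) coδ5)))) (vert (e i))) (𝟙-true is-bv)))
      stays : ∀ x → S⁺ (vert (α x)) ≡ true → 𝟙 (out S⁺ x) ≡ 0
      stays x h = 𝟙-false (¬true⇒false λ o → true≢false (trans (sym h) (out-to S⁺ {x} o)))
      three : outs S⁺ (vert (e i)) ≡ 𝟙 (out S⁺ (e i))
      three = trans (∑-vertex (λ x → 𝟙 (out S⁺ x)) (e i))
        (trans (cong₂ _+_ (cong (𝟙 (out S⁺ (e i)) +_)
             (stays (σ (e i)) (trans (cong (S⁺ ∘ vert) (trans (cong α (σE d i)) (α-invol (ϕ (d (suc i)))))) (in⁺ i 1))))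
             (stays (σ (σ (e i))) (trans (cong (λ x → S⁺ (vert (α x))) (σσE d i)) (in⁺ i 3))))
          (trans (+-identityʳ _) (+-identityʳ _)))

    δ⁺ : δ S⁺ ≡ 5
    δ⁺ = trans (δ-co (shift (co S))) (trans (Shifted.δ≡ sh) coδ5)

    es-unique : Unique (map e five)
    es-unique = unique-map⁻ {f = vert} (unique-++ʳ ws W-unique)

    e-all : ∀ x → out S⁺ x ≡ true → ∃[ i ] e i ≡ x
    e-all x o = let (i , _ , q) = ∈-map⁻ e (#-list-complete (out S⁺) es-unique
                                     (e-out 0 ∷ e-out 1 ∷ e-out 2 ∷ e-out 3 ∷ e-out 4 ∷ []) (≤-reflexive δ⁺) o)
                in i , sym q

    e-link : ∀ i → ϕ (ϕ (ϕ (α (e i)))) ≡ e (suc i)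
    e-link i = trans (cong (ϕ ∘ ϕ) (ϕα (e i))) (E-link {d} up i)

    e-below : ∀ i m → m ≤ 2 → S⁺ (vert (iter (suc m) ϕ (α (e i)))) ≡ true
    e-below i 0 _ = trans (cong (S⁺ ∘ vert) (ϕα (e i))) (in⁺ i 2)
    e-below i 1 _ = trans (cong (S⁺ ∘ vert) (trans (cong ϕ (ϕα (e i))) (ϕσE d i))) (in⁺ i 1)
    e-below i 2 _ = trans (cong (S⁺ ∘ vert) (e-link i)) (in⁺ (suc i) 2)
    e-below i (suc (suc (suc m))) (s≤s (s≤s ()))

    frame⁺ : Frame S⁺ e 1
    frame⁺ = record { periodic = e-per ; outd = e-out ; alld = e-all ; link = e-link ; below-in = e-below }

    nd⁺ : NonDeg S⁺
    nd⁺ = NonDeg-co (shift (co S)) (Shifted.degree sh)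

    size⁺ : # (co S⁺) + 10 ≡ # (co S)
    size⁺ = trans (cong₂ _+_ (#-co-co (shift (co S))) (sym bv10)) (shift-size (co S))

    new-vertex : ∀ v → S v ≡ false → S⁺ v ≡ true → (∃[ i ] v ≡ vert (α (d i))) ⊎ (∃[ i ] v ≡ vert (e i))
    new-vertex v Sv h = conclude (∈-++⁻ ws (W-cover v is-bv))
      where
      is-bv : bv (co S) v ≡ true
      is-bv with true⊎false (bv (co S) v)
      ... | inj₁ p = p
      ... | inj₂ p = ⊥-elim (true≢false (trans (sym (cong₂ (λ a b → a ∧ not b) (co-true S Sv) p)) (not-true h)))
      conclude : v ∈ ws ⊎ v ∈ us → (∃[ i ] v ≡ vert (α (d i))) ⊎ (∃[ i ] v ≡ vert (e i))
      conclude (inj₁ p) = let (i , _ , q) = ∈-map⁻ (λ i → vert (α (d i))) p in inj₁ (i , q)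
      conclude (inj₂ p) = let (i , _ , q) = ∈-map⁻ (λ i → vert (e i)) p in inj₂ (i , q)

  module Inward (S : Fin V → Bool) (d : ℕ → Dart V) {low : ℕ} (frame : Frame S d low) (nd : NonDeg S) (δ5 : δ S ≡ 5) (P : Penta (co S)) where

    open Frame frame

    coδ5 : δ (co S) ≡ 5
    coδ5 = trans (δ-co S) δ5

    open Penta P
    open Package (NonDeg-package (co S) (NonDeg-co S nd) (≤-reflexive coδ5)) using (unique-out)

    single : Single (co S)
    single = five-single (co S) (NonDeg-co S nd) coδ5

    spoke-of : ∀ x → out (co S) x ≡ true → ∃[ j ] σ (iter (toℕ {5} j) ϕ z) ≡ x
    spoke-of x o = let (j , q) = covers (out-from (co S) {x} o) in
      j , Single-eq (co S) single {σ (iter (toℕ j) ϕ z)} {x} (spoke (toℕ j)) o q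

    before : ∀ m → ϕ (iter (m + 4) ϕ z) ≡ iter m ϕ z
    before m = trans (cong (λ n → iter n ϕ z) (sym (+-suc m 4))) (trans (iter-+ m 5 ϕ z) (cong (iter m ϕ) (proj₁ (proj₂ pentagon))))

    -- At the end pentagon, two steps along its face take a spoke to an edge back into `S`. A face
    -- has only one such edge, and `α (d i)` is one.
    top : Top d
    top i = unique-out {ϕ (ϕ (d (suc i)))} {α (d i)} (subst (λ x → out (co S) x ≡ true) (sym two) (spoke (m + 4))) (co-out i)
        (trans (face-iter 2 (d (suc i))) (sym (face-link i)))
      where
      j = spoke-of (α (d (suc i))) (co-out (suc i))
      m = toℕ (proj₁ j)
      two : ϕ (ϕ (d (suc i))) ≡ σ (iter (m + 4) ϕ z)
      two = trans (cong (ϕ ∘ σ) (sym (proj₂ j))) (trans (cong (λ x → ϕ (σ (σ x))) (sym (before m)))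
        (trans (cong ϕ (σσϕ (iter (m + 4) ϕ z))) (ϕα (iter (m + 4) ϕ z))))

    top-vertex : ∀ v → S v ≡ false → ∃[ i ] v ≡ vert (α (d i))
    top-vertex v h = let (j , q) = covers (co-true S h)
                         (i , r) = co-all (σ (iter (toℕ j) ϕ z)) (spoke (toℕ j)) in
      i , trans (sym q) (cong vert (sym r))

  -- The index counts the steps from the spokes `d` to the last ones. For `E d`, with `d` the spokes
  -- at the centre of a pentacap, it is the number of hexagon rings.
  data Tube (d : ℕ → Dart V) : ℕ → Set where
    top  : Top d → Tube d 0
    ring : ∀ {k} → Up d → Tube (E d) k → Tube d (suc k)

  InTube : (ℕ → Dart V) → ℕ → Fin V → Set
  InTube d zero    v = ∃[ i ] v ≡ vert (α (d i))
  InTube d (suc k) v = (∃[ i ] v ≡ vert (α (d i))) ⊎ ((∃[ i ] v ≡ vert (E d i)) ⊎ InTube (E d) k v)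

  TubeFrom : (Fin V → Bool) → (ℕ → Dart V) → Set
  TubeFrom S d = ∃[ k ] (Tube d k × # (co S) ≡ 5 + 10 * k × (∀ v → S v ≡ false → InTube d k v))

  module Ascend (S : Fin V → Bool) (d : ℕ → Dart V) (frame : Frame S d 1) (nd : NonDeg S) (δ5 : δ S ≡ 5) (S≢5 : # S ≢ 5) where

    open Frame frame

    finish : # (co S) ≡ 5 → TubeFrom S d
    finish co5 = 0 , top (Inward.top S d frame nd δ5 P) , co5 , Inward.top-vertex S d frame nd δ5 P
      where
      P : Penta (co S)
      P = penta (co S) (NonDeg-co S nd) (trans (δ-co S) δ5) co5

    module _ (co≢5 : # (co S) ≢ 5) where

      hexagonal : ∀ i → pent (face (d i)) ≡ false
      hexagonal i = ¬true⇒false λ p → 0≢1 (trans (sym (∑≡0 (λ a → 𝟙 (cut S a ∧ pent a)) (proj₂ (five-tight S nd δ5 S≢5 co≢5)) (face (d i))))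
          (𝟙-true (∧-both (cut-d i) p)))
        where
        0≢1 : 0 ≢ 1
        0≢1 ()

      up : Up d
      -- `link` makes three of the six steps round the hexagon.
      up i = trans (cong (λ x → ϕ (ϕ (ϕ x))) (sym (link i)))
        (proj₁ (proj₂ (pent-Hexagon (α (d i)) (trans (cong pent (face-link i)) (hexagonal (suc i))))))

      bd10 : # (bd (co S)) ≡ 10
      bd10 = proj₁ (five-tight (co S) (NonDeg-co S nd) (trans (δ-co S) δ5) co≢5 (λ q → S≢5 (trans (sym (#-co-co S)) q)))

      shifted : Shifted (co S)
      shifted = conclude (five-step (co S) (NonDeg-co S nd) (trans (δ-co S) δ5) (≤-reflexive bd10))
        where
        conclude : # (co S) ≡ 5 ⊎ Shifted (co S) → Shifted (co S)
        conclude (inj₁ q) = ⊥-elim (co≢5 q)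
        conclude (inj₂ q) = q

  grown≢5 : ∀ S S⁺ → NonDeg S → δ S ≡ 5 → # (co S⁺) + 10 ≡ # (co S) → # S⁺ ≢ 5
  grown≢5 S S⁺ nd δ5 size q = absurd (farkas 0 (# S ∷ # (co S) ∷ # S⁺ ∷ # (co S⁺) ∷ V ∷ [])
    ((1 , x₄ ≼ x₂ ⊕ x₃) ∷ (1 , x₀ ⊕ x₁ ≼ x₄) ∷ (1 , x₃ ⊕ con 10 ≼ x₁) ∷ (1 , con 5 ≼ x₀) ∷ (1 , x₂ ≼ con 5) ∷ [])
    (con 1 ≼ con 0)
    (≤-reflexive (sym (#-co S⁺)) , ≤-reflexive (#-co S) , ≤-reflexive size , subst (_≤ # S) δ5 (NonDeg.S≥δ nd) , ≤-reflexive q , tt))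
    where
    absurd : ¬ (1 ≤ 0)
    absurd ()

  tube-from : ∀ fuel S d → # (co S) ≤ fuel → Frame S d 1 → NonDeg S → δ S ≡ 5 → # S ≢ 5 → TubeFrom S d
  tube-from zero S d size frame nd δ5 S≢5 = ⊥-elim (<-irrefl refl (≤-trans (NonDeg.co≥1 nd) size))
  tube-from (suc fuel) S d size frame nd δ5 S≢5 = decide (# (co S) ≟ 5)
    where
    decide : Dec (# (co S) ≡ 5) → TubeFrom S d
    decide (yes co5) = Ascend.finish S d frame nd δ5 S≢5 co5
    decide (no co≢5) = extend (tube-from fuel O.S⁺ O.e smaller O.frame⁺ O.nd⁺ O.δ⁺ (grown≢5 S O.S⁺ nd δ5 O.size⁺))
      where
      module A = Ascend S d frame nd δ5 S≢5
      module O = Outward S d frame nd δ5 (A.up co≢5) (A.bd10 co≢5) (A.shifted co≢5)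
      smaller : # (co O.S⁺) ≤ fuel
      smaller = farkas 0 (# (co O.S⁺) ∷ # (co S) ∷ fuel ∷ []) ((1 , x₀ ⊕ con 10 ≼ x₁) ∷ (1 , x₁ ≼ con 1 ⊕ x₂) ∷ []) (x₀ ≼ x₂)
        (≤-reflexive O.size⁺ , size , tt)
      extend : TubeFrom O.S⁺ O.e → TubeFrom S d
      extend (k , t , sz , cov) = suc k , ring (A.up co≢5) t , size' , cov'
        where
        lem : ∀ k → 5 + 10 * k + 10 ≡ 5 + 10 * suc k
        lem = solve-∀
        size' : # (co S) ≡ 5 + 10 * suc k
        size' = trans (sym O.size⁺) (trans (cong (_+ 10) sz) (lem k))
        cov' : ∀ v → S v ≡ false → InTube d (suc k) v
        cov' v h = split (true⊎false (O.S⁺ v))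
          where
          new : (∃[ i ] v ≡ vert (α (d i))) ⊎ (∃[ i ] v ≡ vert (O.e i)) → InTube d (suc k) v
          new (inj₁ p) = inj₁ p
          new (inj₂ p) = inj₂ (inj₁ p)
          split : O.S⁺ v ≡ true ⊎ O.S⁺ v ≡ false → InTube d (suc k) v
          split (inj₁ p) = new (O.new-vertex v h p)
          split (inj₂ p) = inj₂ (inj₂ (cov v p))

  record Nanotube : Set where
    field
      d        : ℕ → Dart V
      k        : ℕ
      periodic : ∀ i → d (5 + i) ≡ d i
      link     : ∀ i → ϕ (ϕ (α (d i))) ≡ d (suc i)
      up       : Up d
      tube     : Tube (E d) k
      covers   : ∀ v → (∃[ i ] v ≡ vert (d i)) ⊎ InTube d (suc k) v
      size     : V ≡ 20 + 10 * k

  module Build (C : CapSet) (P : Penta (CapSet.S C)) where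

    open CapSet C renaming (S to S₀; degree to nd)
    open Penta P

    ϕ⁵ : ∀ x → face x ≡ face z → iter 5 ϕ x ≡ x
    ϕ⁵ x h = proj₁ (proj₂ (pent-Pentagon x (trans (cong pent h) (pents5 z (out-from S₀ {σ z} (spoke 0))))))

    -- The spokes are numbered against the orientation ϕ of the pentagon, so that link holds.
    y : ℕ → Dart V
    y zero    = z
    y (suc i) = iter 4 ϕ (y i)

    y-iter : ∀ i → y i ≡ iter (4 * i) ϕ z
    y-iter zero    = refl
    y-iter (suc i) = trans (cong (iter 4 ϕ) (y-iter i)) (trans (sym (iter-+ 4 (4 * i) ϕ z)) (cong (λ n → iter n ϕ z) (sym (*-suc 4 i))))

    y-face : ∀ i → face (y i) ≡ face z
    y-face i = trans (cong face (y-iter i)) (face-iter (4 * i) z)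

    y-step : ∀ i → ϕ (y (suc i)) ≡ y i
    y-step i = ϕ⁵ (y i) (y-face i)

    y-per : ∀ i → y (5 + i) ≡ y i
    y-per i = trans (cong (iter 5 ϕ) (trans (cong (iter 5 ϕ) (trans (cong (iter 5 ϕ) (ϕ⁵ (y i) (y-face i))) (ϕ⁵ (y i) (y-face i)))) (ϕ⁵ (y i) (y-face i)))) (ϕ⁵ (y i) (y-face i))

    d : ℕ → Dart V
    d i = σ (y i)

    link : ∀ i → ϕ (ϕ (α (d i))) ≡ d (suc i)
    link i = trans (cong ϕ (ϕα (d i))) (trans (cong (λ x → ϕ (σ (σ x))) (sym (y-step i))) (trans (cong ϕ (σσϕ (y (suc i)))) (ϕα (y (suc i)))))

    outd : ∀ i → out S₀ (d i) ≡ true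
    outd i = subst (λ x → out S₀ (σ x) ≡ true) (sym (y-iter i)) (spoke (4 * i))

    single : Single S₀
    single = five-single S₀ nd δ5

    y₄ : y 4 ≡ iter 1 ϕ z
    y₄ = trans (sym (y-step 4)) (cong ϕ (y-per 0))

    y₃ : y 3 ≡ iter 2 ϕ z
    y₃ = trans (sym (y-step 3)) (cong ϕ y₄)

    y₂ : y 2 ≡ iter 3 ϕ z
    y₂ = trans (sym (y-step 2)) (cong ϕ y₃)

    back : ∀ (j : Fin 5) → ∃[ i ] y i ≡ iter (toℕ j) ϕ z
    back zero = 0 , refl
    back (suc zero) = 4 , y₄
    back (suc (suc zero)) = 3 , y₃
    back (suc (suc (suc zero))) = 2 , y₂
    back (suc (suc (suc (suc zero)))) = 1 , refl

    at-y : ∀ {v} → S₀ v ≡ true → ∃[ i ] vert (d i) ≡ v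
    at-y h = let (j , q) = covers h ; (i , r) = back j in i , trans (cong vert r) q

    alld : ∀ x → out S₀ x ≡ true → ∃[ i ] d i ≡ x
    alld x o = let (i , q) = at-y (out-from S₀ {x} o) in i , Single-eq S₀ single {d i} {x} (outd i) o q

    below-in : ∀ i m → m ≤ 1 → S₀ (vert (iter (suc m) ϕ (α (d i)))) ≡ true
    below-in i 0 _ = trans (cong (S₀ ∘ vert) (ϕα (d i))) (out-from S₀ {d i} (outd i))
    below-in i 1 _ = trans (cong (S₀ ∘ vert) (link i)) (out-from S₀ {d (suc i)} (outd (suc i)))
    below-in i (suc (suc m)) (s≤s ())

    frame : Frame S₀ d 0
    frame = record { periodic = λ i → cong σ (y-per i) ; outd = outd ; alld = alld ; link = link ; below-in = below-in }

    up : Up d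
    -- `link` makes two of the five steps round the pentagon.
    up i = trans (cong (λ x → ϕ (ϕ (ϕ x))) (sym (link i)))
      (proj₁ (proj₂ (pent-Pentagon (α (d i)) (trans (cong pent (Frame.face-link frame i)) (pents5 (d (suc i)) (Frame.in-d frame (suc i)))))))

    open Package (NonDeg-package S₀ nd (≤-reflexive δ5)) using (pent-cut; cut-faces)

    co≢5 : # (co S₀) ≢ 5
    co≢5 q = <-irrefl (sym q) co≥6

    -- All five cut faces are pentagons, so the two walks have total length `20 - 5`, of which the
    -- walk of `S₀` takes at least 5.
    bd10 : # (bd (co S₀)) ≡ 10
    bd10 = ≤-antisym le (five-bd (co S₀) (NonDeg-co S₀ nd) (trans (δ-co S₀) δ5) co≢5)
      where
      p = # (λ a → cut S₀ a ∧ pent a)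
      cut-pent : # (cut S₀) ≤ p
      cut-pent = ∑-mono pt
        where
        pt : ∀ a → 𝟙 (cut S₀ a) ≤ 𝟙 (cut S₀ a ∧ pent a)
        pt a with true⊎false (cut S₀ a)
        ... | inj₂ h = ≤-trans (≤-reflexive (𝟙-false h)) z≤n
        ... | inj₁ h = ≤-reflexive (trans (𝟙-true h) (sym (𝟙-true (∧-both h pa))))
          where
          t = touch-elim S₀ a (∧-left h)
          pa : pent a ≡ true
          pa = trans (cong pent (sym (proj₁ (proj₂ t)))) (pents5 (proj₁ t) (proj₂ (proj₂ t)))
      le : # (bd (co S₀)) ≤ 10
      le = farkas 0 (# (bd (co S₀)) ∷ # (bd S₀) ∷ p ∷ δ S₀ ∷ # (bv S₀) ∷ δ (shift S₀) ∷ # (cut S₀) ∷ [])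
        ((1 , x₁ ⊕ x₀ ⊕ x₂ ≼ 4 ⊗ x₃) ∷ (1 , x₆ ≼ x₂) ∷ (1 , x₃ ≼ x₆) ∷ (1 , x₄ ≼ x₁) ∷ (1 , x₅ ⊕ x₃ ≼ x₄) ∷ (2 , x₃ ≼ con 5) ∷ [])
        (x₀ ≼ con 10)
        (≤-reflexive pent-cut , cut-pent , ≤-reflexive (sym cut-faces) , bv≤bd S₀ single , shift-δ S₀ single , ≤-reflexive δ5 , tt)

    shifted : Shifted (co S₀)
    shifted = conclude (five-step (co S₀) (NonDeg-co S₀ nd) (trans (δ-co S₀) δ5) (≤-reflexive bd10))
      where
      conclude : # (co S₀) ≡ 5 ⊎ Shifted (co S₀) → Shifted (co S₀)
      conclude (inj₁ q) = ⊥-elim (co≢5 q)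
      conclude (inj₂ q) = q

    module O = Outward S₀ d frame nd δ5 up bd10 shifted

    assemble : TubeFrom O.S⁺ O.e → Nanotube
    assemble (k , t , sz , cov) = record
      { d = d ; k = k ; periodic = λ i → cong σ (y-per i) ; link = link ; up = up ; tube = t ; covers = covers' ; size = size' }
      where
      lem : ∀ k → 5 + (5 + 10 * k + 10) ≡ 20 + 10 * k
      lem = solve-∀
      size' : V ≡ 20 + 10 * k
      size' = trans (sym (#-co S₀)) (trans (cong₂ _+_ size5 (trans (sym O.size⁺) (cong (_+ 10) sz))) (lem k))
      covers' : ∀ v → (∃[ i ] v ≡ vert (d i)) ⊎ InTube d (suc k) v
      covers' v = split (true⊎false (S₀ v)) (true⊎false (O.S⁺ v))
        where
        new : (∃[ i ] v ≡ vert (α (d i))) ⊎ (∃[ i ] v ≡ vert (O.e i)) → InTube d (suc k) v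
        new (inj₁ p) = inj₁ p
        new (inj₂ p) = inj₂ (inj₁ p)
        split : S₀ v ≡ true ⊎ S₀ v ≡ false → O.S⁺ v ≡ true ⊎ O.S⁺ v ≡ false → (∃[ i ] v ≡ vert (d i)) ⊎ InTube d (suc k) v
        split (inj₁ h) _        = let (i , q) = at-y h in inj₁ (i , sym q)
        split (inj₂ h) (inj₁ p) = inj₂ (new (O.new-vertex v h p))
        split (inj₂ h) (inj₂ p) = inj₂ (inj₂ (inj₂ (cov v p)))

    nanotube : Nanotube
    nanotube = assemble (tube-from (# (co O.S⁺)) O.S⁺ O.e ≤-refl O.frame⁺ O.nd⁺ O.δ⁺ (grown≢5 S₀ O.S⁺ nd δ5 O.size⁺))

  build : CapSet → Nanotube
  build C = Build.nanotube C (penta S degree δ5 size5)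
    where open CapSet C

-- The face path

pattern at0 p = here p
pattern at1 p = there (here p)
pattern at2 p = there (there (here p))
pattern at3 p = there (there (there (here p)))
pattern at4 p = there (there (there (there (here p))))
pattern past4 p = there (there (there (there p)))

module Arcs {V : ℕ} (α : Dart V → Dart V) (full : IsFullerene α) where

  open IsFullerene full
  open Tubes α full public

  data Walk : Fin V → List (Dart V) → Fin V → Set where
    stop : ∀ {u v} → u ≡ v → Walk u [] v
    step : ∀ {u v x xs} → vert x ≡ u → Walk (vert (α x)) xs v → Walk u (x ∷ xs) v

  walk-++ : ∀ {u v w xs ys} → Walk u xs v → Walk v ys w → Walk u (xs ++ ys) w
  walk-++ (stop refl) q = q
  walk-++ (step p r)  q = step p (walk-++ r q)

  Adjacent : Dart V → Dart V → Set
  Adjacent f g = ∃[ y ] (face f ≡ face y × face g ≡ face (α y))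

  -- Puts `d 4` in the role of `d 1`: a ring with four faces on the path is left through its fourth
  -- face.
  shift3 : (ℕ → Dart V) → ℕ → Dart V
  shift3 d i = d (i + 3)

  Periodic : (ℕ → Dart V) → Set
  Periodic d = ∀ i → d (5 + i) ≡ d i

  unshift : ∀ {A : Set} (f : ℕ → A) → (∀ i → f (5 + i) ≡ f i) → ∀ i → f i ≡ f (i + 2 + 3)
  unshift f per i = trans (sym (per i)) (cong f (lem i))
    where
    lem : ∀ i → 5 + i ≡ i + 2 + 3
    lem = solve-∀

  shift3-periodic : ∀ {d} → Periodic d → Periodic (shift3 d)
  shift3-periodic per i = per (i + 3)

  shift3-Up : ∀ {d} → Up d → Up (shift3 d)
  shift3-Up up i = up (i + 3)

  shift3-Tube : ∀ {d k} → Tube d k → Tube (shift3 d) k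
  shift3-Tube (top t)    = top (λ i → t (i + 3))
  shift3-Tube {d} (ring u t) = ring (shift3-Up {d} u) (shift3-Tube t)

  InTube-shift3 : ∀ d → Periodic d → ∀ k {v} → InTube d k v → InTube (shift3 d) k v
  InTube-shift3 d per zero    (i , p) = i + 2 , trans p (unshift (vert ∘ α ∘ d) (λ i → cong (vert ∘ α) (per i)) i)
  InTube-shift3 d per (suc k) (inj₁ (i , p)) = inj₁ (i + 2 , trans p (unshift (vert ∘ α ∘ d) (λ i → cong (vert ∘ α) (per i)) i))
  InTube-shift3 d per (suc k) (inj₂ (inj₁ (i , p))) = inj₂ (inj₁ (i + 2 , trans p (unshift (vert ∘ E d) (λ i → cong vert (E-periodic {d} per i)) i)))
  InTube-shift3 d per (suc k) (inj₂ (inj₂ p)) = inj₂ (inj₂ (InTube-shift3 (E d) (E-periodic {d} per) k p))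

  InRings : (ℕ → Dart V) → ℕ → Fin nF → Set
  InRings d zero    a = (∃[ i ] a ≡ face (d i)) ⊎ (∃[ i ] a ≡ face (α (ϕ (d i))))
  InRings d (suc k) a = (∃[ i ] a ≡ face (d i)) ⊎ InRings (E d) k a

  InRings-shift3 : ∀ d → Periodic d → ∀ k {a} → InRings d k a → InRings (shift3 d) k a
  InRings-shift3 d per zero (inj₁ (i , p)) = inj₁ (i + 2 , trans p (unshift (face ∘ d) (λ i → cong face (per i)) i))
  InRings-shift3 d per zero (inj₂ (i , p)) = inj₂ (i + 2 , trans p (unshift (λ i → face (α (ϕ (d i)))) (λ i → cong (λ x → face (α (ϕ x))) (per i)) i))
  InRings-shift3 d per (suc k) (inj₁ (i , p)) = inj₁ (i + 2 , trans p (unshift (face ∘ d) (λ i → cong face (per i)) i))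
  InRings-shift3 d per (suc k) (inj₂ p) = inj₂ (InRings-shift3 (E d) (E-periodic {d} per) k p)

  topFrame : (ℕ → Dart V) → ℕ → ℕ → Dart V
  topFrame d zero    = d
  topFrame d (suc k) = topFrame (E d) k

  TopFace : (ℕ → Dart V) → ℕ → Fin nF → Set
  TopFace d k a = (∃[ i ] a ≡ face (topFrame d k i)) ⊎ (∃[ i ] a ≡ face (α (ϕ (topFrame d k i))))

  topFrame-shift3 : ∀ d k i → topFrame (shift3 d) k i ≡ topFrame d k (i + 3)
  topFrame-shift3 d zero    i = refl
  topFrame-shift3 d (suc k) i = topFrame-shift3 (E d) k i

  TopFace-shift3 : ∀ d k {a} → TopFace (shift3 d) k a → TopFace d k a
  TopFace-shift3 d k (inj₁ (i , p)) = inj₁ (i + 3 , trans p (cong face (topFrame-shift3 d k i)))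
  TopFace-shift3 d k (inj₂ (i , p)) = inj₂ (i + 3 , trans p (cong (λ x → face (α (ϕ x))) (topFrame-shift3 d k i)))

  ϕ⁶⇒Hexagon : ∀ x → iter 6 ϕ x ≡ x → Hexagon α x
  ϕ⁶⇒Hexagon x h with faces x
  ... | inj₂ p = p
  ... | inj₁ (_ , five , prim) = ⊥-elim (prim 1 (s≤s z≤n) (s≤s (s≤s z≤n)) (trans (cong ϕ (sym five)) h))

  ϕ⁵⇒Pentagon : ∀ x → iter 5 ϕ x ≡ x → Pentagon α x
  ϕ⁵⇒Pentagon x h with faces x
  ... | inj₁ p = p
  ... | inj₂ (_ , _ , prim) = ⊥-elim (prim 5 (s≤s z≤n) ≤-refl h)

  -- Identifies the faces on both sides of the darts around the ring of `E c`; the face of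
  -- `d (suc i)` lies between the spokes `d i` and `d (suc i)`.
  module Above (c : ℕ → Dart V) (up : Up c) where

    d : ℕ → Dart V
    d = E c

    link : ∀ i → ϕ (ϕ (σ (d i))) ≡ d (suc i)
    link = E-link {c} up

    face-α : ∀ i → face (α (d i)) ≡ face (d (suc i))
    face-α i = trans (sym (face-σ (d i))) (trans (sym (face-iter 2 (σ (d i)))) (cong face (link i)))

    face-σd : ∀ i → face (σ (d i)) ≡ face (d (suc i))
    face-σd i = trans (face-σ (d i)) (face-α i)

    face-ϕσ : ∀ i → face (ϕ (σ (d i))) ≡ face (d (suc i))
    face-ϕσ i = trans (face-ϕ (σ (d i))) (face-σd i)

    below-σ : ∀ i → face (α (σ (d i))) ≡ face (c (suc i))
    below-σ i = trans (cong face (trans (cong α (σE c i)) (α-invol (ϕ (c (suc i)))))) (face-ϕ (c (suc i)))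

    below-ϕσ : ∀ i → face (α (ϕ (σ (d i)))) ≡ face (c (suc (suc i)))
    below-ϕσ i = trans (cong face (trans (cong α (trans (ϕσE c i) (up-turn {c} up i))) (α-invol (ϕ (ϕ (c (suc (suc i)))))))) (face-iter 2 (c (suc (suc i))))

    above-ϕ : ∀ i → face (α (ϕ (c (suc i)))) ≡ face (d (suc i))
    above-ϕ i = trans (cong face (sym (σE c i))) (face-σd i)

    above-ϕϕ : ∀ i → face (α (ϕ (ϕ (c (suc (suc i)))))) ≡ face (d (suc i))
    above-ϕϕ i = trans (cong face (sym (trans (ϕσE c i) (up-turn {c} up i)))) (face-ϕσ i)

    start : vert (ϕ (σ (d 0))) ≡ vert (ϕ (c 1))
    start = cong vert (ϕσE c 0)

    end : vert (α (α (d 0))) ≡ vert (ϕ (ϕ (c 1)))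
    end = cong vert (α-invol (d 0))

    w-vertex : ∀ i → vert (ϕ (σ (d i))) ≡ vert (α (c (suc i)))
    w-vertex i = cong vert (ϕσE c i)

    hexagon : Up d → ∀ i → Hexagon α (d (suc i))
    hexagon upd i = ϕ⁶⇒Hexagon (d (suc i)) (trans (cong (λ x → ϕ (ϕ (ϕ x))) (upd i)) (trans (cong (ϕ ∘ ϕ) (ϕα (d i))) (link i)))

  -- Above the last spokes the darts `α (ϕ (d i))` run round the closing pentagon, in the order of
  -- the spokes.
  module AtTop (d : ℕ → Dart V) (tp : Top d) where

    turn : ∀ i → σ (ϕ (d (suc i))) ≡ α (ϕ (d (suc (suc i))))
    turn i = trans (cong (σ ∘ σ) (sym (tp (suc i)))) (σσϕ (ϕ (d (suc (suc i)))))

    ϕ-turn : ∀ i → ϕ (α (ϕ (d (suc i)))) ≡ α (ϕ (d (suc (suc i))))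
    ϕ-turn i = trans (ϕα (ϕ (d (suc i)))) (turn i)

    centre-step : ∀ i → face (α (ϕ (d (suc (suc i))))) ≡ face (α (ϕ (d (suc i))))
    centre-step i = trans (cong face (sym (ϕ-turn i))) (face-ϕ (α (ϕ (d (suc i)))))

    centre : ∀ i → face (α (ϕ (d (suc i)))) ≡ face (α (ϕ (d 1)))
    centre zero    = refl
    centre (suc i) = trans (centre-step i) (centre i)

    all-centre : Periodic d → ∀ i → face (α (ϕ (d i))) ≡ face (α (ϕ (d 1)))
    all-centre per zero    = trans (cong (λ x → face (α (ϕ x))) (sym (per 0))) (centre 4)
    all-centre per (suc i) = centre i

    turn-vertex : ∀ i → vert (α (ϕ (d (suc (suc i))))) ≡ vert (α (d (suc i)))
    turn-vertex i = cong vert (sym (turn i))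

    turn-next : ∀ i → vert (α (ϕ (d (suc (suc (suc i)))))) ≡ vert (α (α (ϕ (d (suc (suc i))))))
    turn-next i = trans (turn-vertex (suc i)) (cong vert (sym (α-invol (ϕ (d (suc (suc i)))))))

  -- The part of the boundary above the ring of E c, replacing the dart ϕ (c 1); hs and ts are the hexagons and
  -- the top pentagons of the face path, rest the other faces. The boundary may also run along the faces c (suc i)
  -- below with i ∈ is; the faces E c j with j ∈ js are not on the path.
  record Arc (is js : List ℕ) (c : ℕ → Dart V) (k len t : ℕ) : Set where
    field
      arc hs ts rest : List (Dart V)

    chosen : List (Dart V)
    chosen = hs ++ ts

    Good : Dart V → Set
    Good y = face y ∈ map face chosen × (face (α y) ∈ map face rest ⊎ ∃[ i ] (i ∈ is × face (α y) ≡ face (c (suc i))))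

    field
      walk       : Walk (vert (ϕ (c 1))) arc (vert (ϕ (ϕ (c 1))))
      good       : All Good arc
      unchosen   : ∀ {j} → j ∈ js → face (E c j) ∈ map face rest
      chain      : ∀ f → face f ≡ face (c 1) → Linked Adjacent (f ∷ chosen)
      hex        : All (Hexagon α) hs
      tops       : All (λ x → TopFace (E c) k (face x)) ts
      covers-w   : ∀ {i} → i ∈ is → vert (α (c i)) ∈ map vert arc
      covers-u   : ∀ {i} → i ∈ is → vert (E c i) ∈ map vert arc
      covers     : ∀ {v} → InTube (E c) k v → v ∈ map vert arc
      all-faces  : ∀ {a} → InRings (E c) k a → a ∈ map face chosen ⊎ a ∈ map face rest
      arc-length : length arc ≡ len
      face-count : length chosen + length rest ≡ 6 + 5 * k
      top-count  : length ts ≡ t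

  one four just5 : List ℕ
  one   = 1 ∷ []
  four  = 1 ∷ 2 ∷ 3 ∷ 4 ∷ []
  just5 = 5 ∷ []

  two-five : List ℕ
  two-five = 2 ∷ 3 ∷ 4 ∷ 5 ∷ []

  -- Rings carry one and four faces of the path alternately; the next ring is entered three spokes further on.
  tops1 tops4 : ℕ → ℕ
  tops1 zero    = 2
  tops1 (suc k) = tops4 k
  tops4 zero    = 4
  tops4 (suc k) = tops1 k

  -- The arc passes the `5 + 10 * k` vertices of the tube above and two more for each index in `one`
  -- or `four`. The ring faces left out are 2 to 5 when only `E c 1` is on the path, and 5 alone
  -- when 1 to 4 are.
  Arc1 Arc4 : (ℕ → Dart V) → ℕ → Set
  Arc1 c k = Arc one two-five c k (7 + 10 * k) (tops1 k)
  Arc4 c k = Arc four just5 c k (13 + 10 * k) (tops4 k)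

  module _ (c : ℕ → Dart V) (per : Periodic c) (up : Up c) where

    open Above c up

    private
      d-per : Periodic d
      d-per = E-periodic {c} per

      vα-per : ∀ i → vert (α (d (5 + i))) ≡ vert (α (d i))
      vα-per i = cong (vert ∘ α) (d-per i)

      face-per : ∀ i → face (d (5 + i)) ≡ face (d i)
      face-per i = cong face (d-per i)

      d5 : face (d 0) ≡ face (d 5)
      d5 = cong face (sym (d-per 0))

      enter : ∀ f → face f ≡ face (c 1) → Adjacent f (d 1)
      enter f e = ϕ (c 1) , trans e (sym (face-ϕ (c 1))) , sym (above-ϕ 0)

      across : ∀ i → Adjacent (d i) (d (suc i))
      across i = d i , refl , sym (face-α i)

      back : vert (α (d 5)) ≡ vert (α (d 0))
      back = cong (vert ∘ α) (d-per 0)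

    -- The closing pentagon joins the single ring face `d 1` on the path, and the boundary goes
    -- round that pentagon past the other four ring faces.
    arc1-top : Top d → Arc1 c 0
    arc1-top tp = record
      { arc  = ϕ (σ (d 0)) ∷ d 1 ∷ α (ϕ (d 2)) ∷ α (ϕ (d 3)) ∷ α (ϕ (d 4)) ∷ α (ϕ (d 5)) ∷ α (d 0) ∷ []
      ; hs   = []
      ; ts   = d 1 ∷ α (ϕ (d 1)) ∷ []
      ; rest = d 2 ∷ d 3 ∷ d 4 ∷ d 5 ∷ []
      ; walk = step start (step (cong vert (sym (link 0))) (step (turn-vertex 0) (step (turn-next 0) (step (turn-next 1) (step (turn-next 2)
                 (step (sym (trans (cong vert (α-invol (ϕ (d 5)))) back)) (stop end)))))))
      ; good = (at0 (face-ϕσ 0) , inj₂ (1 , at0 refl , below-ϕσ 0))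
             ∷ (at0 refl , inj₁ (at0 (face-α 1)))
             ∷ (at1 (centre 1) , inj₁ (at0 (inward 2)))
             ∷ (at1 (centre 2) , inj₁ (at1 (inward 3)))
             ∷ (at1 (centre 3) , inj₁ (at2 (inward 4)))
             ∷ (at1 (centre 4) , inj₁ (at3 (inward 5)))
             ∷ (at0 (face-α 0) , inj₁ (at3 (trans (cong face (α-invol (d 0))) d5)))
             ∷ []
      ; unchosen = λ { (at0 refl) → at0 refl ; (at1 refl) → at1 refl ; (at2 refl) → at2 refl ; (at3 refl) → at3 refl }
      ; chain = λ f e → enter f e ∷ (ϕ (d 1) , sym (face-ϕ (d 1)) , refl) ∷ [-]
      ; hex = []
      ; tops = inj₁ (1 , refl) ∷ inj₂ (1 , refl) ∷ []
      ; covers-w = λ { (at0 refl) → at0 (sym (w-vertex 0)) }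
      ; covers-u = λ { (at0 refl) → at1 refl }
      ; covers = λ { (i , refl) → cov i }
      ; all-faces = λ { (inj₁ (i , refl)) → rings i ; (inj₂ (i , refl)) → inj₁ (at1 (all-centre d-per i)) }
      ; arc-length = refl ; face-count = refl ; top-count = refl }
      where
      open AtTop d tp
      inward : ∀ i → face (α (α (ϕ (d i)))) ≡ face (d i)
      inward i = trans (cong face (α-invol (ϕ (d i)))) (face-ϕ (d i))
      cov : ∀ i → vert (α (d i)) ∈ map vert (ϕ (σ (d 0)) ∷ d 1 ∷ α (ϕ (d 2)) ∷ α (ϕ (d 3)) ∷ α (ϕ (d 4)) ∷ α (ϕ (d 5)) ∷ α (d 0) ∷ [])
      cov = mod5-values (_∈ map vert (ϕ (σ (d 0)) ∷ d 1 ∷ α (ϕ (d 2)) ∷ α (ϕ (d 3)) ∷ α (ϕ (d 4)) ∷ α (ϕ (d 5)) ∷ α (d 0) ∷ [])) (vert ∘ α ∘ d) vα-per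
        (past4 (at2 refl)) (at2 (sym (turn-vertex 0))) (at3 (sym (turn-vertex 1))) (at4 (sym (turn-vertex 2))) (past4 (at1 (sym (turn-vertex 3))))
      rings : ∀ i → face (d i) ∈ map face (d 1 ∷ α (ϕ (d 1)) ∷ []) ⊎ face (d i) ∈ map face (d 2 ∷ d 3 ∷ d 4 ∷ d 5 ∷ [])
      rings = mod5-values (λ a → a ∈ map face (d 1 ∷ α (ϕ (d 1)) ∷ []) ⊎ a ∈ map face (d 2 ∷ d 3 ∷ d 4 ∷ d 5 ∷ [])) (face ∘ d) face-per
        (inj₂ (at3 d5)) (inj₁ (at0 refl)) (inj₂ (at0 refl)) (inj₂ (at1 refl)) (inj₂ (at2 refl))

    -- The four ring faces end the path: the boundary runs below them as far as `d 4` and returns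
    -- along the closing pentagon, which stays off the path.
    arc4-top : Top d → Arc4 c 0
    arc4-top tp = record
      { arc  = ϕ (σ (d 0)) ∷ σ (d 1) ∷ ϕ (σ (d 1)) ∷ σ (d 2) ∷ ϕ (σ (d 2)) ∷ σ (d 3) ∷ ϕ (σ (d 3)) ∷ d 4 ∷ ϕ (d 4) ∷ ϕ (d 3) ∷ ϕ (d 2) ∷ ϕ (d 1) ∷ α (d 0) ∷ []
      ; hs   = []
      ; ts   = d 1 ∷ d 2 ∷ d 3 ∷ d 4 ∷ []
      ; rest = d 5 ∷ α (ϕ (d 1)) ∷ []
      ; walk = step start (step (cong vert (sym (link 0))) (step refl (step (cong vert (sym (link 1))) (step refl (step (cong vert (sym (link 2))) (step refl
                 (step (cong vert (sym (link 3))) (step refl (step (cong vert (sym (tp 3))) (step (cong vert (sym (tp 2))) (step (cong vert (sym (tp 1)))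
                 (step (cong vert (sym (tp 0))) (stop end)))))))))))))
      ; good = (at0 (face-ϕσ 0) , inj₂ (1 , at0 refl , below-ϕσ 0))
             ∷ (at1 (face-σd 1) , inj₂ (1 , at0 refl , below-σ 1))
             ∷ (at1 (face-ϕσ 1) , inj₂ (2 , at1 refl , below-ϕσ 1))
             ∷ (at2 (face-σd 2) , inj₂ (2 , at1 refl , below-σ 2))
             ∷ (at2 (face-ϕσ 2) , inj₂ (3 , at2 refl , below-ϕσ 2))
             ∷ (at3 (face-σd 3) , inj₂ (3 , at2 refl , below-σ 3))
             ∷ (at3 (face-ϕσ 3) , inj₂ (4 , at3 refl , below-ϕσ 3))
             ∷ (at3 refl , inj₁ (at0 (face-α 4)))
             ∷ (at3 (face-ϕ (d 4)) , inj₁ (at1 (centre 3)))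
             ∷ (at2 (face-ϕ (d 3)) , inj₁ (at1 (centre 2)))
             ∷ (at1 (face-ϕ (d 2)) , inj₁ (at1 (centre 1)))
             ∷ (at0 (face-ϕ (d 1)) , inj₁ (at1 refl))
             ∷ (at0 (face-α 0) , inj₁ (at0 (trans (cong face (α-invol (d 0))) d5)))
             ∷ []
      ; unchosen = λ { (at0 refl) → at0 refl }
      ; chain = λ f e → enter f e ∷ across 1 ∷ across 2 ∷ across 3 ∷ [-]
      ; hex = []
      ; tops = inj₁ (1 , refl) ∷ inj₁ (2 , refl) ∷ inj₁ (3 , refl) ∷ inj₁ (4 , refl) ∷ []
      ; covers-w = λ { (at0 refl) → at0 (sym (w-vertex 0)) ; (at1 refl) → at2 (sym (w-vertex 1))
                     ; (at2 refl) → at4 (sym (w-vertex 2)) ; (at3 refl) → past4 (at2 (sym (w-vertex 3))) }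
      ; covers-u = λ { (at0 refl) → at1 refl ; (at1 refl) → at3 refl ; (at2 refl) → past4 (at1 refl) ; (at3 refl) → past4 (at3 refl) }
      ; covers = λ { (i , refl) → cov i }
      ; all-faces = λ { (inj₁ (i , refl)) → rings i ; (inj₂ (i , refl)) → inj₂ (at1 (all-centre d-per i)) }
      ; arc-length = refl ; face-count = refl ; top-count = refl }
      where
      open AtTop d tp
      cov : ∀ i → vert (α (d i)) ∈ map vert (ϕ (σ (d 0)) ∷ σ (d 1) ∷ ϕ (σ (d 1)) ∷ σ (d 2) ∷ ϕ (σ (d 2)) ∷ σ (d 3) ∷ ϕ (σ (d 3)) ∷ d 4 ∷ ϕ (d 4) ∷ ϕ (d 3) ∷ ϕ (d 2) ∷ ϕ (d 1) ∷ α (d 0) ∷ [])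
      cov = mod5-values (_∈ map vert (ϕ (σ (d 0)) ∷ σ (d 1) ∷ ϕ (σ (d 1)) ∷ σ (d 2) ∷ ϕ (σ (d 2)) ∷ σ (d 3) ∷ ϕ (σ (d 3)) ∷ d 4 ∷ ϕ (d 4) ∷ ϕ (d 3) ∷ ϕ (d 2) ∷ ϕ (d 1) ∷ α (d 0) ∷ [])) (vert ∘ α ∘ d) vα-per
        (past4 (past4 (at4 refl))) (past4 (past4 (at3 refl))) (past4 (past4 (at2 refl))) (past4 (past4 (at1 refl))) (past4 (at4 refl))
      rings : ∀ i → face (d i) ∈ map face (d 1 ∷ d 2 ∷ d 3 ∷ d 4 ∷ []) ⊎ face (d i) ∈ map face (d 5 ∷ α (ϕ (d 1)) ∷ [])
      rings = mod5-values (λ a → a ∈ map face (d 1 ∷ d 2 ∷ d 3 ∷ d 4 ∷ []) ⊎ a ∈ map face (d 5 ∷ α (ϕ (d 1)) ∷ [])) (face ∘ d) face-per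
        (inj₂ (at0 d5)) (inj₁ (at0 refl)) (inj₁ (at1 refl)) (inj₁ (at2 refl)) (inj₁ (at3 refl))

    module _ (upd : Up d) where

      private
        module U = Above d upd

        wrap : face (α (ϕ (ϕ (d 1)))) ≡ face (E d 5)
        wrap = trans (cong (λ x → face (α (ϕ (ϕ x)))) (sym (d-per 1))) (U.above-ϕϕ 4)

      -- The arc above replaces `ϕ (d 1)`, the edge through which the path passes from `d 1` to
      -- `E d 1`. The following edge borders `E d 5`, which is off the path.
      arc1-ring : ∀ {k} → Arc4 d k → Arc1 c (suc k)
      arc1-ring {k} A = record
        { arc  = ϕ (σ (d 0)) ∷ d 1 ∷ (A.arc ++ ϕ (ϕ (d 1)) ∷ α (d 0) ∷ [])
        ; hs   = d 1 ∷ A.hs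
        ; ts   = A.ts
        ; rest = d 2 ∷ d 3 ∷ d 4 ∷ d 5 ∷ A.rest
        ; walk = step start (step (cong vert (sym (link 0))) (walk-++ A.walk (step refl (step (cong vert (sym (upd 0))) (stop end)))))
        ; good = (at0 (face-ϕσ 0) , inj₂ (1 , at0 refl , below-ϕσ 0))
               ∷ (at0 refl , inj₁ (at0 (face-α 1)))
               ∷ All.++⁺ (All.map lift A.good)
                   ((at0 (face-iter 2 (d 1)) , inj₁ (past4 (subst (_∈ map face A.rest) (sym wrap) (A.unchosen (at0 refl)))))
                   ∷ (at0 (face-α 0) , inj₁ (at3 (trans (cong face (α-invol (d 0))) d5)))
                   ∷ [])
        ; unchosen = λ { (at0 refl) → at0 refl ; (at1 refl) → at1 refl ; (at2 refl) → at2 refl ; (at3 refl) → at3 refl }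
        ; chain = λ f e → enter f e ∷ A.chain (d 1) refl
        ; hex = hexagon upd 0 ∷ A.hex
        ; tops = A.tops
        ; covers-w = λ { (at0 refl) → at0 (sym (w-vertex 0)) }
        ; covers-u = λ { (at0 refl) → at1 refl }
        ; covers = cov
        ; all-faces = fcs
        ; arc-length = cong (λ n → suc (suc n)) (trans (length-++ A.arc) (trans (cong (_+ 2) A.arc-length) (arc-len k)))
        ; face-count = trans (cnt (length A.chosen) (length A.rest)) (trans (cong (5 +_) A.face-count) (cnt' k))
        ; top-count = A.top-count }
        where
        module A = Arc A
        arc' : List (Dart V)
        arc' = ϕ (σ (d 0)) ∷ d 1 ∷ (A.arc ++ ϕ (ϕ (d 1)) ∷ α (d 0) ∷ [])
        arc-len : ∀ k → 13 + 10 * k + 2 ≡ 5 + 10 * suc k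
        arc-len = solve-∀
        cnt : ∀ a b → suc a + suc (suc (suc (suc b))) ≡ 5 + (a + b)
        cnt = solve-∀
        cnt' : ∀ k → 5 + (6 + 5 * k) ≡ 6 + 5 * suc k
        cnt' = solve-∀
        lower : ∀ {i a} → i ∈ four → a ≡ face (d (suc i)) → a ∈ map face (d 2 ∷ d 3 ∷ d 4 ∷ d 5 ∷ A.rest)
        lower (at0 refl) e = at0 e
        lower (at1 refl) e = at1 e
        lower (at2 refl) e = at2 e
        lower (at3 refl) e = at3 e
        lift : ∀ {y} → A.Good y → face y ∈ map face (d 1 ∷ A.chosen) ×
          (face (α y) ∈ map face (d 2 ∷ d 3 ∷ d 4 ∷ d 5 ∷ A.rest) ⊎ ∃[ i ] (i ∈ one × face (α y) ≡ face (c (suc i))))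
        lift (p , inj₁ q)           = there p , inj₁ (past4 q)
        lift (p , inj₂ (i , m , e)) = there p , inj₁ (lower m e)
        in-arc : ∀ {v} → v ∈ map vert A.arc → v ∈ map vert arc'
        in-arc {v} p = there (there (subst (v ∈_) (sym (map-++ vert A.arc (ϕ (ϕ (d 1)) ∷ α (d 0) ∷ []))) (∈-++⁺ˡ p)))
        in-end : ∀ {v} → v ∈ map vert (ϕ (ϕ (d 1)) ∷ α (d 0) ∷ []) → v ∈ map vert arc'
        in-end {v} p = there (there (subst (v ∈_) (sym (map-++ vert A.arc (ϕ (ϕ (d 1)) ∷ α (d 0) ∷ []))) (∈-++⁺ʳ (map vert A.arc) p)))
        cov : ∀ {v} → InTube d (suc k) v → v ∈ map vert arc'
        cov (inj₁ (i , refl)) = mod5-values (_∈ map vert arc') (vert ∘ α ∘ d) vα-per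
          (in-end (at1 refl)) (in-arc (A.covers-w (at0 refl))) (in-arc (A.covers-w (at1 refl))) (in-arc (A.covers-w (at2 refl))) (in-arc (A.covers-w (at3 refl))) i
        cov (inj₂ (inj₁ (i , refl))) = mod5-values (_∈ map vert arc') (vert ∘ E d) (λ i → cong vert (E-periodic {d} d-per i))
          (in-end (at0 refl)) (in-arc (A.covers-u (at0 refl))) (in-arc (A.covers-u (at1 refl))) (in-arc (A.covers-u (at2 refl))) (in-arc (A.covers-u (at3 refl))) i
        cov (inj₂ (inj₂ p)) = in-arc (A.covers p)
        fcs : ∀ {a} → InRings d (suc k) a → a ∈ map face (d 1 ∷ A.chosen) ⊎ a ∈ map face (d 2 ∷ d 3 ∷ d 4 ∷ d 5 ∷ A.rest)
        fcs (inj₁ (i , refl)) = mod5-values (λ a → a ∈ map face (d 1 ∷ A.chosen) ⊎ a ∈ map face (d 2 ∷ d 3 ∷ d 4 ∷ d 5 ∷ A.rest)) (face ∘ d) face-per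
          (inj₂ (at3 d5)) (inj₁ (at0 refl)) (inj₂ (at0 refl)) (inj₂ (at1 refl)) (inj₂ (at2 refl)) i
        fcs (inj₂ p) with A.all-faces p
        ... | inj₁ q = inj₁ (there q)
        ... | inj₂ q = inj₂ (past4 q)

      -- The path leaves this ring through `ϕ (d 4)`, which the arc above replaces. The way back
      -- runs along the upper edges of the four faces, whose upper neighbours other than `E d 4` are
      -- off the path.
      arc4-ring : ∀ {k} → Arc1 (shift3 d) k → Arc4 c (suc k)
      arc4-ring {k} A = record
        { arc  = before ++ (A.arc ++ after)
        ; hs   = d 1 ∷ d 2 ∷ d 3 ∷ d 4 ∷ A.hs
        ; ts   = A.ts
        ; rest = d 5 ∷ A.rest
        ; walk = step start (step (cong vert (sym (link 0))) (step refl (step (cong vert (sym (link 1))) (step refl (step (cong vert (sym (link 2))) (step refl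
                   (step (cong vert (sym (link 3))) (walk-++ A.walk
                     (step refl (step (cong vert (sym (upd 3))) (step refl (step (cong vert (sym (upd 2))) (step refl (step (cong vert (sym (upd 1))) (step refl
                     (step (cong vert (sym (upd 0))) (stop end)))))))))))))))))
        ; good = (at0 (face-ϕσ 0) , inj₂ (1 , at0 refl , below-ϕσ 0))
               ∷ (at1 (face-σd 1) , inj₂ (1 , at0 refl , below-σ 1))
               ∷ (at1 (face-ϕσ 1) , inj₂ (2 , at1 refl , below-ϕσ 1))
               ∷ (at2 (face-σd 2) , inj₂ (2 , at1 refl , below-σ 2))
               ∷ (at2 (face-ϕσ 2) , inj₂ (3 , at2 refl , below-ϕσ 2))
               ∷ (at3 (face-σd 3) , inj₂ (3 , at2 refl , below-σ 3))
               ∷ (at3 (face-ϕσ 3) , inj₂ (4 , at3 refl , below-ϕσ 3))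
               ∷ (at3 refl , inj₁ (at0 (face-α 4)))
               ∷ All.++⁺ (All.map lift A.good)
                   ((at3 (face-iter 2 (d 4)) , un (U.above-ϕϕ 2) un3)
                   ∷ (at2 (face-ϕ (d 3)) , un (U.above-ϕ 2) un3)
                   ∷ (at2 (face-iter 2 (d 3)) , un (U.above-ϕϕ 1) un2)
                   ∷ (at1 (face-ϕ (d 2)) , un (U.above-ϕ 1) un2)
                   ∷ (at1 (face-iter 2 (d 2)) , un (U.above-ϕϕ 0) un1)
                   ∷ (at0 (face-ϕ (d 1)) , un (U.above-ϕ 0) un1)
                   ∷ (at0 (face-iter 2 (d 1)) , un wrap (A.unchosen (at0 refl)))
                   ∷ (at0 (face-α 0) , inj₁ (at0 (trans (cong face (α-invol (d 0))) d5)))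
                   ∷ [])
        ; unchosen = λ { (at0 refl) → at0 refl }
        ; chain = λ f e → enter f e ∷ across 1 ∷ across 2 ∷ across 3 ∷ A.chain (d 4) refl
        ; hex = hexagon upd 0 ∷ hexagon upd 1 ∷ hexagon upd 2 ∷ hexagon upd 3 ∷ A.hex
        ; tops = All.map (λ {x} → TopFace-shift3 (E d) k) A.tops
        ; covers-w = λ { (at0 refl) → at0 (sym (w-vertex 0)) ; (at1 refl) → at2 (sym (w-vertex 1))
                       ; (at2 refl) → at4 (sym (w-vertex 2)) ; (at3 refl) → past4 (at2 (sym (w-vertex 3))) }
        ; covers-u = λ { (at0 refl) → at1 refl ; (at1 refl) → at3 refl ; (at2 refl) → past4 (at1 refl) ; (at3 refl) → past4 (at3 refl) }
        ; covers = cov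
        ; all-faces = fcs
        ; arc-length = cong (8 +_) (trans (length-++ A.arc) (trans (cong (_+ 8) A.arc-length) (arc-len k)))
        ; face-count = trans (cnt (length A.chosen) (length A.rest)) (trans (cong (5 +_) A.face-count) (cnt' k))
        ; top-count = A.top-count }
        where
        module A = Arc A
        before after arc' : List (Dart V)
        before = ϕ (σ (d 0)) ∷ σ (d 1) ∷ ϕ (σ (d 1)) ∷ σ (d 2) ∷ ϕ (σ (d 2)) ∷ σ (d 3) ∷ ϕ (σ (d 3)) ∷ d 4 ∷ []
        after = ϕ (ϕ (d 4)) ∷ ϕ (d 3) ∷ ϕ (ϕ (d 3)) ∷ ϕ (d 2) ∷ ϕ (ϕ (d 2)) ∷ ϕ (d 1) ∷ ϕ (ϕ (d 1)) ∷ α (d 0) ∷ []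
        arc' = before ++ (A.arc ++ after)
        rest' : List (Dart V)
        rest' = d 5 ∷ A.rest
        arc-len : ∀ k → 7 + 10 * k + 8 ≡ 5 + 10 * suc k
        arc-len = solve-∀
        cnt : ∀ a b → suc (suc (suc (suc a))) + suc b ≡ 5 + (a + b)
        cnt = solve-∀
        cnt' : ∀ k → 5 + (6 + 5 * k) ≡ 6 + 5 * suc k
        cnt' = solve-∀
        Ed-per : Periodic (E d)
        Ed-per = E-periodic {d} d-per
        -- The shifted indices 3, 4, 5 stand for `E d` at 6, 7, 8, that is at 1, 2, 3 modulo 5.
        un1 : face (E d 1) ∈ map face A.rest
        un1 = subst (_∈ map face A.rest) (cong face (Ed-per 1)) (A.unchosen (at1 refl))
        un2 : face (E d 2) ∈ map face A.rest
        un2 = subst (_∈ map face A.rest) (cong face (Ed-per 2)) (A.unchosen (at2 refl))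
        un3 : face (E d 3) ∈ map face A.rest
        un3 = subst (_∈ map face A.rest) (cong face (Ed-per 3)) (A.unchosen (at3 refl))
        un : ∀ {a b} {B : Set} → a ≡ b → b ∈ map face A.rest → a ∈ map face rest' ⊎ B
        un refl p = inj₁ (there p)
        lift : ∀ {y} → A.Good y → face y ∈ map face (d 1 ∷ d 2 ∷ d 3 ∷ d 4 ∷ A.chosen) ×
          (face (α y) ∈ map face rest' ⊎ ∃[ i ] (i ∈ four × face (α y) ≡ face (c (suc i))))
        lift (p , inj₁ q)                 = past4 p , inj₁ (there q)
        -- The only face of this ring that the upper arc may border from above is `shift3 d 2`,
        -- which is `d 5`.
        lift (p , inj₂ (.1 , at0 refl , e)) = past4 p , inj₁ (at0 e)
        in-arc : ∀ {v} → v ∈ map vert A.arc → v ∈ map vert arc'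
        in-arc {v} p = past4 (past4 (subst (v ∈_) (sym (map-++ vert A.arc after)) (∈-++⁺ˡ p)))
        in-end : ∀ {v} → v ∈ map vert after → v ∈ map vert arc'
        in-end {v} p = past4 (past4 (subst (v ∈_) (sym (map-++ vert A.arc after)) (∈-++⁺ʳ (map vert A.arc) p)))
        cov : ∀ {v} → InTube d (suc k) v → v ∈ map vert arc'
        cov (inj₁ (i , refl)) = mod5-values (_∈ map vert arc') (vert ∘ α ∘ d) vα-per
          (in-end (past4 (at3 refl))) (in-end (past4 (at1 refl))) (in-end (at3 refl)) (in-end (at1 refl)) (in-arc (A.covers-w (at0 refl))) i
        cov (inj₂ (inj₁ (i , refl))) = mod5-values (_∈ map vert arc') (vert ∘ E d) (λ i → cong vert (Ed-per i))
          (in-end (past4 (at2 refl))) (in-end (at4 refl)) (in-end (at2 refl)) (in-end (at0 refl)) (in-arc (A.covers-u (at0 refl))) i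
        cov (inj₂ (inj₂ p)) = in-arc (A.covers (InTube-shift3 (E d) Ed-per k p))
        fcs : ∀ {a} → InRings d (suc k) a → a ∈ map face (d 1 ∷ d 2 ∷ d 3 ∷ d 4 ∷ A.chosen) ⊎ a ∈ map face rest'
        fcs (inj₁ (i , refl)) = mod5-values (λ a → a ∈ map face (d 1 ∷ d 2 ∷ d 3 ∷ d 4 ∷ A.chosen) ⊎ a ∈ map face rest') (face ∘ d) face-per
          (inj₂ (at0 d5)) (inj₁ (at0 refl)) (inj₁ (at1 refl)) (inj₁ (at2 refl)) (inj₁ (at3 refl)) i
        fcs (inj₂ p) with A.all-faces (InRings-shift3 (E d) Ed-per k p)
        ... | inj₁ q = inj₁ (past4 q)
        ... | inj₂ q = inj₂ (there q)

  arc1 : ∀ k c → Periodic c → Up c → Tube (E c) k → Arc1 c k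
  arc4 : ∀ k c → Periodic c → Up c → Tube (E c) k → Arc4 c k
  arc1 zero    c per up (top t)    = arc1-top c per up t
  arc1 (suc k) c per up (ring u t) = arc1-ring c per up u (arc4 k (E c) (E-periodic {c} per) u t)
  arc4 zero    c per up (top t)    = arc4-top c per up t
  arc4 (suc k) c per up (ring u t) = arc4-ring c per up u
    (arc1 k (shift3 (E c)) (shift3-periodic {E c} (E-periodic {c} per)) (shift3-Up {E c} u) (shift3-Tube t))

-- From closed walks and face lists to Hamilton cycles

unique-lookup : ∀ {A B : Set} (f : A → B) xs → Unique (map f xs) → ∀ i j → f (lookup xs i) ≡ f (lookup xs j) → i ≡ j
unique-lookup f (x ∷ xs) (p ∷ u) zero    zero    e = refl
unique-lookup f (x ∷ xs) (p ∷ u) zero    (suc j) e = ⊥-elim (All.lookup p (∈-map⁺ f (∈-lookup j)) e)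
unique-lookup f (x ∷ xs) (p ∷ u) (suc i) zero    e = ⊥-elim (All.lookup p (∈-map⁺ f (∈-lookup i)) (sym e))
unique-lookup f (x ∷ xs) (p ∷ u) (suc i) (suc j) e = cong suc (unique-lookup f xs u i j e)

last-or-inject : ∀ n (i : Fin (suc n)) → (∃[ j ] i ≡ inject₁ j) ⊎ i ≡ fromℕ n
last-or-inject zero    zero    = inj₂ refl
last-or-inject (suc n) zero    = inj₁ (zero , refl)
last-or-inject (suc n) (suc i) with last-or-inject n i
... | inj₁ (j , e) = inj₁ (suc j , cong suc e)
... | inj₂ e       = inj₂ (cong suc e)

-- `Pentagon` and `InCap` are propositions rather than Booleans, so every entry carries a proof or a
-- refutation; the index counts the proofs.
data Tagged {A : Set} (P : A → Set) : List A → ℕ → Set where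
  []   : Tagged P [] 0
  keep : ∀ {x xs n} → P x → Tagged P xs n → Tagged P (x ∷ xs) (suc n)
  skip : ∀ {x xs n} → ¬ P x → Tagged P xs n → Tagged P (x ∷ xs) n

module _ {A : Set} {P : A → Set} where

  tagged-all : ∀ {xs} → All P xs → Tagged P xs (length xs)
  tagged-all []       = []
  tagged-all (p ∷ ps) = keep p (tagged-all ps)

  tagged-none : ∀ {xs} → All (¬_ ∘ P) xs → Tagged P xs 0
  tagged-none []       = []
  tagged-none (p ∷ ps) = skip p (tagged-none ps)

  tagged-++ : ∀ {xs ys m n} → Tagged P xs m → Tagged P ys n → Tagged P (xs ++ ys) (m + n)
  tagged-++ []        q = q
  tagged-++ (keep p t) q = keep p (tagged-++ t q)
  tagged-++ (skip p t)  q = skip p (tagged-++ t q)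

  tagged-exactly : ∀ {xs n} → Tagged P xs n → ExactlyN n (λ i → P (lookup xs i))
  tagged-exactly [] = (λ ()) , (λ ()) , (λ ()) , λ ()
  tagged-exactly (skip ¬p t) with tagged-exactly t
  ... | g , inj , sound , complete = (suc ∘ g) , (λ a b e → inj a b (suc-inj e)) , sound , complete'
    where
    suc-inj : ∀ {n} {i j : Fin n} → Fin.suc i ≡ suc j → i ≡ j
    suc-inj refl = refl
    complete' : ∀ i → _ → ∃[ a ] suc (g a) ≡ i
    complete' zero    p = ⊥-elim (¬p p)
    complete' (suc i) p = let (a , e) = complete i p in a , cong suc e
  tagged-exactly {x ∷ xs} {suc n} (keep p t) with tagged-exactly t
  ... | g , inj , sound , complete = g' , inj' , sound' , complete'
    where
    g' : Fin (suc n) → Fin (suc (length xs))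
    g' zero    = zero
    g' (suc a) = suc (g a)
    suc-inj : ∀ {n} {i j : Fin n} → Fin.suc i ≡ suc j → i ≡ j
    suc-inj refl = refl
    inj' : ∀ a b → g' a ≡ g' b → a ≡ b
    inj' zero    zero    e = refl
    inj' (suc a) (suc b) e = cong suc (inj a b (suc-inj e))
    sound' : ∀ a → P (lookup (x ∷ xs) (g' a))
    sound' zero    = p
    sound' (suc a) = sound a
    complete' : ∀ i → P (lookup (x ∷ xs) i) → ∃[ a ] g' a ≡ i
    complete' zero    p = zero , refl
    complete' (suc i) p = let (a , e) = complete i p in suc a , cong suc e

module Assembly {V : ℕ} (α : Dart V → Dart V) (full : IsFullerene α) where

  open IsFullerene full
  open Arcs α full public

  walk-step : ∀ {u v x} xs → Walk u (x ∷ xs) v → ∀ (i : Fin (length xs)) →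
    vert (α (lookup (x ∷ xs) (inject₁ i))) ≡ vert (lookup (x ∷ xs) (suc i))
  walk-step (y ∷ xs) (step p (step q r)) zero    = sym q
  walk-step (y ∷ xs) (step p (step q r)) (suc i) = walk-step xs (step q r) i

  walk-last : ∀ {u v x} xs → Walk u (x ∷ xs) v → vert (α (lookup (x ∷ xs) (fromℕ (length xs)))) ≡ v
  walk-last []       (step p (stop q)) = q
  walk-last (y ∷ xs) (step p r)        = walk-last xs r

  walk-first : ∀ {u v x xs} → Walk u (x ∷ xs) v → vert x ≡ u
  walk-first (step p _) = p

  record ClosedWalk (xs : List (Dart V)) : Set where
    field
      cycle : Cycle (Adj α)
      edge  : ∀ {x} → x ∈ xs → CycEdge cycle (vert x) (vert (α x))
      edge⁻ : ∀ {u v} → CycEdge cycle u v → ∃[ x ] (x ∈ xs × ((vert x ≡ u × vert (α x) ≡ v) ⊎ (vert x ≡ v × vert (α x) ≡ u)))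
      visit : ∀ {v} → v ∈ map vert xs → ∃[ i ] Cycle.vtx cycle i ≡ v

  closed-walk : ∀ {u} xs → 3 ≤ length xs → Unique (map vert xs) → Walk u xs u → ClosedWalk xs
  closed-walk (_ ∷ []) (s≤s ()) _ _
  closed-walk (_ ∷ _ ∷ []) (s≤s (s≤s ())) _ _
  closed-walk {u} (x ∷ y ∷ z ∷ zs) _ uniq w = record { cycle = C ; edge = edge ; edge⁻ = edge⁻ ; visit = visit }
    where
    xs = x ∷ y ∷ z ∷ zs
    last : vert (α (lookup xs (fromℕ (length (y ∷ z ∷ zs))))) ≡ vert x
    last = trans (walk-last (y ∷ z ∷ zs) w) (sym (walk-first w))
    C : Cycle (Adj α)
    C = record
      { m = length zs ; vtx = λ i → vert (lookup xs i) ; inj = unique-lookup vert xs uniq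
      ; step = λ i → proj₂ (lookup xs (inject₁ i)) , walk-step (y ∷ z ∷ zs) w i
      ; close = proj₂ (lookup xs (fromℕ (length (y ∷ z ∷ zs)))) , last }
    edge-at : ∀ i → CycEdge C (vert (lookup xs i)) (vert (α (lookup xs i)))
    edge-at i with last-or-inject (length (y ∷ z ∷ zs)) i
    ... | inj₁ (j , refl) = inj₁ (j , inj₁ (refl , sym (walk-step (y ∷ z ∷ zs) w j)))
    ... | inj₂ refl       = inj₂ (inj₁ (refl , sym last))
    edge : ∀ {d} → d ∈ xs → CycEdge C (vert d) (vert (α d))
    edge p = subst (λ d → CycEdge C (vert d) (vert (α d))) (sym (lookup-index p)) (edge-at (index p))
    edge⁻ : ∀ {u v} → CycEdge C u v → ∃[ d ] (d ∈ xs × ((vert d ≡ u × vert (α d) ≡ v) ⊎ (vert d ≡ v × vert (α d) ≡ u)))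
    edge⁻ (inj₁ (i , inj₁ (p , q))) = lookup xs (inject₁ i) , ∈-lookup (inject₁ i) , inj₁ (p , trans (walk-step (y ∷ z ∷ zs) w i) q)
    edge⁻ (inj₁ (i , inj₂ (p , q))) = lookup xs (inject₁ i) , ∈-lookup (inject₁ i) , inj₂ (p , trans (walk-step (y ∷ z ∷ zs) w i) q)
    edge⁻ (inj₂ (inj₁ (p , q)))     = lookup xs (fromℕ _) , ∈-lookup {xs = xs} (fromℕ _) , inj₁ (p , trans last q)
    edge⁻ (inj₂ (inj₂ (p , q)))     = lookup xs (fromℕ _) , ∈-lookup {xs = xs} (fromℕ _) , inj₂ (p , trans last q)
    visit : ∀ {v} → v ∈ map vert xs → ∃[ i ] vert (lookup xs i) ≡ v
    visit p = let (d , d∈ , e) = ∈-map⁻ vert p in index d∈ , trans (cong vert (sym (lookup-index d∈))) (sym e)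

  dart-cases : ∀ x y → vert x ≡ vert y → x ≡ y ⊎ (x ≡ σ y ⊎ x ≡ σ (σ y))
  dart-cases x y e with dart-at y (proj₂ x)
  ... | inj₁ p        = inj₁ (trans (cong (_, proj₂ x) e) p)
  ... | inj₂ (inj₁ p) = inj₂ (inj₁ (trans (cong (_, proj₂ x) e) p))
  ... | inj₂ (inj₂ p) = inj₂ (inj₂ (trans (cong (_, proj₂ x) e) p))

  module Disc (c : Dart V) (cs N HL : List (Dart V)) (uniq : Unique (map face ((c ∷ cs) ++ N)))
              (CW : ClosedWalk HL) (visits : ∀ v → v ∈ map vert HL)
              (good : All (λ y → face y ∈ map face (c ∷ cs) × face (α y) ∈ map face N) HL)
              (chain : Linked Adjacent (c ∷ cs)) where

    open ClosedWalk CW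

    fs : Fin (suc (length cs)) → Dart V
    fs = lookup (c ∷ cs)

    in⇒ : ∀ {d} → InFaces α fs d → face d ∈ map face (c ∷ cs)
    in⇒ (i , sf) = subst (_∈ map face (c ∷ cs)) (face-cong sf) (∈-map⁺ face (∈-lookup i))

    in⇐ : ∀ {d} → face d ∈ map face (c ∷ cs) → InFaces α fs d
    in⇐ {d} p = let (y , y∈ , e) = ∈-map⁻ face p in
      index y∈ , face-SameFace (trans (cong face (sym (lookup-index y∈))) (sym e))

    disjoint : ∀ {a} → a ∈ map face (c ∷ cs) → a ∈ map face N → ⊥
    disjoint p q = unique-++-disjoint (subst Unique (map-++ face (c ∷ cs) N) uniq) p q refl

    good-at : ∀ {y} → y ∈ HL → InFaces α fs y × ¬ InFaces α fs (α y)
    good-at y∈ = in⇐ (proj₁ (All.lookup good y∈)) , λ p → disjoint (in⇒ p) (proj₂ (All.lookup good y∈))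

    -- At most one of the three darts at a vertex has its own face inside and the opposite face outside.
    boundary-dart : ∀ d → InFaces α fs d → ¬ InFaces α fs (α d) → CycEdge cycle (vert d) (vert (α d))
    boundary-dart d p ¬q = at (∈-map⁻ vert (visits (vert d)))
      where
      at : ∃[ y ] (y ∈ HL × vert d ≡ vert y) → CycEdge cycle (vert d) (vert (α d))
      at (y , y∈ , e) with dart-cases d y e
      ... | inj₁ refl = edge y∈
      ... | inj₂ (inj₁ refl) = ⊥-elim (disjoint (in⇒ p) (subst (_∈ map face N) (sym (face-σ y)) (proj₂ (All.lookup good y∈))))
      ... | inj₂ (inj₂ refl) = ⊥-elim (¬q (in⇐ (subst (_∈ map face (c ∷ cs)) (trans (cong face (sym (σ³ y))) (face-σ (σ (σ y)))) (proj₁ (All.lookup good y∈)))))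

    -- Without multiple edges the ends of an edge determine its dart, so `CycEdge`, which speaks of
    -- vertices, gives back a dart of `HL`.
    same-dart : ∀ x d → vert x ≡ vert d → vert (α x) ≡ vert (α d) → x ≡ d
    same-dart (v , i) (.v , j) refl e = cong (v ,_) (nomulti v i j e)

    boundary : BoundaryIs α fs cycle
    boundary d = to , from
      where
      to : BoundaryDart α fs d → CycEdge cycle (vert d) (vert (α d))
      to (inj₁ (p , q)) = boundary-dart d p q
      to (inj₂ (p , q)) = CycEdge-sym cycle (subst (λ z → CycEdge cycle (vert (α d)) (vert z)) (α-invol d)
        (boundary-dart (α d) p (λ r → q (subst (InFaces α fs) (α-invol d) r))))
      from : CycEdge cycle (vert d) (vert (α d)) → BoundaryDart α fs d
      from h with edge⁻ h
      ... | x , x∈ , inj₁ (p , q) with same-dart x d p q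
      ...   | refl = inj₁ (good-at x∈)
      from h | x , x∈ , inj₂ (p , q) with same-dart x (α d) p (trans q (cong vert (sym (α-invol d))))
      ...   | refl = inj₂ (proj₁ (good-at x∈) , λ r → proj₂ (good-at x∈) (subst (InFaces α fs) (sym (α-invol d)) r))

    hamilton : IsHamiltonCycle α cycle
    hamilton v = visit (visits v)

    unique-prefix : ∀ (xs ys : List (Dart V)) → Unique (map face (xs ++ ys)) → Unique (map face xs)
    unique-prefix []       ys u       = []
    unique-prefix (x ∷ xs) ys (p ∷ u) = All.++⁻ˡ (map face xs) (subst (All (face x ≢_)) (map-++ face xs ys) p) ∷ unique-prefix xs ys u

    share : ∀ {x} xs → Linked Adjacent (x ∷ xs) → ∀ (i : Fin (length xs)) → ShareEdge α (lookup (x ∷ xs) (inject₁ i)) (lookup (x ∷ xs) (suc i))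
    share (y ∷ xs) ((z , p , q) ∷ l) zero    = z , face-SameFace p , face-SameFace q
    share (y ∷ xs) (_ ∷ l)           (suc i) = share xs l i

    path : IsPathOfFaces α fs
    path = (λ i j s → unique-lookup face (c ∷ cs) (unique-prefix (c ∷ cs) N uniq) i j (face-cong s)) , share cs chain , cycle , boundary

    ham-face-path : ∀ {c₁ c₂ n₁ n₂} →
      Tagged (λ x → Pentagon α x × InCap α c₁ x) (c ∷ cs) n₁ →
      Tagged (λ x → Pentagon α x × InCap α c₂ x) (c ∷ cs) n₂ →
      Tagged (Pentagon α) (c ∷ cs) (n₁ + n₂) → HamFacePath α c₁ c₂ n₁ n₂
    ham-face-path t₁ t₂ t = length cs , fs , cycle , path , hamilton , boundary ,
      tagged-exactly t₁ , tagged-exactly t₂ , tagged-exactly t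

  pent-true : ∀ {x} → Pentagon α x → pent (face x) ≡ true
  pent-true {x} p with len-cases (face x)
  ... | inj₁ (_ , e) = e
  ... | inj₂ (e , _) = ⊥-elim (5≢6 (trans (sym (len-FaceLen p)) e))
    where
    5≢6 : 5 ≢ 6
    5≢6 ()

  pent-false : ∀ {x} → Hexagon α x → pent (face x) ≡ false
  pent-false {x} p with len-cases (face x)
  ... | inj₂ (_ , e) = e
  ... | inj₁ (e , _) = ⊥-elim (6≢5 (trans (sym (len-FaceLen p)) e))
    where
    6≢5 : 6 ≢ 5
    6≢5 ()

  Pentagon-face : ∀ {x} y → Pentagon α x → face y ≡ face x → Pentagon α y
  Pentagon-face y p e = pent-Pentagon y (trans (cong pent e) (pent-true p))

  Hexagon⇒¬Pentagon : ∀ {x} → Hexagon α x → ¬ Pentagon α x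
  Hexagon⇒¬Pentagon h p = true≢false (trans (sym (pent-true p)) (pent-false h))

  euler-V : 2 * nF ≡ V + 4
  euler-V = +-cancelˡ-≡ (2 * V) _ _ (trans euler (lem V))
    where
    lem : ∀ V → 3 * V + 4 ≡ 2 * V + (V + 4)
    lem = solve-∀

  -- `3V + p = 6 nF` and `2 nF = V + 4` force `p = 12`; with `V = 20 + 10k` this leaves `5k`
  -- hexagons.
  hexagons : ∀ k h → V ≡ 20 + 10 * k → NumHexFaces α h → h ≡ 5 * k
  hexagons k h size (g , distinct , hexes , cover) = ≤-antisym
      (farkas 1 ρ ((2 , x₂ ⊕ x₀ ≼ x₃) ∷ (2 , 6 ⊗ x₃ ≼ 3 ⊗ x₄ ⊕ x₂) ∷ (5 , x₄ ⊕ con 4 ≼ 2 ⊗ x₃) ∷ (1 , x₄ ≼ con 20 ⊕ 10 ⊗ x₁) ∷ [])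
        (x₀ ≼ 5 ⊗ x₁) (≤-reflexive total , ≤-reflexive (sym darts) , ≤-reflexive (sym euler-V) , ≤-reflexive size , tt))
      (farkas 1 ρ ((2 , x₃ ≼ x₂ ⊕ x₀) ∷ (2 , 3 ⊗ x₄ ⊕ x₂ ≼ 6 ⊗ x₃) ∷ (5 , 2 ⊗ x₃ ≼ x₄ ⊕ con 4) ∷ (1 , con 20 ⊕ 10 ⊗ x₁ ≼ x₄) ∷ [])
        (5 ⊗ x₁ ≼ x₀) (≤-reflexive (sym total) , ≤-reflexive darts , ≤-reflexive euler-V , ≤-reflexive (sym size) , tt))
    where
    p = # pent
    ρ = h ∷ k ∷ p ∷ nF ∷ V ∷ []
    complete : ∀ a → not (pent a) ≡ true → ∃[ b ] face (g b) ≡ a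
    complete a q = let (b , s) = cover (rep a) (pent-Hexagon (rep a) (trans (cong pent (face-rep a)) (not-true q))) in
      b , trans (face-cong s) (face-rep a)
    hexes# : # (λ a → not (pent a)) ≡ h
    hexes# = trans (#-bijection (λ a → not (pent a)) (λ b → face (g b)) (λ a b e → distinct a b (face-SameFace e))
      (λ b → cong not (pent-false (hexes b))) complete) (∑1-Fin h)
    total : p + h ≡ nF
    total = trans (cong (p +_) (sym hexes#)) (trans (sym (∑-+ _ _)) (trans (∑-cong (λ a → pt (pent a))) (∑1-Fin nF)))
      where
      pt : ∀ b → 𝟙 b + 𝟙 (not b) ≡ 1
      pt true  = refl
      pt false = refl
    darts : 3 * V + p ≡ 6 * nF
    darts = trans (cong (_+ p) (sym (trans (∑-darts-at (λ _ → 1)) (trans (cong (_* 3) (∑1-Fin V)) (*-comm V 3)))))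
      (trans (pents (λ _ → true)) (trans (cong (_* 6) (∑1-Fin nF)) (*-comm nF 6)))

  top-info : ∀ k c → Periodic c → Up c → Tube (E c) k →
    Periodic (topFrame (E c) k) × Top (topFrame (E c) k) × (∀ i → ϕ (ϕ (σ (topFrame (E c) k i))) ≡ topFrame (E c) k (suc i))
  top-info zero    c per up (top t)    = E-periodic {c} per , t , E-link {c} up
  top-info (suc k) c per up (ring u t) = top-info k (E c) (E-periodic {c} per) u t

  ring-head : ∀ c k {a} → ∃[ i ] a ≡ face (c i) → InRings c k a
  ring-head c zero    p = inj₁ p
  ring-head c (suc k) p = inj₁ p

  Ringed : (ℕ → Dart V) → ℕ → Fin nF → Set
  Ringed c k a = (∃[ i ] a ≡ face (c i)) ⊎ InRings (E c) k a

  -- Every dart starts at one of the listed vertices, so naming the faces of the three darts at each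
  -- of them shows that the rings exhaust the faces.
  ring-w : ∀ k c → Periodic c → Up c → (∀ i → face (α (c i)) ≡ face (c (suc i))) → ∀ x i → vert x ≡ vert (α (c i)) → Ringed c k (face x)
  ring-w k c per up' fl x i e with dart-cases x (α (c i)) e
  ... | inj₁ refl = inj₁ (suc i , fl i)
  ... | inj₂ (inj₁ refl) = inj₁ (i , face-ϕ (c i))
  ... | inj₂ (inj₂ refl) = inj₂ (ring-head (E c) k (suc (4 + i) ,
          trans (cong (λ y → face (σ (ϕ y))) (sym (per i))) (trans (cong face (sym (ϕσE c (4 + i)))) (Above.face-ϕσ c up' (4 + i)))))

  ring-u : ∀ k c → Up c → ∀ x i → vert x ≡ vert (E c i) → Ringed c k (face x)
  ring-u k c up' x i e with dart-cases x (E c i) e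
  ... | inj₁ refl = inj₂ (ring-head (E c) k (i , refl))
  ... | inj₂ (inj₁ refl) = inj₂ (ring-head (E c) k (suc i , Above.face-σd c up' i))
  ... | inj₂ (inj₂ refl) = inj₁ (suc i , trans (cong face (σσE c i)) (face-iter 2 (c (suc i))))

  ring-top : ∀ c → Periodic c → Top c → (∀ i → face (α (c i)) ≡ face (c (suc i))) → ∀ x i → vert x ≡ vert (α (c i)) → InRings c 0 (face x)
  ring-top c per tp fl x i e with dart-cases x (α (c i)) e
  ... | inj₁ refl = inj₁ (suc i , fl i)
  ... | inj₂ (inj₁ refl) = inj₁ (i , face-ϕ (c i))
  ... | inj₂ (inj₂ refl) = inj₂ (suc (suc (4 + i)) , trans (cong (λ y → face (σ (ϕ y))) (sym (per i))) (cong face (AtTop.turn c tp (4 + i))))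

  ringed : ∀ k c → Periodic c → Up c → (∀ i → face (α (c i)) ≡ face (c (suc i))) → Tube (E c) k →
    ∀ x → InTube c (suc k) (vert x) → Ringed c k (face x)
  ringed k c per up' fl t x (inj₁ (i , e)) = ring-w k c per up' fl x i e
  ringed k c per up' fl t x (inj₂ (inj₁ (i , e))) = ring-u k c up' x i e
  ringed zero c per up' fl (top t) x (inj₂ (inj₂ (i , e))) =
    inj₂ (ring-top (E c) (E-periodic {c} per) t (Above.face-α c up') x i e)
  ringed (suc k) c per up' fl (ring u t) x (inj₂ (inj₂ p)) =
    inj₂ (ringed k (E c) (E-periodic {c} per) u (Above.face-α c up') t x p)

  midRings : (ℕ → Dart V) → ℕ → List (Dart V)
  midRings c zero    = []
  midRings c (suc k) = map c five ++ midRings (E c) k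

  midRings-length : ∀ c k → length (midRings c k) ≡ 5 * k
  midRings-length c zero    = refl
  midRings-length c (suc k) = trans (cong (5 +_) (midRings-length (E c) k)) (sym (*-suc 5 k))

  ∈-ring : ∀ c → Periodic c → ∀ i → face (c i) ∈ map face (map c five)
  ∈-ring c per i = ∈-map⁺ face (∈-five c per i)

  odd⇒2 : ∀ k → (5 * k) % 2 ≡ 1 → tops4 k ≡ 2
  odd⇒2 zero ()
  odd⇒2 (suc zero) _ = refl
  -- `tops4` has period 2, and `5 * (k + 2)` differs from `5 * k` by an even number.
  odd⇒2 (suc (suc k)) h = odd⇒2 k (trans (sym (trans (cong (_% 2) (lem k)) ([m+kn]%n≡m%n (5 * k) 5 2))) h)
    where
    lem : ∀ k → 5 * suc (suc k) ≡ 5 * k + 5 * 2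
    lem = solve-∀

  even⇒4 : ∀ k → (5 * k) % 2 ≡ 0 → tops4 k ≡ 4
  even⇒4 zero _ = refl
  even⇒4 (suc zero) ()
  even⇒4 (suc (suc k)) h = even⇒4 k (trans (sym (trans (cong (_% 2) (lem k)) ([m+kn]%n≡m%n (5 * k) 5 2))) h)
    where
    lem : ∀ k → 5 * suc (suc k) ≡ 5 * k + 5 * 2
    lem = solve-∀

  module Final (N : Nanotube) (A : Arc4 (Nanotube.d N) (Nanotube.k N)) where

    open Nanotube N
    module A = Arc A
    module U = Above d up

    blink : ∀ i → ϕ (σ (d i)) ≡ d (suc i)
    blink i = trans (cong ϕ (sym (ϕα (d i)))) (link i)

    face-αd : ∀ i → face (α (d i)) ≡ face (d (suc i))
    face-αd i = trans (sym (face-iter 2 (α (d i)))) (cong face (link i))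

    face-σd : ∀ i → face (σ (d i)) ≡ face (d (suc i))
    face-σd i = trans (face-σ (d i)) (face-αd i)

    σσd : ∀ i → σ (σ (d (suc i))) ≡ α (σ (d i))
    σσd i = trans (cong (σ ∘ σ) (sym (blink i))) (σσϕ (σ (d i)))

    inner-step : ∀ i → ϕ (α (σ (d (suc i)))) ≡ α (σ (d i))
    inner-step i = trans (ϕα (σ (d (suc i)))) (σσd i)

    d5 : d 5 ≡ d 0
    d5 = periodic 0

    -- `σ (d 0)` joins two neighbouring vertices of the first central pentagon with a ring face on
    -- its own side; its reverse lies on that pentagon.
    c₁ : Dart V
    c₁ = α (σ (d 0))

    face-centre : ∀ i → face (α (σ (d i))) ≡ face c₁
    face-centre zero    = refl
    face-centre (suc i) = trans (sym (face-ϕ (α (σ (d (suc i)))))) (trans (cong face (inner-step i)) (face-centre i))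

    pentagon-d : ∀ i → Pentagon α (d (suc i))
    pentagon-d i = ϕ⁵⇒Pentagon (d (suc i)) (trans (cong (ϕ ∘ ϕ) (up i)) (link i))

    pentagon-c₁ : Pentagon α c₁
    pentagon-c₁ = ϕ⁵⇒Pentagon c₁ (trans (cong (λ x → iter 5 ϕ (α (σ x))) (sym d5))
      (trans (cong (iter 4 ϕ) (inner-step 4)) (trans (cong (iter 3 ϕ) (inner-step 3)) (trans (cong (iter 2 ϕ) (inner-step 2))
        (trans (cong ϕ (inner-step 1)) (inner-step 0))))))

    orbit-c₁ : ∀ m → ∃[ i ] iter m ϕ c₁ ≡ α (σ (d i))
    orbit-c₁ zero = 0 , refl
    orbit-c₁ (suc m) with orbit-c₁ m
    ... | suc i , e = i , trans (cong ϕ e) (inner-step i)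
    ... | zero  , e = 4 , trans (cong ϕ (trans e (cong (α ∘ σ) (sym d5)))) (inner-step 4)

    around-c₁ : ∀ m → ∃[ i ] face (α (iter m ϕ c₁)) ≡ face (d (suc i))
    around-c₁ m = let (i , e) = orbit-c₁ m in i , trans (cong face (trans (cong α e) (α-invol (σ (d i))))) (face-σd i)

    pentacap₁ : IsPentacap α c₁
    pentacap₁ = pentagon-c₁ , λ j → let (i , e) = around-c₁ (toℕ j) in Pentagon-face (α (iter (toℕ j) ϕ c₁)) (pentagon-d i) e

    cap₁-centre : InCap α c₁ c₁
    cap₁-centre = inj₁ (0 , refl)

    cap₁-d1 : InCap α c₁ (d 1)
    cap₁-d1 = inj₂ (zero , 1 , trans (cong ϕ (α-invol (σ (d 0)))) (blink 0))

    T : ℕ → Dart V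
    T = topFrame (E d) k

    T-per : Periodic T
    T-per = proj₁ (top-info k d periodic up tube)

    T-top : Top T
    T-top = proj₁ (proj₂ (top-info k d periodic up tube))

    T-link : ∀ i → ϕ (ϕ (σ (T i))) ≡ T (suc i)
    T-link = proj₂ (proj₂ (top-info k d periodic up tube))

    module TT = AtTop T T-top

    c₂ : Dart V
    c₂ = α (ϕ (T 1))

    pentagon-T : ∀ i → Pentagon α (T (suc i))
    pentagon-T i = ϕ⁵⇒Pentagon (T (suc i)) (trans (cong (iter 3 ϕ) (T-top i)) (trans (cong (ϕ ∘ ϕ) (ϕα (T i))) (T-link i)))

    orbit-c₂ : ∀ m → iter m ϕ c₂ ≡ α (ϕ (T (suc m)))
    orbit-c₂ zero    = refl
    orbit-c₂ (suc m) = trans (cong ϕ (orbit-c₂ m)) (TT.ϕ-turn m)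

    pentagon-c₂ : Pentagon α c₂
    pentagon-c₂ = ϕ⁵⇒Pentagon c₂ (trans (orbit-c₂ 5) (cong (α ∘ ϕ) (T-per 1)))

    around-c₂ : ∀ m → face (α (iter m ϕ c₂)) ≡ face (T (suc m))
    around-c₂ m = trans (cong face (trans (cong α (orbit-c₂ m)) (α-invol (ϕ (T (suc m)))))) (face-ϕ (T (suc m)))

    pentacap₂ : IsPentacap α c₂
    pentacap₂ = pentagon-c₂ , λ j → Pentagon-face (α (iter (toℕ j) ϕ c₂)) (pentagon-T (toℕ j)) (around-c₂ (toℕ j))

    CapFace₂ : Fin nF → Set
    CapFace₂ a = ∀ x → face x ≡ a → Pentagon α x × InCap α c₂ x

    cap₂-at : ∀ (j : Fin 5) → CapFace₂ (face (T (suc (toℕ j))))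
    cap₂-at j x e = Pentagon-face x (pentagon-T (toℕ j)) e , inj₂ (j , face-SameFace (trans (around-c₂ (toℕ j)) (sym e)))

    cap₂-T : ∀ i → CapFace₂ (face (T i))
    cap₂-T = mod5-values CapFace₂ (face ∘ T) (λ i → cong face (T-per i))
      (subst CapFace₂ (cong face (T-per 0)) (cap₂-at (suc (suc (suc (suc zero))))))
      (cap₂-at zero) (cap₂-at (suc zero)) (cap₂-at (suc (suc zero))) (cap₂-at (suc (suc (suc zero))))

    centre₂ : ∀ i → face (α (ϕ (T i))) ≡ face c₂
    centre₂ = TT.all-centre T-per

    cap₂-top : ∀ {x} → TopFace (E d) k (face x) → Pentagon α x × InCap α c₂ x
    cap₂-top {x} (inj₁ (i , e)) = cap₂-T i x e
    cap₂-top {x} (inj₂ (i , e)) = Pentagon-face x pentagon-c₂ (trans e (centre₂ i)) , inj₁ (face-SameFace (sym (trans e (centre₂ i))))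

    face-names : ∀ x → face x ≡ face c₁ ⊎ Ringed d k (face x)
    face-names x = by (covers (vert x))
      where
      at-d : ∀ i → vert x ≡ vert (d i) → face x ≡ face c₁ ⊎ Ringed d k (face x)
      at-d i e with dart-cases x (d i) e
      ... | inj₁ refl = inj₂ (inj₁ (i , refl))
      ... | inj₂ (inj₁ refl) = inj₂ (inj₁ (suc i , face-σd i))
      ... | inj₂ (inj₂ refl) = inj₁ (trans (cong (λ y → face (σ (σ y))) (sym (periodic i))) (trans (cong face (σσd (4 + i))) (face-centre (4 + i))))
      by : (∃[ i ] vert x ≡ vert (d i)) ⊎ InTube d (suc k) (vert x) → face x ≡ face c₁ ⊎ Ringed d k (face x)
      by (inj₁ (i , e)) = at-d i e
      by (inj₂ p)       = inj₂ (ringed k d periodic up face-αd tube x p)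

    nF-size : nF ≡ 12 + 5 * k
    nF-size = ≤-antisym
      (farkas 1 (nF ∷ V ∷ k ∷ []) ((1 , 2 ⊗ x₀ ≼ x₁ ⊕ con 4) ∷ (1 , x₁ ≼ con 20 ⊕ 10 ⊗ x₂) ∷ []) (x₀ ≼ con 12 ⊕ 5 ⊗ x₂)
        (≤-reflexive euler-V , ≤-reflexive size , tt))
      (farkas 1 (nF ∷ V ∷ k ∷ []) ((1 , x₁ ⊕ con 4 ≼ 2 ⊗ x₀) ∷ (1 , con 20 ⊕ 10 ⊗ x₂ ≼ x₁) ∷ []) (con 12 ⊕ 5 ⊗ x₂ ≼ x₀)
        (≤-reflexive (sym euler-V) , ≤-reflexive (sym size) , tt))

    -- Used for two lists: the one ordered by caps and rings, whose distinct entries make the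
    -- pentacaps disjoint, and the one of path and rest, which makes the faces of the path distinct.
    faces-unique : ∀ xs → length xs ≡ 12 + 5 * k → (∀ x → face x ∈ map face xs) → Unique (map face xs)
    faces-unique xs l cov = #-list-unique (λ _ → true) (map face xs)
      (λ a _ → subst (_∈ map face xs) (face-rep a) (cov (rep a)))
      (≤-reflexive (trans (length-map face xs) (trans l (trans (sym nF-size) (sym (∑1-Fin nF))))))

    cap-faces₁ cap-faces₂ : List (Dart V)
    cap-faces₁ = c₁ ∷ map d five
    cap-faces₂ = c₂ ∷ map T five

    in-mid : ∀ k c → Periodic c → (∀ i → face (α (ϕ (topFrame c k i))) ≡ face c₂) → (∀ {a} → (∃[ i ] a ≡ face (topFrame c k i)) → a ∈ map face cap-faces₂) →
      ∀ {a} → InRings c k a → a ∈ map face (midRings c k ++ cap-faces₂)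
    in-mid zero    c per cen tp (inj₁ p)          = tp p
    in-mid zero    c per cen tp (inj₂ (i , refl)) = here (cen i)
    in-mid (suc k) c per cen tp (inj₁ (i , refl)) = subst (face (c i) ∈_) (sym (map-++ face (map c five) (midRings (E c) k ++ cap-faces₂))) (∈-++⁺ˡ (∈-ring c per i))
    in-mid (suc k) c per cen tp {a} (inj₂ p) = subst (a ∈_) (sym (map-++ face (map c five) (midRings (E c) k ++ cap-faces₂)))
      (∈-++⁺ʳ (map face (map c five)) (in-mid k (E c) (E-periodic {c} per) cen tp p))

    all-faces : List (Dart V)
    all-faces = cap-faces₁ ++ (midRings (E d) k ++ cap-faces₂)

    all-faces-cover : ∀ x → face x ∈ map face all-faces
    all-faces-cover x = subst (face x ∈_) (sym (map-++ face cap-faces₁ (midRings (E d) k ++ cap-faces₂))) (by (face-names x))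
      where
      by : face x ≡ face c₁ ⊎ Ringed d k (face x) → face x ∈ map face cap-faces₁ ++ map face (midRings (E d) k ++ cap-faces₂)
      by (inj₁ e)              = here e
      by (inj₂ (inj₁ (i , e))) = there (∈-++⁺ˡ (subst (_∈ map face (map d five)) (sym e) (∈-ring d periodic i)))
      by (inj₂ (inj₂ p))       = ∈-++⁺ʳ (map face cap-faces₁) (in-mid k (E d) (E-periodic {d} periodic) centre₂
        (λ q → there (subst (_∈ map face (map T five)) (sym (proj₂ q)) (∈-ring T T-per (proj₁ q)))) p)

    all-faces-unique : Unique (map face all-faces)
    all-faces-unique = faces-unique all-faces
      (cong (6 +_) (trans (length-++ (midRings (E d) k)) (trans (cong (_+ 6) (midRings-length (E d) k)) (+-comm (5 * k) 6)))) all-faces-cover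

    in-cap₁ : ∀ {f} → InCap α c₁ f → face f ∈ map face cap-faces₁
    in-cap₁ (inj₁ s)       = here (sym (face-cong s))
    in-cap₁ {f} (inj₂ (j , s)) = let (i , e) = around-c₁ (toℕ j) in
      there (subst (_∈ map face (map d five)) (trans (sym e) (face-cong s)) (∈-ring d periodic (suc i)))

    in-cap₂ : ∀ {f} → InCap α c₂ f → face f ∈ map face cap-faces₂
    in-cap₂ (inj₁ s)       = here (sym (face-cong s))
    in-cap₂ {f} (inj₂ (j , s)) =
      there (subst (_∈ map face (map T five)) (trans (sym (around-c₂ (toℕ j))) (face-cong s)) (∈-ring T T-per (suc (toℕ j))))

    disjoint-caps : DisjointCaps α c₁ c₂
    disjoint-caps f p q = unique-++-disjoint (subst Unique (map-++ face cap-faces₁ (midRings (E d) k ++ cap-faces₂)) all-faces-unique) (in-cap₁ p)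
      (subst (face f ∈_) (sym (map-++ face (midRings (E d) k) cap-faces₂)) (∈-++⁺ʳ (map face (midRings (E d) k)) (in-cap₂ q))) refl

    -- `HL` goes out along `d 1`, takes the arc above in place of `ϕ (d 1)`, comes back along `d 0`
    -- and goes round the central pentagon by its four edges not shared with the face of `d 1`.
    Cs Ns HL tail : List (Dart V)
    Cs = d 1 ∷ A.chosen
    Ns = d 2 ∷ d 3 ∷ d 4 ∷ d 5 ∷ A.rest
    tail = ϕ (ϕ (d 1)) ∷ α (d 0) ∷ α (σ (d 4)) ∷ α (σ (d 3)) ∷ α (σ (d 2)) ∷ α (σ (d 1)) ∷ []
    HL = d 1 ∷ (A.arc ++ tail)

    chosen-cover : ∀ x → face x ∈ map face ((c₁ ∷ Cs) ++ Ns)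
    chosen-cover x = subst (face x ∈_) (sym (map-++ face (c₁ ∷ Cs) Ns)) (by (face-names x))
      where
      Either : Fin nF → Set
      Either a = a ∈ map face (c₁ ∷ Cs) ++ map face Ns
      rest∈ : ∀ {a} → a ∈ map face Ns → Either a
      rest∈ = ∈-++⁺ʳ (map face (c₁ ∷ Cs))
      bottom : ∀ i → Either (face (d i))
      bottom = mod5-values Either (face ∘ d) (λ i → cong face (periodic i))
        (rest∈ (at3 (cong face (sym d5)))) (there (here refl)) (rest∈ (at0 refl)) (rest∈ (at1 refl)) (rest∈ (at2 refl))
      upper : ∀ {a} → a ∈ map face A.chosen ⊎ a ∈ map face A.rest → Either a
      upper (inj₁ p) = there (there (∈-++⁺ˡ p))
      upper (inj₂ p) = rest∈ (past4 p)
      by : face x ≡ face c₁ ⊎ Ringed d k (face x) → Either (face x)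
      by (inj₁ e)              = here e
      by (inj₂ (inj₁ (i , e))) = subst Either (sym e) (bottom i)
      by (inj₂ (inj₂ p))       = upper (A.all-faces p)

    chosen-unique : Unique (map face ((c₁ ∷ Cs) ++ Ns))
    chosen-unique = faces-unique ((c₁ ∷ Cs) ++ Ns)
      (trans (length-++ (c₁ ∷ Cs)) (trans (lem (length A.chosen) (length A.rest)) (cong (6 +_) A.face-count))) chosen-cover
      where
      lem : ∀ a b → suc (suc a) + suc (suc (suc (suc b))) ≡ 6 + (a + b)
      lem = solve-∀

    visits : ∀ v → v ∈ map vert HL
    visits v = by (covers v)
      where
      in-arc : ∀ {v} → v ∈ map vert A.arc → v ∈ map vert HL
      in-arc {v} p = there (subst (v ∈_) (sym (map-++ vert A.arc tail)) (∈-++⁺ˡ p))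
      in-tail : ∀ {v} → v ∈ map vert tail → v ∈ map vert HL
      in-tail {v} p = there (subst (v ∈_) (sym (map-++ vert A.arc tail)) (∈-++⁺ʳ (map vert A.arc) p))
      inner-vertex : ∀ i → vert (d (suc i)) ≡ vert (α (σ (d i)))
      inner-vertex i = cong vert (sym (blink i))
      by : (∃[ i ] v ≡ vert (d i)) ⊎ InTube d (suc k) v → v ∈ map vert HL
      by (inj₁ (i , refl)) = mod5-values (_∈ map vert HL) (vert ∘ d) (λ i → cong vert (periodic i))
        (in-tail (at2 (trans (cong vert (sym d5)) (inner-vertex 4)))) (here refl)
        (in-tail (past4 (at1 (inner-vertex 1)))) (in-tail (at4 (inner-vertex 2))) (in-tail (at3 (inner-vertex 3))) i
      by (inj₂ (inj₁ (i , refl))) = mod5-values (_∈ map vert HL) (vert ∘ α ∘ d) (λ i → cong (vert ∘ α) (periodic i))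
        (in-tail (at1 refl)) (in-arc (A.covers-w (at0 refl))) (in-arc (A.covers-w (at1 refl))) (in-arc (A.covers-w (at2 refl))) (in-arc (A.covers-w (at3 refl))) i
      by (inj₂ (inj₂ (inj₁ (i , refl)))) = mod5-values (_∈ map vert HL) (vert ∘ E d) (λ i → cong vert (E-periodic {d} periodic i))
        (in-tail (at0 refl)) (in-arc (A.covers-u (at0 refl))) (in-arc (A.covers-u (at1 refl))) (in-arc (A.covers-u (at2 refl))) (in-arc (A.covers-u (at3 refl))) i
      by (inj₂ (inj₂ (inj₂ p))) = in-arc (A.covers p)

    HL-length : length HL ≡ 20 + 10 * k
    HL-length = cong suc (trans (length-++ A.arc) (trans (cong (_+ 6) A.arc-length) (lem k)))
      where
      lem : ∀ k → 13 + 10 * k + 6 ≡ 19 + 10 * k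
      lem = solve-∀

    HL-unique : Unique (map vert HL)
    HL-unique = #-list-unique (λ _ → true) (map vert HL) (λ v _ → visits v)
      (≤-reflexive (trans (length-map vert HL) (trans HL-length (trans (sym size) (sym (∑1-Fin V))))))

    HL-walk : Walk (vert (d 1)) HL (vert (d 1))
    HL-walk = step refl (walk-++ A.walk (step refl (step (cong vert (sym (up 0)))
      (step (trans (cong vert (blink 4)) (trans (cong vert d5) (cong vert (sym (α-invol (d 0))))) ) (step (inward 3) (step (inward 2) (step (inward 1)
        (stop (cong vert (α-invol (σ (d 1))))))))))))
      where
      inward : ∀ i → vert (α (σ (d i))) ≡ vert (α (α (σ (d (suc i)))))
      inward i = trans (cong vert (blink i)) (cong vert (sym (α-invol (σ (d (suc i))))))

    good : All (λ y → face y ∈ map face (c₁ ∷ Cs) × face (α y) ∈ map face Ns) HL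
    good = (at1 refl , at0 (face-αd 1)) ∷ All.++⁺ (All.map lift A.good)
      ((at1 (face-iter 2 (d 1)) , past4 (subst (_∈ map face A.rest) (sym wrap) (A.unchosen (at0 refl))))
      ∷ (at1 (face-αd 0) , at3 (trans (cong face (α-invol (d 0))) (cong face (sym d5))))
      ∷ (at0 (face-centre 4) , at3 (opposite 4))
      ∷ (at0 (face-centre 3) , at2 (opposite 3))
      ∷ (at0 (face-centre 2) , at1 (opposite 2))
      ∷ (at0 (face-centre 1) , at0 (opposite 1))
      ∷ [])
      where
      wrap : face (α (ϕ (ϕ (d 1)))) ≡ face (E d 5)
      wrap = trans (cong (λ x → face (α (ϕ (ϕ x)))) (sym (periodic 1))) (U.above-ϕϕ 4)
      opposite : ∀ i → face (α (α (σ (d i)))) ≡ face (d (suc i))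
      opposite i = trans (cong face (α-invol (σ (d i)))) (face-σd i)
      lower : ∀ {i a} → i ∈ four → a ≡ face (d (suc i)) → a ∈ map face Ns
      lower (at0 refl) e = at0 e
      lower (at1 refl) e = at1 e
      lower (at2 refl) e = at2 e
      lower (at3 refl) e = at3 e
      lift : ∀ {y} → A.Good y → face y ∈ map face (c₁ ∷ Cs) × face (α y) ∈ map face Ns
      lift (p , inj₁ q)           = there (there p) , past4 q
      lift (p , inj₂ (i , m , e)) = there (there p) , lower m e

    chain : Linked Adjacent (c₁ ∷ Cs)
    chain = (c₁ , refl , sym (trans (cong face (α-invol (σ (d 0)))) (face-σd 0))) ∷ A.chain (d 1) refl

    module D = Disc c₁ Cs Ns HL chosen-unique (closed-walk HL (subst (3 ≤_) (sym HL-length) (s≤s (s≤s (s≤s z≤n)))) HL-unique HL-walk) visits good chain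

    ham-face-path : HamFacePath α c₁ c₂ 2 (tops4 k)
    ham-face-path = D.ham-face-path
      -- The path begins with two pentagons of the first cap; the only other pentagons on it are
      -- `A.ts`, in the second cap.
      (keep (pentagon-c₁ , cap₁-centre) (keep (pentagon-d 0 , cap₁-d1) (tagged-++ (tagged-none (All.map (λ h p → Hexagon⇒¬Pentagon h (proj₁ p)) A.hex))
        (tagged-none (All.map (λ t p → disjoint-caps _ (proj₂ p) (proj₂ (cap₂-top t))) A.tops)))))
      (skip (λ p → disjoint-caps c₁ cap₁-centre (proj₂ p)) (skip (λ p → disjoint-caps (d 1) cap₁-d1 (proj₂ p))
        (subst (Tagged _ A.chosen) A.top-count (tagged-++ (tagged-none (All.map (λ h p → Hexagon⇒¬Pentagon h (proj₁ p)) A.hex)) (tagged-all (All.map cap₂-top A.tops))))))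
      (keep pentagon-c₁ (keep (pentagon-d 0)
        (subst (Tagged _ A.chosen) A.top-count (tagged-++ (tagged-none (All.map Hexagon⇒¬Pentagon A.hex)) (tagged-all (All.map (λ t → proj₁ (cap₂-top t)) A.tops))))))

    ham-cycle : HasHamiltonCycle α
    ham-cycle = ClosedWalk.cycle CW , D.hamilton
      where CW = closed-walk HL (subst (3 ≤_) (sym HL-length) (s≤s (s≤s (s≤s z≤n)))) HL-unique HL-walk

    result : HasHamiltonCycle α ×
      (∀ h → NumHexFaces α h →
        (h % 2 ≡ 1 → ∃[ c₁ ] ∃[ c₂ ] (IsPentacap α c₁ × IsPentacap α c₂ × DisjointCaps α c₁ c₂ × HamFacePath α c₁ c₂ 2 2)) ×
        (h % 2 ≡ 0 → ∃[ c₁ ] ∃[ c₂ ] (IsPentacap α c₁ × IsPentacap α c₂ × DisjointCaps α c₁ c₂ × HamFacePath α c₁ c₂ 2 4)))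
    result = ham-cycle , λ h num →
        (λ odd → c₁ , c₂ , pentacap₁ , pentacap₂ , disjoint-caps ,
          subst (HamFacePath α c₁ c₂ 2) (odd⇒2 k (trans (cong (_% 2) (sym (hexagons k h size num))) odd)) ham-face-path)
      , (λ even → c₁ , c₂ , pentacap₁ , pentacap₂ , disjoint-caps ,
          subst (HamFacePath α c₁ c₂ 2) (even⇒4 k (trans (cong (_% 2) (sym (hexagons k h size num))) even)) ham-face-path)

theorem3p1 : ∀ (V : ℕ) (α : Dart V → Dart V) →
    IsFullerene α → HasNontrivialCyclic5Cut α →
    HasHamiltonCycle α ×
    (∀ h → NumHexFaces α h →
    (h % 2 ≡ 1 → ∃[ c₁ ] ∃[ c₂ ] (IsPentacap α c₁ × IsPentacap α c₂ × DisjointCaps α c₁ c₂ ×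
    HamFacePath α c₁ c₂ 2 2)) ×
    (h % 2 ≡ 0 → ∃[ c₁ ] ∃[ c₂ ] (IsPentacap α c₁ × IsPentacap α c₂ × DisjointCaps α c₁ c₂ ×
    HamFacePath α c₁ c₂ 2 4)))
theorem3p1 V α full H = finish (build (cap-set H))
  where
  open Assembly α full
  finish : Nanotube → _
  finish N = Final.result N (arc4 k d periodic up tube)
    where open Nanotube N
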